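{- Let $\mathscr{M}=(X,\mathcal I)$ and $\mathscr{N}=(Y,\mathcal J)$ be matroids, and let $\Phi:\mathscr M\to\mathscr N$ be a morphism of matroids. Let $\omega:X\to\mathbb R_{>0}$ be a positive weight function and let $1\le k<\mathrm{rk}(\mathscr M)$. Then $$\mathrm B_\omega(k)^2\ \ge\ \Bigl(1+\frac1k\Bigr)\Bigl(1+\frac{1}{p(k-1)-1}\Bigr)\,\mathrm B_\omega(k-1)\,\mathrm B_\omega(k+1).$$
   Context: Matroids are finite, given by ground set and independent sets. The rank functions of $\mathscr M$ and $\mathscr N$ are $f(S)=\max\{|A|:A\subseteq S, A\in\mathcal I\}$ for $S\subseteq X$, and $g$ defined likewise on subsets of $Y$; $\mathrm{rk}(\mathscr M)=f(X)$, $\mathrm{rk}(\mathscr N)=g(Y)$. A morphism $\Phi:\mathscr M\to\mathscr N$ is a function $\Phi:X\to Y$ with $g(\Phi(T))-g(\Phi(S))\le f(T)-f(S)$ for all $S\subseteq T\subseteq X$. A set $S\in\mathcal I$ is a basis of $\Phi$ if $g(\Phi(S))=\mathrm{rk}(\mathscr N)$. Let $\mathcal B$ be the set of bases of $\Phi$ and $\mathcal B_j=\{S\in\mathcal B:|S|=j\}$. Put $\omega(S)=\prod_{x\in S}\omega(x)$ and $\mathrm B_\omega(j)=\sum_{S\in\mathcal B_j}\omega(S)$. For $S\in\mathcal I$, let $\mathrm{Cont}(S)=\{x\in X\setminus S: S\cup\{x\}\in\mathcal I\}$. For $x,y\in\mathrm{Cont}(S)$ write $x\sim_S y$ if $x=y$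 or $S\cup\{x,y\}\notin\mathcal I$; this is an equivalence relation, and $\mathrm{Par}(S)$ denotes its set of equivalence classes (parallel classes). Let $p(j)=\max\{|\mathrm{Par}(S)|:S\in\mathcal B_j\}$, with $p(j)=0$ if $\mathcal B_j=\varnothing$. -}

module Defs where

open import Algebra.Bundles using (CommutativeMonoid)
open import Data.Bool.Properties as Bool using ()
open import Data.Fin.Base using (Fin)
open import Data.Fin.Properties as Fin using (any?)
open import Data.Fin.Subset
  using (Subset; inside; outside; _∈_; _∉_; _⊆_; _∪_; ⁅_⁆; ∣_∣; ⊤)
open import Data.Fin.Subset.Properties using (_∈?_; _⊆?_)
open import Data.Integer.Base as ℤ using (ℤ; +_; -[1+_])
open import Data.List.Base using (List; []; _∷_; _++_; map; filter; foldr; length; allFin)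
open import Data.List.Extrema.Nat using (max)
open import Data.Nat.Base as ℕ using (ℕ; zero; suc; _⊔_)
import Data.Nat.Properties as ℕ
open import Data.Product.Base using (∃; _×_; _,_; proj₁; proj₂)
open import Data.Rational.Base as ℚ using (ℚ; 0ℚ; 1ℚ; ½)
import Data.Rational.Properties as ℚ
open import Data.Sum.Base using (_⊎_)
open import Data.Vec.Base using (tabulate; []; _∷_)
open import Data.Vec.Properties using (≡-dec)
open import Level using (0ℓ)
open import Relation.Binary.Definitions using () renaming (Decidable to Decidable₂)
open import Relation.Binary.PropositionalEquality using (_≡_; sym; cong; cong₂; subst)
open import Relation.Nullary.Decidable using (does; _×-dec_; _⊎-dec_; ¬?)
open import Relation.Nullary.Negation using (¬_)
open import Relation.Unary using (Pred; Decidable)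

-- The real numbers, as Cauchy sequences of rationals.  Propositional
-- equality of sequences is finer than equality of reals, so reals are
-- only ever compared through _<ᴿ_ and _≤ᴿ_.

IsCauchy : (ℕ → ℚ) → Set
IsCauchy s = ∀ ε → 0ℚ ℚ.< ε →
  ∃ λ N → ∀ m n → N ℕ.≤ m → N ℕ.≤ n → ℚ.∣ s m ℚ.- s n ∣ ℚ.< ε

record ℝ : Set where
  constructor mkℝ
  field
    seq    : ℕ → ℚ
    cauchy : IsCauchy seq

open ℝ public

private
  open import Algebra.Properties.CommutativeSemigroup
    (CommutativeMonoid.commutativeSemigroup ℚ.+-0-commutativeMonoid) using (interchange)
  open ℚ.≤-Reasoning

  half+half : ∀ ε → ½ ℚ.* ε ℚ.+ ½ ℚ.* ε ≡ ε
  half+half ε = begin-equality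
    ½ ℚ.* ε ℚ.+ ½ ℚ.* ε  ≡⟨ ℚ.*-distribʳ-+ ε ½ ½ ⟨
    1ℚ ℚ.* ε             ≡⟨ ℚ.*-identityˡ ε ⟩
    ε                    ∎

  sum-diff : ∀ a b c d → (a ℚ.+ b) ℚ.- (c ℚ.+ d) ≡ (a ℚ.- c) ℚ.+ (b ℚ.- d)
  sum-diff a b c d = begin-equality
    (a ℚ.+ b) ℚ.+ ℚ.- (c ℚ.+ d)        ≡⟨ cong ((a ℚ.+ b) ℚ.+_) (ℚ.neg-distrib-+ c d) ⟩
    (a ℚ.+ b) ℚ.+ (ℚ.- c ℚ.+ ℚ.- d)    ≡⟨ interchange a b (ℚ.- c) (ℚ.- d) ⟩
    (a ℚ.- c) ℚ.+ (b ℚ.- d)            ∎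

  decompose : ∀ a b → a ≡ b ℚ.+ (a ℚ.- b)
  decompose a b = begin-equality
    a                        ≡⟨ ℚ.+-identityʳ a ⟨
    a ℚ.+ 0ℚ                 ≡⟨ cong (a ℚ.+_) (ℚ.+-inverseˡ b) ⟨
    a ℚ.+ (ℚ.- b ℚ.+ b)      ≡⟨ ℚ.+-assoc a (ℚ.- b) b ⟨
    (a ℚ.- b) ℚ.+ b          ≡⟨ ℚ.+-comm (a ℚ.- b) b ⟩
    b ℚ.+ (a ℚ.- b)          ∎

  telescope : ∀ p q r → p ℚ.- r ≡ (p ℚ.- q) ℚ.+ (q ℚ.- r)
  telescope p q r = begin-equality
    p ℚ.- r                              ≡⟨ cong (ℚ._- r) (decompose p q) ⟩
    (q ℚ.+ (p ℚ.- q)) ℚ.- r              ≡⟨ cong (ℚ._- r) (ℚ.+-comm q (p ℚ.- q)) ⟩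
    ((p ℚ.- q) ℚ.+ q) ℚ.- r              ≡⟨ ℚ.+-assoc (p ℚ.- q) q (ℚ.- r) ⟩
    (p ℚ.- q) ℚ.+ (q ℚ.- r)              ∎

  *-distribˡ-- : ∀ a b c → a ℚ.* (b ℚ.- c) ≡ a ℚ.* b ℚ.- a ℚ.* c
  *-distribˡ-- a b c = begin-equality
    a ℚ.* (b ℚ.- c)                ≡⟨ ℚ.*-distribˡ-+ a b (ℚ.- c) ⟩
    a ℚ.* b ℚ.+ a ℚ.* (ℚ.- c)      ≡⟨ cong (a ℚ.* b ℚ.+_) (ℚ.neg-distribʳ-* a c) ⟨
    a ℚ.* b ℚ.- a ℚ.* c            ∎

  prod-diff : ∀ a b c d → (a ℚ.* b) ℚ.- (c ℚ.* d) ≡ a ℚ.* (b ℚ.- d) ℚ.+ d ℚ.* (a ℚ.- c)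
  prod-diff a b c d = begin-equality
    a ℚ.* b ℚ.- c ℚ.* d
      ≡⟨ telescope (a ℚ.* b) (a ℚ.* d) (c ℚ.* d) ⟩
    (a ℚ.* b ℚ.- a ℚ.* d) ℚ.+ (a ℚ.* d ℚ.- c ℚ.* d)
      ≡⟨ cong₂ (λ u v → (a ℚ.* b ℚ.- a ℚ.* d) ℚ.+ (u ℚ.- v)) (ℚ.*-comm a d) (ℚ.*-comm c d) ⟩
    (a ℚ.* b ℚ.- a ℚ.* d) ℚ.+ (d ℚ.* a ℚ.- d ℚ.* c)
      ≡⟨ cong₂ ℚ._+_ (*-distribˡ-- a b d) (*-distribˡ-- d a c) ⟨
    a ℚ.* (b ℚ.- d) ℚ.+ d ℚ.* (a ℚ.- c)
      ∎

  ½*-pos : ∀ ε → 0ℚ ℚ.< ε → 0ℚ ℚ.< ½ ℚ.* ε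
  ½*-pos ε 0<ε = ℚ.positive⁻¹ (½ ℚ.* ε) {{ℚ.pos*pos⇒pos ½ ε {{ℚ.positive 0<ε}}}}

  EventuallyBoundedBy : (ℕ → ℚ) → ℚ → ℕ → Set
  EventuallyBoundedBy s b N = ∀ n → N ℕ.≤ n → ℚ.∣ s n ∣ ℚ.≤ b

  bounded : ∀ x → ∃ λ b → 0ℚ ℚ.< b × ∃ (EventuallyBoundedBy (seq x) b)
  bounded (mkℝ s c) with c 1ℚ (ℚ.positive⁻¹ 1ℚ)
  ... | N , h = ℚ.∣ s N ∣ ℚ.+ 1ℚ
              , ℚ.+-mono-≤-< (ℚ.0≤∣p∣ (s N)) (ℚ.positive⁻¹ 1ℚ)
              , N , bound
    where
    bound : EventuallyBoundedBy s (ℚ.∣ s N ∣ ℚ.+ 1ℚ) N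
    bound n N≤n = begin
      ℚ.∣ s n ∣                        ≡⟨ cong ℚ.∣_∣ (decompose (s n) (s N)) ⟩
      ℚ.∣ s N ℚ.+ (s n ℚ.- s N) ∣      ≤⟨ ℚ.∣p+q∣≤∣p∣+∣q∣ (s N) (s n ℚ.- s N) ⟩
      ℚ.∣ s N ∣ ℚ.+ ℚ.∣ s n ℚ.- s N ∣  ≤⟨ ℚ.+-monoʳ-≤ ℚ.∣ s N ∣ (ℚ.<⇒≤ (h n N N≤n ℕ.≤-refl)) ⟩
      ℚ.∣ s N ∣ ℚ.+ 1ℚ                 ∎

fromℚ : ℚ → ℝ
fromℚ q = mkℝ (λ _ → q) λ ε 0<ε →
  0 , λ _ _ _ _ → subst (ℚ._< ε) (sym (cong ℚ.∣_∣ (ℚ.+-inverseʳ q))) 0<ε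

0ᴿ 1ᴿ : ℝ
0ᴿ = fromℚ 0ℚ
1ᴿ = fromℚ 1ℚ

infixl 6 _+ᴿ_
infixl 7 _*ᴿ_
infix  4 _<ᴿ_ _≤ᴿ_

_+ᴿ_ : ℝ → ℝ → ℝ
x +ᴿ y = mkℝ s s-cauchy
  where
  s : ℕ → ℚ
  s n = seq x n ℚ.+ seq y n

  s-cauchy : IsCauchy s
  s-cauchy ε 0<ε with cauchy x (½ ℚ.* ε) (½*-pos ε 0<ε) | cauchy y (½ ℚ.* ε) (½*-pos ε 0<ε)
  ... | M , hx | N , hy = M ⊔ N , λ m n m≥ n≥ → close m n
          (hx m n (ℕ.m⊔n≤o⇒m≤o M N m≥) (ℕ.m⊔n≤o⇒m≤o M N n≥))
          (hy m n (ℕ.m⊔n≤o⇒n≤o M N m≥) (ℕ.m⊔n≤o⇒n≤o M N n≥))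
    where
    close : ∀ m n → ℚ.∣ seq x m ℚ.- seq x n ∣ ℚ.< ½ ℚ.* ε →
            ℚ.∣ seq y m ℚ.- seq y n ∣ ℚ.< ½ ℚ.* ε → ℚ.∣ s m ℚ.- s n ∣ ℚ.< ε
    close m n p q = begin-strict
      ℚ.∣ s m ℚ.- s n ∣
        ≡⟨ cong ℚ.∣_∣ (sum-diff (seq x m) (seq y m) (seq x n) (seq y n)) ⟩
      ℚ.∣ (seq x m ℚ.- seq x n) ℚ.+ (seq y m ℚ.- seq y n) ∣
        ≤⟨ ℚ.∣p+q∣≤∣p∣+∣q∣ (seq x m ℚ.- seq x n) (seq y m ℚ.- seq y n) ⟩
      ℚ.∣ seq x m ℚ.- seq x n ∣ ℚ.+ ℚ.∣ seq y m ℚ.- seq y n ∣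
        <⟨ ℚ.+-mono-< p q ⟩
      ½ ℚ.* ε ℚ.+ ½ ℚ.* ε
        ≡⟨ half+half ε ⟩
      ε ∎

_*ᴿ_ : ℝ → ℝ → ℝ
x *ᴿ y = mkℝ s s-cauchy
  where
  s : ℕ → ℚ
  s n = seq x n ℚ.* seq y n

  s-cauchy : IsCauchy s
  s-cauchy ε 0<ε with bounded x | bounded y
  ... | a , 0<a , K , ha | b , 0<b , L , hb = K ⊔ L ⊔ (M ⊔ N) , λ m n m≥ n≥ → close m n
          (ha m (ℕ.m⊔n≤o⇒m≤o K L (ℕ.m⊔n≤o⇒m≤o (K ⊔ L) (M ⊔ N) m≥)))
          (hb n (ℕ.m⊔n≤o⇒n≤o K L (ℕ.m⊔n≤o⇒m≤o (K ⊔ L) (M ⊔ N) n≥)))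
          (proj₂ cx m n (ℕ.m⊔n≤o⇒m≤o M N (ℕ.m⊔n≤o⇒n≤o (K ⊔ L) (M ⊔ N) m≥))
                        (ℕ.m⊔n≤o⇒m≤o M N (ℕ.m⊔n≤o⇒n≤o (K ⊔ L) (M ⊔ N) n≥)))
          (proj₂ cy m n (ℕ.m⊔n≤o⇒n≤o M N (ℕ.m⊔n≤o⇒n≤o (K ⊔ L) (M ⊔ N) m≥))
                        (ℕ.m⊔n≤o⇒n≤o M N (ℕ.m⊔n≤o⇒n≤o (K ⊔ L) (M ⊔ N) n≥)))
    where
    instance
      a-pos : ℚ.Positive a
      a-pos = ℚ.positive 0<a
      b-pos : ℚ.Positive b
      b-pos = ℚ.positive 0<b
      ε-pos : ℚ.Positive ε
      ε-pos = ℚ.positive 0<ε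
      a+b-pos : ℚ.Positive (a ℚ.+ b)
      a+b-pos = ℚ.pos+pos⇒pos a b
      a+b≢0 : ℚ.NonZero (a ℚ.+ b)
      a+b≢0 = ℚ.pos⇒nonZero (a ℚ.+ b)

    δ : ℚ
    δ = ℚ.1/ (a ℚ.+ b) ℚ.* ε

    0<δ : 0ℚ ℚ.< δ
    0<δ = ℚ.positive⁻¹ δ
      {{ℚ.pos*pos⇒pos (ℚ.1/ (a ℚ.+ b)) {{ℚ.1/pos⇒pos (a ℚ.+ b)}} ε}}

    cx = cauchy x δ 0<δ
    cy = cauchy y δ 0<δ
    M  = proj₁ cx
    N  = proj₁ cy


    [a+b]δ≡ε : a ℚ.* δ ℚ.+ b ℚ.* δ ≡ ε
    [a+b]δ≡ε = begin-equality
      a ℚ.* δ ℚ.+ b ℚ.* δ                          ≡⟨ ℚ.*-distribʳ-+ δ a b ⟨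
      (a ℚ.+ b) ℚ.* (ℚ.1/ (a ℚ.+ b) ℚ.* ε)         ≡⟨ ℚ.*-assoc (a ℚ.+ b) (ℚ.1/ (a ℚ.+ b)) ε ⟨
      ((a ℚ.+ b) ℚ.* ℚ.1/ (a ℚ.+ b)) ℚ.* ε         ≡⟨ cong (ℚ._* ε) (ℚ.*-inverseʳ (a ℚ.+ b)) ⟩
      1ℚ ℚ.* ε                                     ≡⟨ ℚ.*-identityˡ ε ⟩
      ε                                            ∎

    scaled : ∀ c .{{_ : ℚ.Positive c}} u v → ℚ.∣ u ∣ ℚ.≤ c → ℚ.∣ v ∣ ℚ.< δ →
             ℚ.∣ u ℚ.* v ∣ ℚ.< c ℚ.* δ
    scaled c u v p q = begin-strict
      ℚ.∣ u ℚ.* v ∣         ≡⟨ ℚ.∣p*q∣≡∣p∣*∣q∣ u v ⟩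
      ℚ.∣ u ∣ ℚ.* ℚ.∣ v ∣   ≤⟨ ℚ.*-monoʳ-≤-nonNeg ℚ.∣ v ∣ {{ℚ.nonNegative (ℚ.0≤∣p∣ v)}} p ⟩
      c ℚ.* ℚ.∣ v ∣         <⟨ ℚ.*-monoʳ-<-pos c q ⟩
      c ℚ.* δ               ∎

    close : ∀ m n → ℚ.∣ seq x m ∣ ℚ.≤ a → ℚ.∣ seq y n ∣ ℚ.≤ b →
            ℚ.∣ seq x m ℚ.- seq x n ∣ ℚ.< δ → ℚ.∣ seq y m ℚ.- seq y n ∣ ℚ.< δ →
            ℚ.∣ s m ℚ.- s n ∣ ℚ.< ε
    close m n xm≤a yn≤b dx dy = begin-strict
      ℚ.∣ s m ℚ.- s n ∣
        ≡⟨ cong ℚ.∣_∣ (prod-diff (seq x m) (seq y m) (seq x n) (seq y n)) ⟩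
      ℚ.∣ seq x m ℚ.* (seq y m ℚ.- seq y n) ℚ.+ seq y n ℚ.* (seq x m ℚ.- seq x n) ∣
        ≤⟨ ℚ.∣p+q∣≤∣p∣+∣q∣ (seq x m ℚ.* (seq y m ℚ.- seq y n)) (seq y n ℚ.* (seq x m ℚ.- seq x n)) ⟩
      ℚ.∣ seq x m ℚ.* (seq y m ℚ.- seq y n) ∣ ℚ.+ ℚ.∣ seq y n ℚ.* (seq x m ℚ.- seq x n) ∣
        <⟨ ℚ.+-mono-< (scaled a (seq x m) (seq y m ℚ.- seq y n) xm≤a dy)
                      (scaled b (seq y n) (seq x m ℚ.- seq x n) yn≤b dx) ⟩
      a ℚ.* δ ℚ.+ b ℚ.* δ
        ≡⟨ [a+b]δ≡ε ⟩
      ε ∎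

_<ᴿ_ : ℝ → ℝ → Set
x <ᴿ y = ∃ λ ε → 0ℚ ℚ.< ε × ∃ λ N → ∀ n → N ℕ.≤ n → seq x n ℚ.+ ε ℚ.≤ seq y n

-- A termwise comparison up to arbitrarily small ε, since seq x n ≤ seq y n
-- may fail for every n even when the two limits agree.
_≤ᴿ_ : ℝ → ℝ → Set
x ≤ᴿ y = ∀ ε → 0ℚ ℚ.< ε → ∃ λ N → ∀ n → N ℕ.≤ n → seq x n ℚ.≤ seq y n ℚ.+ ε

sumᴿ prodᴿ : List ℝ → ℝ
sumᴿ  = foldr _+ᴿ_ 0ᴿ
prodᴿ = foldr _*ᴿ_ 1ᴿ

-- Total reciprocal of an integer, with the convention 1/0 = 0.  It is applied
-- to k ≥ 1 and to p(k-1) - 1 for k < rk M.  The latter is never 0: an independent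
-- set of size k-1 extends to one of size k+1, which gives two distinct parallel
-- classes, so p(k-1) ≥ 2 unless there are no bases of size k-1 and p(k-1) = 0.
recip : ℤ → ℚ
recip (+ zero)  = 0ℚ
recip (+ suc n) = + 1 ℚ./ suc n
recip -[1+ n ]  = -[1+ 0 ] ℚ./ suc n

subsets : ∀ n → List (Subset n)
subsets zero    = [] ∷ []
subsets (suc n) = map (outside ∷_) (subsets n) ++ map (inside ∷_) (subsets n)

comprehension : ∀ {n} {P : Pred (Fin n) 0ℓ} → Decidable P → Subset n
comprehension P? = tabulate (λ x → does (P? x))

image : ∀ {n m} → (Fin n → Fin m) → Subset n → Subset m
image φ S = comprehension (λ y → any? (λ x → (x ∈? S) ×-dec (φ x Fin.≟ y)))

record Matroid (n : ℕ) : Set₁ where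
  field
    Indep      : Pred (Subset n) 0ℓ
    indep?     : Decidable Indep
    nonempty   : ∃ Indep
    hereditary : ∀ {S T} → S ⊆ T → Indep T → Indep S
    exchange   : ∀ {S T} → Indep S → Indep T → ∣ S ∣ ℕ.< ∣ T ∣ →
                 ∃ λ x → x ∈ T × x ∉ S × Indep (S ∪ ⁅ x ⁆)

  rank : Subset n → ℕ
  rank S = max 0 (map ∣_∣ (filter (λ A → (A ⊆? S) ×-dec indep? A) (subsets n)))

  rk : ℕ
  rk = rank ⊤

  Cont : Subset n → Pred (Fin n) 0ℓ
  Cont S x = x ∉ S × Indep (S ∪ ⁅ x ⁆)

  cont? : ∀ S → Decidable (Cont S)
  cont? S x = ¬? (x ∈? S) ×-dec indep? (S ∪ ⁅ x ⁆)

  -- The relation x ∼_S y, an equivalence only when restricted to Cont S.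
  Parallel : Subset n → Fin n → Fin n → Set
  Parallel S x y = x ≡ y ⊎ ¬ Indep (S ∪ (⁅ x ⁆ ∪ ⁅ y ⁆))

  parallel? : ∀ S → Decidable₂ (Parallel S)
  parallel? S x y = (x Fin.≟ y) ⊎-dec ¬? (indep? (S ∪ (⁅ x ⁆ ∪ ⁅ y ⁆)))

  parallelClass : Subset n → Fin n → Subset n
  parallelClass S x = comprehension (λ y → cont? S y ×-dec parallel? S x y)

  IsParallelClass : Subset n → Pred (Subset n) 0ℓ
  IsParallelClass S C = ∃ λ x → Cont S x × C ≡ parallelClass S x

  isParallelClass? : ∀ S → Decidable (IsParallelClass S)
  isParallelClass? S C = any? (λ x → cont? S x ×-dec ≡-dec Bool._≟_ C (parallelClass S x))

  -- Classes are listed as subsets of the ground set, hence without repetition.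
  Par : Subset n → List (Subset n)
  Par S = filter (isParallelClass? S) (subsets n)

open Matroid public

record Morphism {n m : ℕ} (M : Matroid n) (N : Matroid m) : Set where
  field
    fun      : Fin n → Fin m
    rankDrop : ∀ {S T} → S ⊆ T →
               + rank N (image fun T) ℤ.- + rank N (image fun S)
                 ℤ.≤ + rank M T ℤ.- + rank M S

module _ {n m : ℕ} {M : Matroid n} {N : Matroid m} (Φ : Morphism M N) where
  open Morphism Φ

  IsBasis : Pred (Subset n) 0ℓ
  IsBasis S = Indep M S × rank N (image fun S) ≡ rk N

  isBasis? : Decidable IsBasis
  isBasis? S = indep? M S ×-dec (rank N (image fun S) ℕ.≟ rk N)

  bases : ℕ → List (Subset n)
  bases j = filter (λ S → isBasis? S ×-dec (∣ S ∣ ℕ.≟ j)) (subsets n)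

  -- p(j); the base value 0 also covers the case of no bases of size j.
  maxPar : ℕ → ℕ
  maxPar j = max 0 (map (λ S → length (Par M S)) (bases j))

  module _ (ω : Fin n → ℝ) where

    weight : Subset n → ℝ
    weight S = prodᴿ (map ω (filter (_∈? S) (allFin n)))

    B : ℕ → ℝ
    B j = sumᴿ (map weight (bases j))

{-# OPTIONS --safe #-}
module Submission where

-- Real inequalities between Cauchy sequences are checked termwise, so the weights may
-- be taken rational.  For S ⊆ X put F_d(S) = d! Σ ω(T ∖ S) over the bases T ⊇ S of Φ
-- with |T| = |S| + d, let c = 1 + 1/(p(k-1) - 1), and let A_d(S) be the symmetric matrix
-- on X ∪ {0} with entries
--   A₀₀ = c F_d(S),  A₀ₓ = ω(x) F_d(S + x),  Aₓᵧ = ω(x) ω(y) F_d(S + x + y),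
-- read as 0 when x or y is not new.
-- The claim is that A_{k-1-|S|}(S) is negative semidefinite on some hyperplane.  For
-- S = ∅ the resulting reverse Cauchy–Schwarz inequality for the vectors e₀ and 1_X
-- reads c F_{k-1}(∅) F_{k+1}(∅) ≤ F_k(∅)², which is the theorem.  The claim goes by
-- induction on k-1-|S|, as in the combinatorial atlas of Chan and Pak.  For |S| = k-1
-- the matrix is that of a complete multipartite graph, or, if S is a basis, of a cone
-- over one with at most p(k-1) parts; this is where c comes from.  The inductive step
-- is a local-to-global argument: A_d(S) is the weighted sum of the matrices
-- A_{d-1}(S + x), and connectivity of its graph suffices to combine their inequalities.
-- Eigenvectors, which need not be rational, are replaced by solving a graph Laplacian
-- equation over ℚ.

open import Defs
open import Data.Fin.Base using (Fin)
open import Data.Integer.Base as ℤ using (+_)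
open import Data.Nat.Base using (ℕ; suc; _∸_; _≤_; _<_)
open import Data.Rational.Base as ℚ using (1ℚ)

open import Algebra.Bundles using (CommutativeRing)
open import Data.Bool.Base using (true; false; if_then_else_)
open import Data.Bool.Properties as Bool using ()
open import Data.Empty using () renaming (⊥ to Empty)
open import Data.Fin.Base using (zero; suc)
open import Data.Fin.Properties as Fin using ()
open import Data.Fin.Subset using (Subset; inside; outside; _∈_; _∉_; _⊆_; _∪_; ⁅_⁆; ∣_∣; ⊥)
open import Data.Fin.Subset.Properties
  using (_∈?_; _⊆?_; ⊆-antisym; ⊆-refl; ⊆-trans; ⊆-max; ⊆-min; x∈⁅x⁆; x∈⁅y⁆⇒x≡y; x∈p∪q⁺; x∈p∪q⁻;
         p⊆p∪q; p⊆q⇒∣p∣≤∣q∣; ∪-comm; ∪-assoc; ∪-identityʳ; ∣⊥∣≡0)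
import Data.Integer.Properties as ℤ
open import Data.List.Base as List using (List; []; _∷_; _++_; map; filter; foldr; length; allFin)
open import Data.List.Extrema.Nat using (xs≤max; argmax-sel)
import Data.List.Membership.Propositional as List
open import Data.List.Membership.Propositional.Properties
  using (∈-map⁺; ∈-map⁻; ∈-++⁺ˡ; ∈-++⁺ʳ; ∈-filter⁺; ∈-filter⁻)
import Data.List.Properties as List
open import Data.List.Relation.Unary.All as All using ()
open import Data.List.Relation.Unary.Any using (here)
open import Data.Nat.Base as ℕ using (zero)
import Data.Nat.Properties as ℕ
open import Data.Product.Base using (∃; ∃₂; _×_; _,_; proj₁; proj₂)
open import Data.Rational.Base using (ℚ; 0ℚ; _+_; _*_; _-_; -_)
import Data.Rational.Properties as ℚ
open import Data.Rational.Solver using (module +-*-Solver)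
import Data.Rational.Unnormalised.Base as ℚᵘ
import Data.Rational.Unnormalised.Properties as ℚᵘ
open import Data.Sum.Base using (_⊎_; inj₁; inj₂; [_,_]′)
open import Data.Vec.Base as Vec using (here; there)
open import Data.Vec.Properties as Vec using (lookup∘tabulate; lookup⇒[]=; []=⇒lookup)
open import Function.Base using (_∘_; id)
open import Level using (0ℓ)
open import Relation.Binary.Definitions using (tri<; tri≈; tri>) renaming (Decidable to Decidable₂)
open import Relation.Binary.PropositionalEquality
  using (_≡_; _≢_; refl; sym; trans; cong; cong₂; subst; subst₂; module ≡-Reasoning)
open import Relation.Nullary.Decidable using (Dec; yes; no; does; ¬?; _×-dec_; dec-true; decidable-stable)
open import Relation.Nullary.Negation using (¬_; contradiction)
open import Relation.Unary using (Pred; Decidable)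

open import Algebra.Properties.Semiring.Sum
  (CommutativeRing.semiring ℚ.+-*-commutativeRing)
  using (sum; sum-cong-≗; ∑-distrib-+; ∑-comm; *-distribˡ-sum; sum-replicate-zero)
open +-*-Solver using (solve; _:=_; _:+_; _:*_; _:-_; :-_; con)

-- Inequalities and finite sums over ℚ

-- The coordinate 0 homogenises: it stands for a dummy element, so that three consecutive levels
-- become entries of one quadratic form. A sum of forms that are negative semidefinite on
-- hyperplanes need not be so on any, hence the inductive step cannot simply add. What binds the
-- local forms together is that contracting the matrix at S + x with 1_X gives, up to the weight,
-- row x of the matrix at S. The usual argument then rescales by square roots of the degrees and
-- compares with a Perron eigenvector; the Laplacian equation does this work over ℚ, and by
-- connectivity the only obstruction to solving it is the sum of the right-hand side. The factor c
-- stands in the corner alone and is the same for every S, so it survives the summation. A cone over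
-- N ≥ 2 parts tolerates c up to N/(N-1), which decreases in N; hence the maximum p(k-1). Degenerate
-- cases are governed by a fixed basis of Φ with k + 1 elements: extendable sets are completed by
-- exchange against it, so that nonzero entries force positive degrees. If there is no such basis,
-- B(k+1) = 0.

*-nonneg : ∀ {p q} → 0ℚ ℚ.≤ p → 0ℚ ℚ.≤ q → 0ℚ ℚ.≤ p * q
*-nonneg {p} {q} 0≤p 0≤q =
  ℚ.nonNegative⁻¹ (p * q) {{ℚ.nonNeg*nonNeg⇒nonNeg p {{ℚ.nonNegative 0≤p}} q {{ℚ.nonNegative 0≤q}}}}

*-pos : ∀ {p q} → 0ℚ ℚ.< p → 0ℚ ℚ.< q → 0ℚ ℚ.< p * q
*-pos {p} {q} 0<p 0<q =
  ℚ.positive⁻¹ (p * q) {{ℚ.pos*pos⇒pos p {{ℚ.positive 0<p}} q {{ℚ.positive 0<q}}}}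

*-monoˡ-≤ : ∀ {p q r} → 0ℚ ℚ.≤ r → p ℚ.≤ q → r * p ℚ.≤ r * q
*-monoˡ-≤ {r = r} 0≤r = ℚ.*-monoˡ-≤-nonNeg r {{ℚ.nonNegative 0≤r}}

*-cancelˡ-≤ : ∀ {p q r} → 0ℚ ℚ.< r → r * p ℚ.≤ r * q → p ℚ.≤ q
*-cancelˡ-≤ {r = r} 0<r = ℚ.*-cancelˡ-≤-pos r {{ℚ.positive 0<r}}

≤⇒0≤- : ∀ {p q} → p ℚ.≤ q → 0ℚ ℚ.≤ q - p
≤⇒0≤- {p} {q} p≤q = subst (ℚ._≤ q - p) (ℚ.+-inverseʳ p) (ℚ.+-monoˡ-≤ (- p) p≤q)

0≤-⇒≤ : ∀ {p q} → 0ℚ ℚ.≤ q - p → p ℚ.≤ q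
0≤-⇒≤ {p} {q} 0≤ = subst₂ ℚ._≤_ (ℚ.+-identityʳ p)
  (solve 2 (λ p q → p :+ (q :- p) := q) refl p q) (ℚ.+-monoʳ-≤ p 0≤)

square-nonneg : ∀ p → 0ℚ ℚ.≤ p * p
square-nonneg p with ℚ.≤-total 0ℚ p
... | inj₁ 0≤p = *-nonneg 0≤p 0≤p
... | inj₂ p≤0 = subst (0ℚ ℚ.≤_) (solve 1 (λ p → (:- p) :* (:- p) := p :* p) refl p)
                   (*-nonneg (ℚ.neg-antimono-≤ p≤0) (ℚ.neg-antimono-≤ p≤0))

≤0∨0< : ∀ p → p ℚ.≤ 0ℚ ⊎ 0ℚ ℚ.< p
≤0∨0< p with p ℚ.≤? 0ℚ
... | yes p≤0 = inj₁ p≤0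
... | no  p≰0 = inj₂ (ℚ.≰⇒> p≰0)

0<⇒≢0 : ∀ {p} → 0ℚ ℚ.< p → p ≢ 0ℚ
0<⇒≢0 0<p refl = ℚ.<-irrefl refl 0<p

≢0⇒0< : ∀ {p} → 0ℚ ℚ.≤ p → p ≢ 0ℚ → 0ℚ ℚ.< p
≢0⇒0< {p} 0≤p p≢0 = [ (λ p≤0 → contradiction (ℚ.≤-antisym p≤0 0≤p) p≢0) , (λ 0<p → 0<p) ]′ (≤0∨0< p)

square≢0 : ∀ {p} → p ≢ 0ℚ → 0ℚ ℚ.< p * p
square≢0 {p} p≢0 with ℚ.<-cmp 0ℚ p
... | tri< 0<p _ _ = *-pos 0<p 0<p
... | tri≈ _ 0≡p _ = contradiction (sym 0≡p) p≢0
... | tri> _ _ p<0 =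
  subst (0ℚ ℚ.<_) (solve 1 (λ p → (:- p) :* (:- p) := p :* p) refl p)
    (*-pos (ℚ.neg-antimono-< p<0) (ℚ.neg-antimono-< p<0))

square≡0 : ∀ {p} → p * p ≡ 0ℚ → p ≡ 0ℚ
square≡0 {p} pp≡0 with p ℚ.≟ 0ℚ
... | yes p≡0 = p≡0
... | no  p≢0 = contradiction pp≡0 (0<⇒≢0 (square≢0 p≢0))

*-cancelˡ-≡0 : ∀ {p q} → 0ℚ ℚ.< p → p * q ≡ 0ℚ → q ≡ 0ℚ
*-cancelˡ-≡0 {p} {q} 0<p pq≡0 with q ℚ.≟ 0ℚ
... | yes q≡0 = q≡0
... | no  q≢0 = contradiction
        (trans (solve 2 (λ p q → q :* q :* (p :* p) := (p :* q) :* (p :* q)) refl p q)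
               (trans (cong (λ e → e * e) pq≡0) (ℚ.*-zeroˡ 0ℚ)))
        (0<⇒≢0 (*-pos (square≢0 q≢0) (*-pos 0<p 0<p)))

sum-nonneg : ∀ {n} {f : Fin n → ℚ} → (∀ i → 0ℚ ℚ.≤ f i) → 0ℚ ℚ.≤ sum f
sum-nonneg {zero}  0≤f = ℚ.≤-refl
sum-nonneg {suc n} 0≤f = ℚ.+-mono-≤ (0≤f zero) (sum-nonneg (0≤f ∘ suc))

sum-mono : ∀ {n} {f g : Fin n → ℚ} → (∀ i → f i ℚ.≤ g i) → sum f ℚ.≤ sum g
sum-mono {zero}  f≤g = ℚ.≤-refl
sum-mono {suc n} f≤g = ℚ.+-mono-≤ (f≤g zero) (sum-mono (f≤g ∘ suc))

sum-zero : ∀ {n} {f : Fin n → ℚ} → (∀ i → f i ≡ 0ℚ) → sum f ≡ 0ℚ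
sum-zero {n} f≡0 = trans (sum-cong-≗ f≡0) (sum-replicate-zero n)

term≤sum : ∀ {n} {f : Fin n → ℚ} → (∀ i → 0ℚ ℚ.≤ f i) → ∀ i → f i ℚ.≤ sum f
term≤sum {suc n} {f} 0≤f zero = subst (ℚ._≤ sum f) (ℚ.+-identityʳ (f zero))
  (ℚ.+-monoʳ-≤ (f zero) (sum-nonneg (0≤f ∘ suc)))
term≤sum {suc n} {f} 0≤f (suc i) = subst (ℚ._≤ sum f) (ℚ.+-identityˡ (f (suc i)))
  (ℚ.+-mono-≤ (0≤f zero) (term≤sum (0≤f ∘ suc) i))

sum≡0⇒term≡0 : ∀ {n} {f : Fin n → ℚ} → (∀ i → 0ℚ ℚ.≤ f i) → sum f ≡ 0ℚ → ∀ i → f i ≡ 0ℚ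
sum≡0⇒term≡0 {f = f} 0≤f ∑≡0 i =
  ℚ.≤-antisym (subst (f i ℚ.≤_) ∑≡0 (term≤sum 0≤f i)) (0≤f i)

sum-pos⇒term-pos : ∀ {n} {f : Fin n → ℚ} → 0ℚ ℚ.< sum f → ∃ λ i → 0ℚ ℚ.< f i
sum-pos⇒term-pos {zero}  0<∑ = contradiction 0<∑ (ℚ.<-irrefl refl)
sum-pos⇒term-pos {suc n} {f} 0<∑ with ≤0∨0< (f zero)
... | inj₂ 0<f₀ = zero , 0<f₀
... | inj₁ f₀≤0 with sum-pos⇒term-pos (ℚ.<-≤-trans 0<∑ (subst (sum f ℚ.≤_)
                       (ℚ.+-identityˡ (sum (f ∘ suc))) (ℚ.+-monoˡ-≤ (sum (f ∘ suc)) f₀≤0)))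
...   | i , 0<fᵢ = suc i , 0<fᵢ

sum-lin : ∀ {n} a b (f g : Fin n → ℚ) → sum (λ i → a * f i + b * g i) ≡ a * sum f + b * sum g
sum-lin a b f g = trans (∑-distrib-+ (λ i → a * f i) (λ i → b * g i))
  (sym (cong₂ _+_ (*-distribˡ-sum a f) (*-distribˡ-sum b g)))

sum-sub : ∀ {n} (f g : Fin n → ℚ) → sum (λ i → f i - g i) ≡ sum f - sum g
sum-sub f g = begin
  sum (λ i → f i - g i)                ≡⟨ sum-cong-≗ (λ i → lem (f i) (g i)) ⟩
  sum (λ i → 1ℚ * f i + (- 1ℚ) * g i)  ≡⟨ sum-lin 1ℚ (- 1ℚ) f g ⟩
  1ℚ * sum f + (- 1ℚ) * sum g          ≡⟨ lem (sum f) (sum g) ⟨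
  sum f - sum g                        ∎
  where
  open ≡-Reasoning
  lem : ∀ p q → p - q ≡ 1ℚ * p + (- 1ℚ) * q
  lem = solve 2 (λ p q → p :- q := con 1ℚ :* p :+ (:- con 1ℚ) :* q) refl

-- Only the boolean `does` is inspected, so the indicator of a decision about `suc` indices or
-- longer characteristic vectors reduces by computation to that of the tails. The inductions below
-- rely on this.
𝟙 : ∀ {a} {A : Set a} → Dec A → ℚ
𝟙 d = if does d then 1ℚ else 0ℚ

𝟙-yes : ∀ {a} {A : Set a} (d : Dec A) → A → 𝟙 d ≡ 1ℚ
𝟙-yes (yes _) _ = refl
𝟙-yes (no ¬a) a = contradiction a ¬a

𝟙-no : ∀ {a} {A : Set a} (d : Dec A) → ¬ A → 𝟙 d ≡ 0ℚ
𝟙-no (yes a) ¬a = contradiction a ¬a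
𝟙-no (no _)  _  = refl

𝟙-cong : ∀ {a b} {A : Set a} {B : Set b} (d : Dec A) (e : Dec B) → (A → B) → (B → A) → 𝟙 d ≡ 𝟙 e
𝟙-cong (yes a) e to from = sym (𝟙-yes e (to a))
𝟙-cong (no ¬a) e to from = sym (𝟙-no e (¬a ∘ from))

𝟙-nonneg : ∀ {a} {A : Set a} (d : Dec A) → 0ℚ ℚ.≤ 𝟙 d
𝟙-nonneg (yes _) = ℚ.nonNegative⁻¹ 1ℚ
𝟙-nonneg (no _)  = ℚ.≤-refl

sum-δ : ∀ {n} (x : Fin n) (f : Fin n → ℚ) → sum (λ y → 𝟙 (x Fin.≟ y) * f y) ≡ f x
sum-δ {suc n} zero f = trans
  (cong₂ _+_ (ℚ.*-identityˡ (f zero)) (sum-zero (λ i → ℚ.*-zeroˡ (f (suc i)))))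
  (ℚ.+-identityʳ (f zero))
sum-δ {suc n} (suc x) f = trans
  (cong₂ _+_ (ℚ.*-zeroˡ (f zero)) (sum-δ x (f ∘ suc)))
  (ℚ.+-identityˡ (f (suc x)))

-- Symmetric forms

Vector : ℕ → Set
Vector n = Fin n → ℚ

Matrix : ℕ → Set
Matrix n = Fin n → Fin n → ℚ

Symmetric : ∀ {n} → Matrix n → Set
Symmetric M = ∀ i j → M i j ≡ M j i

dot : ∀ {n} → Vector n → Vector n → ℚ
dot u v = sum (λ i → u i * v i)

infixr 7 _·_
_·_ : ∀ {n} → Matrix n → Vector n → Vector n
(M · v) i = dot (M i) v

form : ∀ {n} → Matrix n → Vector n → Vector n → ℚ
form M u v = dot u (M · v)

dot-cong : ∀ {n} {u u′ v v′ : Vector n} → (∀ i → u i ≡ u′ i) → (∀ i → v i ≡ v′ i) → dot u v ≡ dot u′ v′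
dot-cong u≗ v≗ = sum-cong-≗ (λ i → cong₂ _*_ (u≗ i) (v≗ i))

dot-comm : ∀ {n} (u v : Vector n) → dot u v ≡ dot v u
dot-comm u v = sum-cong-≗ (λ i → ℚ.*-comm (u i) (v i))

dot-linʳ : ∀ {n} (w : Vector n) a b u v →
  dot w (λ i → a * u i + b * v i) ≡ a * dot w u + b * dot w v
dot-linʳ w a b u v = trans
  (sum-cong-≗ (λ i → solve 5 (λ w a b u v → w :* (a :* u :+ b :* v) := a :* (w :* u) :+ b :* (w :* v))
                       refl (w i) a b (u i) (v i)))
  (sum-lin a b (λ i → w i * u i) (λ i → w i * v i))

dot-linˡ : ∀ {n} (w : Vector n) a b u v →
  dot (λ i → a * u i + b * v i) w ≡ a * dot u w + b * dot v w
dot-linˡ w a b u v = begin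
  dot (λ i → a * u i + b * v i) w  ≡⟨ dot-comm _ w ⟩
  dot w (λ i → a * u i + b * v i)  ≡⟨ dot-linʳ w a b u v ⟩
  a * dot w u + b * dot w v        ≡⟨ cong₂ (λ p q → a * p + b * q) (dot-comm w u) (dot-comm w v) ⟩
  a * dot u w + b * dot v w        ∎
  where open ≡-Reasoning

form-cong : ∀ {n} {M M′ : Matrix n} {u u′ v v′ : Vector n} → (∀ i j → M i j ≡ M′ i j) →
  (∀ i → u i ≡ u′ i) → (∀ i → v i ≡ v′ i) → form M u v ≡ form M′ u′ v′
form-cong M≗ u≗ v≗ = dot-cong u≗ (λ i → dot-cong (M≗ i) v≗)

dot-sumʳ : ∀ {m n} (w : Vector n) (f : Fin m → Vector n) →
  dot w (λ x → sum (λ j → f j x)) ≡ sum (λ j → dot w (f j))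
dot-sumʳ w f = trans (sum-cong-≗ (λ x → *-distribˡ-sum (w x) (λ j → f j x)))
                     (∑-comm (λ x j → w x * f j x))

form-sym : ∀ {n} {M : Matrix n} → Symmetric M → ∀ u v → form M u v ≡ form M v u
form-sym {M = M} M-sym u v = begin
  sum (λ i → u i * dot (M i) v)            ≡⟨ dot-sumʳ u (λ j i → M i j * v j) ⟩
  sum (λ j → sum (λ i → u i * (M i j * v j)))
    ≡⟨ sum-cong-≗ (λ j → sum-cong-≗ (λ i → trans (cong (λ p → u i * (p * v j)) (M-sym i j))
         (solve 3 (λ u m v → u :* (m :* v) := v :* (m :* u)) refl (u i) (M j i) (v j)))) ⟩
  sum (λ j → sum (λ i → v j * (M j i * u i)))
    ≡⟨ sum-cong-≗ (λ j → sym (*-distribˡ-sum (v j) (λ i → M j i * u i))) ⟩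
  sum (λ j → v j * dot (M j) u)            ∎
  where open ≡-Reasoning

form-expand : ∀ {n} {M : Matrix n} → Symmetric M → ∀ a b u v →
  form M (λ i → a * u i + b * v i) (λ i → a * u i + b * v i) ≡
  a * a * form M u u + (a * b + a * b) * form M u v + b * b * form M v v
form-expand {M = M} M-sym a b u v = begin
  form M w w
    ≡⟨ dot-cong {u = w} (λ _ → refl) (λ i → dot-linʳ (M i) a b u v) ⟩
  dot w (λ i → a * (M · u) i + b * (M · v) i)
    ≡⟨ dot-linʳ w a b (M · u) (M · v) ⟩
  a * form M w u + b * form M w v
    ≡⟨ cong₂ (λ p q → a * p + b * q) (dot-linˡ (M · u) a b u v) (dot-linˡ (M · v) a b u v) ⟩
  a * (a * form M u u + b * form M v u) + b * (a * form M u v + b * form M v v)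
    ≡⟨ cong (λ p → a * (a * form M u u + b * p) + b * (a * form M u v + b * form M v v)) (form-sym M-sym v u) ⟩
  a * (a * form M u u + b * form M u v) + b * (a * form M u v + b * form M v v)
    ≡⟨ solve 5 (λ a b p q r → a :* (a :* p :+ b :* q) :+ b :* (a :* q :+ b :* r) :=
                 a :* a :* p :+ (a :* b :+ a :* b) :* q :+ b :* b :* r)
         refl a b (form M u u) (form M u v) (form M v v) ⟩
  a * a * form M u u + (a * b + a * b) * form M u v + b * b * form M v v ∎
  where
  open ≡-Reasoning
  w : Vector _
  w i = a * u i + b * v i

-- A spectrum-free form of the condition that a symmetric matrix has at most one positive
-- eigenvalue. The functional may be zero, in which case the matrix is negative semidefinite
-- outright.
NegativeOnHyperplane : ∀ {n} → Matrix n → Set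
NegativeOnHyperplane {n} M =
  ∃ λ (l : Vector n) → ∀ v → dot l v ≡ 0ℚ → form M v v ℚ.≤ 0ℚ

-- If M(v,v) > 0, then u = l(v) h - l(h) v lies in the hyperplane, and M(u,u) ≤ 0
-- is a bound on the discriminant of M restricted to the span of v and h.
reverse-Cauchy-Schwarz : ∀ {n} {M : Matrix n} → Symmetric M → NegativeOnHyperplane M →
  ∀ h → 0ℚ ℚ.≤ form M h h → ∀ v → form M v v * form M h h ℚ.≤ form M v h * form M v h
reverse-Cauchy-Schwarz {n} {M} M-sym (l , neg) h 0≤hh v with ≤0∨0< (form M v v)
... | inj₁ vv≤0 = ℚ.≤-trans
        (subst (form M v v * form M h h ℚ.≤_) (ℚ.*-zeroˡ (form M h h))
          (ℚ.*-monoʳ-≤-nonNeg (form M h h) {{ℚ.nonNegative 0≤hh}} vv≤0))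
        (square-nonneg (form M v h))
... | inj₂ 0<vv = 0≤-⇒≤ (*-cancelˡ-≤ 0<t² (subst₂ ℚ._≤_ (sym (ℚ.*-zeroʳ (t * t))) eq₂
        (ℚ.≤-trans (square-nonneg (s * vv + t * b))
          (subst (ℚ._≤ (s * vv + t * b) * (s * vv + t * b) - vv * form M u u)
                (ℚ.+-identityʳ ((s * vv + t * b) * (s * vv + t * b)))
            (ℚ.+-monoʳ-≤ ((s * vv + t * b) * (s * vv + t * b)) (ℚ.neg-antimono-≤ vv*uu≤0))))))
  where
  t s b vv hh : ℚ
  t  = dot l v
  s  = - dot l h
  b  = form M v h
  vv = form M v v
  hh = form M h h

  u : Vector n
  u i = s * v i + t * h i

  t≢0 : t ≢ 0ℚ
  t≢0 t≡0 = ℚ.<-irrefl refl (ℚ.<-≤-trans 0<vv (neg v t≡0))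

  0<t² : 0ℚ ℚ.< t * t
  0<t² = square≢0 t≢0

  lu≡0 : dot l u ≡ 0ℚ
  lu≡0 = trans (dot-linʳ l s t v h)
    (solve 2 (λ p q → (:- q) :* p :+ p :* q := con 0ℚ) refl (dot l v) (dot l h))

  vv*uu≤0 : vv * form M u u ℚ.≤ 0ℚ
  vv*uu≤0 = subst (vv * form M u u ℚ.≤_) (ℚ.*-zeroʳ vv) (*-monoˡ-≤ (ℚ.<⇒≤ 0<vv) (neg u lu≡0))

  -- Completing the square in M(u,u). Since `vv` times M(u,u) is at most 0, the left side is
  -- non-negative, and `t * t` cancels on the right.
  eq₂ : (s * vv + t * b) * (s * vv + t * b) - vv * form M u u ≡ t * t * (b * b - vv * hh)
  eq₂ = trans (cong (λ p → (s * vv + t * b) * (s * vv + t * b) - vv * p) (form-expand M-sym s t v h))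
    (solve 5 (λ s t b p q →
       (s :* p :+ t :* b) :* (s :* p :+ t :* b) :-
         p :* (s :* s :* p :+ (s :* t :+ s :* t) :* b :+ t :* t :* q)
       := t :* t :* (b :* b :- p :* q)) refl s t b vv hh)

-- Gram–Schmidt without normalisation, so that no square roots leave ℚ.
orthogonal-decomposition : ∀ {m n} (a : Fin m → Vector n) (β : Vector n) →
  ∃₂ λ (u : Vector m) (r : Vector n) →
    (∀ x → β x ≡ sum (λ j → u j * a j x) + r x) × (∀ j → dot (a j) r ≡ 0ℚ)
orthogonal-decomposition {zero} a β = (λ ()) , β , (λ x → sym (ℚ.+-identityˡ (β x))) , λ ()
orthogonal-decomposition {suc m} {n} a β
  with orthogonal-decomposition (a ∘ suc) β | orthogonal-decomposition (a ∘ suc) (a zero)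
... | u , r , β≡ , r⊥ | p , s , a₀≡ , s⊥ = u′ , r′ , β≡′ , r′⊥
  where
  open ≡-Reasoning
  coefficient : ∃ λ τ → τ * dot s s ≡ dot s r
  coefficient with dot s s ℚ.≟ 0ℚ
  -- Here `s` vanishes, so `a zero` already lies in the span of the other vectors and any
  -- coefficient would do.
  ... | yes ss≡0 = 0ℚ , trans (ℚ.*-zeroˡ (dot s s)) (sym (sum-zero (λ i →
          trans (cong (_* r i) (square≡0 {s i} (sum≡0⇒term≡0 (λ j → square-nonneg (s j)) ss≡0 i))) (ℚ.*-zeroˡ (r i)))))
  ... | no ss≢0 = dot s r * ℚ.1/ dot s s , (begin
          dot s r * ℚ.1/ dot s s * dot s s    ≡⟨ ℚ.*-assoc (dot s r) _ _ ⟩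
          dot s r * (ℚ.1/ dot s s * dot s s)  ≡⟨ cong (dot s r *_) (ℚ.*-inverseˡ (dot s s)) ⟩
          dot s r * 1ℚ                        ≡⟨ ℚ.*-identityʳ (dot s r) ⟩
          dot s r                             ∎)
    where instance _ = ℚ.≢-nonZero ss≢0

  τ = proj₁ coefficient

  u′ : Vector (suc m)
  u′ zero    = τ
  u′ (suc j) = 1ℚ * u j + (- τ) * p j

  r′ : Vector n
  r′ x = 1ℚ * r x + (- τ) * s x

  combination : Vector m → Vector n
  combination w x = sum (λ j → w j * a (suc j) x)

  β≡′ : ∀ x → β x ≡ τ * a zero x + combination (u′ ∘ suc) x + r′ x
  β≡′ x = begin
    β x
      ≡⟨ β≡ x ⟩
    combination u x + r x
      ≡⟨ solve 5 (λ τ U P r s → U :+ r := τ :* (P :+ s) :+ (con 1ℚ :* U :+ (:- τ) :* P) :+ (con 1ℚ :* r :+ (:- τ) :* s))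
           refl τ (combination u x) (combination p x) (r x) (s x) ⟩
    τ * (combination p x + s x) + (1ℚ * combination u x + (- τ) * combination p x) + r′ x
      ≡⟨ cong₂ (λ e f → τ * e + f + r′ x) (a₀≡ x) (dot-linˡ (λ j → a (suc j) x) 1ℚ (- τ) u p) ⟨
    τ * a zero x + combination (u′ ∘ suc) x + r′ x ∎

  r′⊥suc : ∀ j → dot (a (suc j)) r′ ≡ 0ℚ
  r′⊥suc j = begin
    dot (a (suc j)) r′                                ≡⟨ dot-linʳ (a (suc j)) 1ℚ (- τ) r s ⟩
    1ℚ * dot (a (suc j)) r + (- τ) * dot (a (suc j)) s
      ≡⟨ cong₂ (λ e f → 1ℚ * e + (- τ) * f) (r⊥ j) (s⊥ j) ⟩
    1ℚ * 0ℚ + (- τ) * 0ℚ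
      ≡⟨ solve 1 (λ τ → con 1ℚ :* con 0ℚ :+ (:- τ) :* con 0ℚ := con 0ℚ) refl τ ⟩
    0ℚ                                                ∎

  r′⊥ : ∀ j → dot (a j) r′ ≡ 0ℚ
  r′⊥ (suc j) = r′⊥suc j
  r′⊥ zero    = begin
    dot (a zero) r′
      ≡⟨ dot-comm (a zero) r′ ⟩
    dot r′ (a zero)
      ≡⟨ sum-cong-≗ (λ x → trans (cong (r′ x *_) (a₀≡ x)) (ℚ.*-distribˡ-+ (r′ x) _ _)) ⟩
    sum (λ x → r′ x * combination p x + r′ x * s x)
      ≡⟨ ∑-distrib-+ (λ x → r′ x * combination p x) (λ x → r′ x * s x) ⟩
    dot r′ (combination p) + dot r′ s
      ≡⟨ cong₂ _+_ (trans (dot-sumʳ r′ (λ j x → p j * a (suc j) x)) (sum-zero zero-term)) (dot-linˡ s 1ℚ (- τ) r s) ⟩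
    0ℚ + (1ℚ * dot r s + (- τ) * dot s s)
      ≡⟨ cong (λ e → 0ℚ + (1ℚ * e + (- τ) * dot s s)) (trans (dot-comm r s) (sym (proj₂ coefficient))) ⟩
    0ℚ + (1ℚ * (τ * dot s s) + (- τ) * dot s s)
      ≡⟨ solve 2 (λ τ q → con 0ℚ :+ (con 1ℚ :* (τ :* q) :+ (:- τ) :* q) := con 0ℚ) refl τ (dot s s) ⟩
    0ℚ ∎
    where
    zero-term : ∀ j → dot r′ (λ x → p j * a (suc j) x) ≡ 0ℚ
    zero-term j = begin
      dot r′ (λ x → p j * a (suc j) x)
        ≡⟨ sum-cong-≗ (λ x → solve 3 (λ r p a → r :* (p :* a) := p :* (a :* r)) refl (r′ x) (p j) (a (suc j) x)) ⟩
      sum (λ x → p j * (a (suc j) x * r′ x))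
        ≡⟨ *-distribˡ-sum (p j) (λ x → a (suc j) x * r′ x) ⟨
      p j * dot (a (suc j)) r′
        ≡⟨ trans (cong (p j *_) (r′⊥suc j)) (ℚ.*-zeroʳ (p j)) ⟩
      0ℚ ∎

-- Weighted graph Laplacians

degree : ∀ {n} → Matrix n → Vector n
degree C x = sum (C x)

laplacian : ∀ {n} → Matrix n → Vector n → Vector n
laplacian C u x = degree C x * u x - (C · u) x

-- The kernel of a Laplacian consists of the functions constant along edges, so connectivity is
-- phrased through these rather than through paths. Vertices of degree zero are exempt: the elements
-- of S, for instance, remain as indices of the matrix.
Connected : ∀ {n} → Matrix n → Set
Connected {n} C = ∀ (r : Vector n) → (∀ x y → 0ℚ ℚ.< C x y → r x ≡ r y) →
  ∀ x y → degree C x ≢ 0ℚ → degree C y ≢ 0ℚ → r x ≡ r y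

module _ {n} {C : Matrix n} (C-sym : Symmetric C) where
  open ≡-Reasoning

  -- The double sum is written once by rows and once by columns, and the two are added; stating
  -- twice the energy avoids a factor of one half.
  laplacian-energy : ∀ u → dot u (laplacian C u) + dot u (laplacian C u) ≡
    sum (λ x → sum (λ y → C x y * ((u x - u y) * (u x - u y))))
  laplacian-energy u = begin
    dot u (laplacian C u) + dot u (laplacian C u)
      ≡⟨ cong₂ _+_ half (trans half (∑-comm (λ x y → u x * (C x y * (u x - u y))))) ⟩
    sum (λ x → sum (λ y → u x * (C x y * (u x - u y)))) + sum (λ y → sum (λ x → u x * (C x y * (u x - u y))))
      ≡⟨ ∑-distrib-+ (λ x → sum (λ y → u x * (C x y * (u x - u y)))) (λ x → sum (λ y → u y * (C y x * (u y - u x)))) ⟨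
    sum (λ x → sum (λ y → u x * (C x y * (u x - u y))) + sum (λ y → u y * (C y x * (u y - u x))))
      ≡⟨ sum-cong-≗ (λ x → trans
           (sym (∑-distrib-+ (λ y → u x * (C x y * (u x - u y))) (λ y → u y * (C y x * (u y - u x)))))
           (sum-cong-≗ (λ y → trans
             (cong (λ c → u x * (C x y * (u x - u y)) + u y * (c * (u y - u x))) (C-sym y x))
             (solve 3 (λ c p q → p :* (c :* (p :- q)) :+ q :* (c :* (q :- p)) := c :* ((p :- q) :* (p :- q)))
               refl (C x y) (u x) (u y))))) ⟩
    sum (λ x → sum (λ y → C x y * ((u x - u y) * (u x - u y)))) ∎
    where
    half : dot u (laplacian C u) ≡ sum (λ x → sum (λ y → u x * (C x y * (u x - u y))))
    half = sum-cong-≗ (λ x → begin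
      u x * (degree C x * u x - (C · u) x)
        ≡⟨ cong (λ e → u x * (e - (C · u) x)) (trans (ℚ.*-comm _ (u x)) (*-distribˡ-sum (u x) (C x))) ⟩
      u x * (sum (λ y → u x * C x y) - sum (λ y → C x y * u y))
        ≡⟨ cong (u x *_) (sum-sub (λ y → u x * C x y) (λ y → C x y * u y)) ⟨
      u x * sum (λ y → u x * C x y - C x y * u y)
        ≡⟨ *-distribˡ-sum (u x) (λ y → u x * C x y - C x y * u y) ⟩
      sum (λ y → u x * (u x * C x y - C x y * u y))
        ≡⟨ sum-cong-≗ (λ y → solve 3 (λ c p q → p :* (p :* c :- c :* q) := p :* (c :* (p :- q)))
             refl (C x y) (u x) (u y)) ⟩
      sum (λ y → u x * (C x y * (u x - u y))) ∎)

  -- The operator `laplacian` as an explicit matrix, whose rows can be handed to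
  -- `orthogonal-decomposition`.
  kirchhoff : Matrix n
  kirchhoff x y = 𝟙 (x Fin.≟ y) * degree C x - C x y

  kirchhoff-sym : Symmetric kirchhoff
  kirchhoff-sym x y with x Fin.≟ y
  ... | yes refl = cong (λ e → e * degree C x - C x x) (sym (𝟙-yes (x Fin.≟ x) refl))
  ... | no x≢y = cong₂ _-_
    (trans (ℚ.*-zeroˡ (degree C x))
          (sym (trans (cong (_* degree C y) (𝟙-no (y Fin.≟ x) (x≢y ∘ sym))) (ℚ.*-zeroˡ (degree C y)))))
    (C-sym x y)

  kirchhoff≗laplacian : ∀ u x → (kirchhoff · u) x ≡ laplacian C u x
  kirchhoff≗laplacian u x = begin
    sum (λ y → (𝟙 (x Fin.≟ y) * degree C x - C x y) * u y)
      ≡⟨ sum-cong-≗ (λ y → solve 4 (λ i d c u → (i :* d :- c) :* u := i :* (d :* u) :- c :* u)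
           refl (𝟙 (x Fin.≟ y)) (degree C x) (C x y) (u y)) ⟩
    sum (λ y → 𝟙 (x Fin.≟ y) * (degree C x * u y) - C x y * u y)
      ≡⟨ sum-sub (λ y → 𝟙 (x Fin.≟ y) * (degree C x * u y)) (λ y → C x y * u y) ⟩
    sum (λ y → 𝟙 (x Fin.≟ y) * (degree C x * u y)) - (C · u) x
      ≡⟨ cong (_- (C · u) x) (sum-δ x (λ y → degree C x * u y)) ⟩
    laplacian C u x ∎

  module _ (C≥0 : ∀ x y → 0ℚ ℚ.≤ C x y) where

    energy≥0 : ∀ (u : Vector n) x y → 0ℚ ℚ.≤ C x y * ((u x - u y) * (u x - u y))
    energy≥0 u x y = *-nonneg (C≥0 x y) (square-nonneg (u x - u y))

    laplacian-psd : ∀ u → 0ℚ ℚ.≤ dot u (laplacian C u)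
    laplacian-psd u with ≤0∨0< (dot u (laplacian C u))
    ... | inj₂ 0<e = ℚ.<⇒≤ 0<e
    -- If e ≤ 0 then e + e ≤ e, so non-negativity of the doubled energy passes to e.
    ... | inj₁ e≤0 = ℚ.≤-trans
      (subst (0ℚ ℚ.≤_) (sym (laplacian-energy u)) (sum-nonneg (λ x → sum-nonneg (energy≥0 u x))))
      (subst (dot u (laplacian C u) + dot u (laplacian C u) ℚ.≤_) (ℚ.+-identityˡ (dot u (laplacian C u)))
        (ℚ.+-monoˡ-≤ (dot u (laplacian C u)) e≤0))

    -- The energy of `r` is zero and is a sum of non-negative terms, so the term of each edge
    -- vanishes.
    laplacian-kernel : ∀ {r} → (∀ x → laplacian C r x ≡ 0ℚ) → ∀ x y → 0ℚ ℚ.< C x y → r x ≡ r y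
    laplacian-kernel {r} Lr≡0 x y 0<c = begin
      r x              ≡⟨ solve 2 (λ p q → p := (p :- q) :+ q) refl (r x) (r y) ⟩
      (r x - r y) + r y ≡⟨ cong (_+ r y) (square≡0 {r x - r y} (*-cancelˡ-≡0 0<c energy≡0)) ⟩
      0ℚ + r y          ≡⟨ ℚ.+-identityˡ (r y) ⟩
      r y               ∎
      where
      rLr≡0 : dot r (laplacian C r) ≡ 0ℚ
      rLr≡0 = sum-zero (λ x → trans (cong (r x *_) (Lr≡0 x)) (ℚ.*-zeroʳ (r x)))
      energy≡0 : C x y * ((r x - r y) * (r x - r y)) ≡ 0ℚ
      energy≡0 = sum≡0⇒term≡0 (energy≥0 r x)
        (sum≡0⇒term≡0 (λ x → sum-nonneg (energy≥0 r x))
          (trans (sym (laplacian-energy r)) (trans (cong₂ _+_ rLr≡0 rLr≡0) (ℚ.+-identityˡ 0ℚ))) x) y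

    -- Fredholm alternative. The part `r` of `β` orthogonal to all rows lies in the kernel, so it is
    -- constant on the vertices of positive degree, and r·β is that constant times the sum of `β`,
    -- which is 0. But r·β = r·r, so `r` vanishes.
    laplacian-solvable : Connected C → ∀ (β : Vector n) → (∀ x → degree C x ≡ 0ℚ → β x ≡ 0ℚ) → sum β ≡ 0ℚ →
      ∃ λ u → ∀ x → β x ≡ laplacian C u x
    laplacian-solvable conn β β-supp ∑β≡0
      with orthogonal-decomposition kirchhoff β
    ... | u , r , β≡ , r⊥ = u , λ x → trans (β≡ x) (begin
        sum (λ j → u j * kirchhoff j x) + r x  ≡⟨ cong₂ _+_ (combination x) (r≡0 x) ⟩
        laplacian C u x + 0ℚ                  ≡⟨ ℚ.+-identityʳ _ ⟩
        laplacian C u x                       ∎)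
      where
      combination : ∀ x → sum (λ j → u j * kirchhoff j x) ≡ laplacian C u x
      combination x = trans
        (sum-cong-≗ (λ j → trans (ℚ.*-comm (u j) _) (cong (_* u j) (kirchhoff-sym j x))))
        (kirchhoff≗laplacian u x)

      r-const : ∀ x y → degree C x ≢ 0ℚ → degree C y ≢ 0ℚ → r x ≡ r y
      r-const = conn r (laplacian-kernel (λ x → trans (sym (kirchhoff≗laplacian r x)) (r⊥ x)))

      r·β≡0 : dot r β ≡ 0ℚ
      r·β≡0 with Fin.any? (λ x → ¬? (degree C x ℚ.≟ 0ℚ))
      ... | no none = sum-zero (λ x → trans (cong (r x *_) (β-supp x (decided x))) (ℚ.*-zeroʳ (r x)))
        where
        decided : ∀ x → degree C x ≡ 0ℚ
        decided x with degree C x ℚ.≟ 0ℚ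
        ... | yes d≡0 = d≡0
        ... | no  d≢0 = contradiction (x , d≢0) none
      ... | yes (x₀ , d₀≢0) = begin
        sum (λ x → r x * β x)   ≡⟨ sum-cong-≗ same ⟩
        sum (λ x → r x₀ * β x)  ≡⟨ *-distribˡ-sum (r x₀) β ⟨
        r x₀ * sum β            ≡⟨ trans (cong (r x₀ *_) ∑β≡0) (ℚ.*-zeroʳ (r x₀)) ⟩
        0ℚ                      ∎
        where
        same : ∀ x → r x * β x ≡ r x₀ * β x
        same x with degree C x ℚ.≟ 0ℚ
        ... | yes d≡0 = trans (trans (cong (r x *_) (β-supp x d≡0)) (ℚ.*-zeroʳ (r x)))
                          (sym (trans (cong (r x₀ *_) (β-supp x d≡0)) (ℚ.*-zeroʳ (r x₀))))
        ... | no  d≢0 = cong (_* β x) (r-const x x₀ d≢0 d₀≢0)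

      r·r≡0 : dot r r ≡ 0ℚ
      r·r≡0 = begin
        dot r r
          ≡⟨ solve 1 (λ e → e := con 0ℚ :+ e) refl (dot r r) ⟩
        0ℚ + dot r r
          ≡⟨ cong (_+ dot r r) (trans (dot-sumʳ r (λ j x → u j * kirchhoff j x)) (sum-zero (λ j → begin
               dot r (λ x → u j * kirchhoff j x)
                 ≡⟨ sum-cong-≗ (λ x → solve 3 (λ r u k → r :* (u :* k) := u :* (k :* r)) refl (r x) (u j) (kirchhoff j x)) ⟩
               sum (λ x → u j * (kirchhoff j x * r x))
                 ≡⟨ *-distribˡ-sum (u j) (λ x → kirchhoff j x * r x) ⟨
               u j * dot (kirchhoff j) r
                 ≡⟨ trans (cong (u j *_) (r⊥ j)) (ℚ.*-zeroʳ (u j)) ⟩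
               0ℚ ∎))) ⟨
        dot r (λ x → sum (λ j → u j * kirchhoff j x)) + dot r r
          ≡⟨ ∑-distrib-+ (λ x → r x * sum (λ j → u j * kirchhoff j x)) (λ x → r x * r x) ⟨
        sum (λ x → r x * sum (λ j → u j * kirchhoff j x) + r x * r x)
          ≡⟨ sum-cong-≗ (λ x → trans (cong (r x *_) (β≡ x)) (ℚ.*-distribˡ-+ (r x) _ (r x))) ⟨
        dot r β
          ≡⟨ r·β≡0 ⟩
        0ℚ ∎

      r≡0 : ∀ x → r x ≡ 0ℚ
      r≡0 x = square≡0 {r x} (sum≡0⇒term≡0 (λ y → square-nonneg (r y)) r·r≡0 x)

ones : ∀ {n} → Vector (suc n)
ones zero    = 0ℚ
ones (suc _) = 1ℚ

·ones : ∀ {n} (A : Matrix (suc n)) i → (A · ones) i ≡ sum (λ y → A i (suc y))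
·ones A i = trans (cong₂ _+_ (ℚ.*-zeroʳ (A i zero)) (sum-cong-≗ (λ y → ℚ.*-identityʳ (A i (suc y)))))
                  (ℚ.+-identityˡ _)

block : ∀ {n} → Matrix (suc n) → Matrix n
block A x y = A (suc x) (suc y)

-- With D the degrees and C the block of A, write v = u - T where (D - C) u = D v + v₀ b.
-- Then A u = D T off the coordinate 0, and expanding A(u - T, u - T) gives
-- A(v,v) ≤ - T·(D - C)T.
local-to-global : ∀ {n} (A : Matrix (suc n)) → Symmetric A →
  (∀ x y → 0ℚ ℚ.≤ block A x y) →
  (∀ x → degree (block A) x ≡ 0ℚ → A zero (suc x) ≡ 0ℚ) →
  Connected (block A) →
  (∀ (u : Vector (suc n)) (T : Vector n) → (∀ x → degree (block A) x * T x ≡ (A · u) (suc x)) →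
     form A u u ℚ.≤ sum (λ x → degree (block A) x * (T x * T x))) →
  NegativeOnHyperplane A
-- Orthogonality of `v` to `A · ones` says exactly that the right-hand side `β` of the Laplacian
-- equation sums to zero.
local-to-global {n} A A-sym C≥0 supp conn local = A · ones , negative
  where
  open ≡-Reasoning
  C : Matrix n
  C = block A
  C-sym : Symmetric C
  C-sym x y = A-sym (suc x) (suc y)

  negative : ∀ v → dot (A · ones) v ≡ 0ℚ → form A v v ℚ.≤ 0ℚ
  -- With S = Σ D T², the cross term A(u,T) equals S because A u = D T off the coordinate 0, and
  -- `local` gives A(u,u) ≤ S. What remains is S - 2S + C(T,T), minus the Laplacian energy of `T`.
  negative v ⊥ = subst (ℚ._≤ 0ℚ) (sym vv≡) (ℚ.≤-trans
      (ℚ.+-monoˡ-≤ (form C T T) (ℚ.+-monoˡ-≤ (- (S + S)) (local u T DT≡)))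
      (subst (ℚ._≤ 0ℚ) bound≡ (ℚ.neg-antimono-≤ (laplacian-psd C-sym C≥0 T))))
    where
    β : Vector n
    β x = degree C x * v (suc x) + A (suc x) zero * v zero

    ∑β≡0 : sum β ≡ 0ℚ
    ∑β≡0 = begin
      sum β
        ≡⟨ ∑-distrib-+ (λ x → degree C x * v (suc x)) (λ x → A (suc x) zero * v zero) ⟩
      sum (λ x → degree C x * v (suc x)) + sum (λ x → A (suc x) zero * v zero)
        ≡⟨ cong₂ _+_ (sum-cong-≗ (λ x → cong (_* v (suc x)) (sym (·ones A (suc x))))) (begin
             sum (λ x → A (suc x) zero * v zero)
               ≡⟨ sum-cong-≗ (λ x → trans (ℚ.*-comm _ (v zero)) (cong (v zero *_) (A-sym (suc x) zero))) ⟩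
             sum (λ x → v zero * A zero (suc x))
               ≡⟨ *-distribˡ-sum (v zero) (λ x → A zero (suc x)) ⟨
             v zero * sum (λ x → A zero (suc x))
               ≡⟨ trans (ℚ.*-comm (v zero) _) (cong (_* v zero) (sym (·ones A zero))) ⟩
             (A · ones) zero * v zero ∎) ⟩
      sum (λ x → (A · ones) (suc x) * v (suc x)) + (A · ones) zero * v zero
        ≡⟨ trans (ℚ.+-comm _ ((A · ones) zero * v zero)) ⊥ ⟩
      0ℚ ∎

    β-supp : ∀ x → degree C x ≡ 0ℚ → β x ≡ 0ℚ
    β-supp x d≡0 = begin
      degree C x * v (suc x) + A (suc x) zero * v zero
        ≡⟨ cong₂ (λ d b → d * v (suc x) + b * v zero) d≡0 (trans (A-sym (suc x) zero) (supp x d≡0)) ⟩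
      0ℚ * v (suc x) + 0ℚ * v zero
        ≡⟨ solve 2 (λ p q → con 0ℚ :* p :+ con 0ℚ :* q := con 0ℚ) refl (v (suc x)) (v zero) ⟩
      0ℚ ∎

    solution = laplacian-solvable C-sym C≥0 conn β β-supp ∑β≡0

    u T⁺ : Vector (suc n)
    u zero    = v zero
    u (suc x) = proj₁ solution x

    T : Vector n
    T x = u (suc x) - v (suc x)

    T⁺ zero    = 0ℚ
    T⁺ (suc x) = T x

    DT≡ : ∀ x → degree C x * T x ≡ (A · u) (suc x)
    DT≡ x = begin
      degree C x * (u (suc x) - v (suc x))
        ≡⟨ solve 5 (λ d p q b c → d :* (p :- q) := b :+ (d :* p :- c) :- (d :* q :+ b) :+ c)
             refl (degree C x) (u (suc x)) (v (suc x)) (A (suc x) zero * v zero) ((C · proj₁ solution) x) ⟩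
      A (suc x) zero * v zero + laplacian C (proj₁ solution) x - β x + (C · proj₁ solution) x
        ≡⟨ cong (λ e → A (suc x) zero * v zero + e - β x + (C · proj₁ solution) x) (proj₂ solution x) ⟨
      A (suc x) zero * v zero + β x - β x + (C · proj₁ solution) x
        ≡⟨ solve 3 (λ p b c → p :+ b :- b :+ c := p :+ c) refl (A (suc x) zero * v zero) (β x) ((C · proj₁ solution) x) ⟩
      (A · u) (suc x) ∎

    S : ℚ
    S = sum (λ x → degree C x * (T x * T x))

    uT≡ : form A u T⁺ ≡ S
    uT≡ = begin
      form A u T⁺ ≡⟨ form-sym A-sym u T⁺ ⟩
      0ℚ * (A · u) zero + sum (λ x → T x * (A · u) (suc x))
        ≡⟨ cong₂ _+_ (ℚ.*-zeroˡ ((A · u) zero)) (sum-cong-≗ (λ x → trans (cong (T x *_) (sym (DT≡ x)))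
             (solve 2 (λ d t → t :* (d :* t) := d :* (t :* t)) refl (degree C x) (T x)))) ⟩
      0ℚ + S      ≡⟨ ℚ.+-identityˡ S ⟩
      S           ∎

    TT≡ : form A T⁺ T⁺ ≡ form C T T
    TT≡ = begin
      0ℚ * (A · T⁺) zero + sum (λ x → T x * (A (suc x) zero * 0ℚ + (C · T) x))
        ≡⟨ cong₂ _+_ (ℚ.*-zeroˡ ((A · T⁺) zero)) (sum-cong-≗ (λ x →
             solve 3 (λ t a c → t :* (a :* con 0ℚ :+ c) := t :* c) refl (T x) (A (suc x) zero) ((C · T) x))) ⟩
      0ℚ + form C T T ≡⟨ ℚ.+-identityˡ (form C T T) ⟩
      form C T T      ∎

    v≗ : ∀ i → v i ≡ 1ℚ * u i + (- 1ℚ) * T⁺ i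
    v≗ zero    = solve 1 (λ p → p := con 1ℚ :* p :+ (:- con 1ℚ) :* con 0ℚ) refl (v zero)
    v≗ (suc x) = solve 2 (λ p q → q := con 1ℚ :* p :+ (:- con 1ℚ) :* (p :- q)) refl (u (suc x)) (v (suc x))

    vv≡ : form A v v ≡ form A u u - (S + S) + form C T T
    vv≡ = begin
      form A v v
        ≡⟨ form-cong {M = A} (λ _ _ → refl) v≗ v≗ ⟩
      form A (λ i → 1ℚ * u i + (- 1ℚ) * T⁺ i) (λ i → 1ℚ * u i + (- 1ℚ) * T⁺ i)
        ≡⟨ form-expand A-sym 1ℚ (- 1ℚ) u T⁺ ⟩
      1ℚ * 1ℚ * form A u u + (1ℚ * (- 1ℚ) + 1ℚ * (- 1ℚ)) * form A u T⁺ + (- 1ℚ) * (- 1ℚ) * form A T⁺ T⁺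
        ≡⟨ cong₂ (λ e f → 1ℚ * 1ℚ * form A u u + (1ℚ * (- 1ℚ) + 1ℚ * (- 1ℚ)) * e + (- 1ℚ) * (- 1ℚ) * f) uT≡ TT≡ ⟩
      1ℚ * 1ℚ * form A u u + (1ℚ * (- 1ℚ) + 1ℚ * (- 1ℚ)) * S + (- 1ℚ) * (- 1ℚ) * form C T T
        ≡⟨ solve 3 (λ p s q → con 1ℚ :* con 1ℚ :* p :+ (con 1ℚ :* (:- con 1ℚ) :+ con 1ℚ :* (:- con 1ℚ)) :* s
             :+ (:- con 1ℚ) :* (:- con 1ℚ) :* q := p :- (s :+ s) :+ q) refl (form A u u) S (form C T T) ⟩
      form A u u - (S + S) + form C T T ∎

    bound≡ : - dot T (laplacian C T) ≡ S - (S + S) + form C T T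
    bound≡ = begin
      - dot T (laplacian C T)
        ≡⟨ cong -_ (trans (sum-cong-≗ (λ x → solve 3 (λ t d c → t :* (d :* t :- c) := d :* (t :* t) :- t :* c)
             refl (T x) (degree C x) ((C · T) x))) (sum-sub (λ x → degree C x * (T x * T x)) (λ x → T x * (C · T) x))) ⟩
      - (S - form C T T)
        ≡⟨ solve 2 (λ s q → :- (s :- q) := s :- (s :+ s) :+ q) refl S (form C T T) ⟩
      S - (S + S) + form C T T ∎

-- Sums over lists and over subsets

𝟙-× : ∀ {a b} {A : Set a} {B : Set b} (d : Dec A) (e : Dec B) → 𝟙 (d ×-dec e) ≡ 𝟙 d * 𝟙 e
𝟙-× (yes _) e = sym (ℚ.*-identityˡ (𝟙 e))
𝟙-× (no _)  e = sym (ℚ.*-zeroˡ (𝟙 e))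

sumₗ : ∀ {A : Set} → (A → ℚ) → List A → ℚ
sumₗ f xs = foldr _+_ 0ℚ (map f xs)

sumₗ-cong : ∀ {A : Set} {f g : A → ℚ} → (∀ x → f x ≡ g x) → ∀ xs → sumₗ f xs ≡ sumₗ g xs
sumₗ-cong f≗g []       = refl
sumₗ-cong f≗g (x ∷ xs) = cong₂ _+_ (f≗g x) (sumₗ-cong f≗g xs)

sumₗ-zero : ∀ {A : Set} {f : A → ℚ} → (∀ x → f x ≡ 0ℚ) → ∀ xs → sumₗ f xs ≡ 0ℚ
sumₗ-zero f≡0 []       = refl
sumₗ-zero f≡0 (x ∷ xs) = trans (cong₂ _+_ (f≡0 x) (sumₗ-zero f≡0 xs)) (ℚ.+-identityˡ 0ℚ)

sumₗ-++ : ∀ {A : Set} (f : A → ℚ) xs ys → sumₗ f (xs ++ ys) ≡ sumₗ f xs + sumₗ f ys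
sumₗ-++ f []       ys = sym (ℚ.+-identityˡ (sumₗ f ys))
sumₗ-++ f (x ∷ xs) ys = trans (cong (_+_ (f x)) (sumₗ-++ f xs ys)) (sym (ℚ.+-assoc (f x) (sumₗ f xs) (sumₗ f ys)))

sumₗ-map : ∀ {A B : Set} (f : B → ℚ) (g : A → B) xs → sumₗ f (map g xs) ≡ sumₗ (f ∘ g) xs
sumₗ-map f g []       = refl
sumₗ-map f g (x ∷ xs) = cong (_+_ (f (g x))) (sumₗ-map f g xs)

sumₗ-filter : ∀ {A : Set} {P : Pred A 0ℓ} (P? : Decidable P) (f : A → ℚ) xs →
  sumₗ f (filter P? xs) ≡ sumₗ (λ x → 𝟙 (P? x) * f x) xs
sumₗ-filter P? f []       = refl
sumₗ-filter P? f (x ∷ xs) with P? x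
... | yes _ = cong₂ _+_ (sym (ℚ.*-identityˡ (f x))) (sumₗ-filter P? f xs)
... | no  _ = trans (sumₗ-filter P? f xs)
                (sym (trans (cong (_+ _) (ℚ.*-zeroˡ (f x))) (ℚ.+-identityˡ _)))

sumₗ-*ˡ : ∀ {A : Set} c (f : A → ℚ) xs → c * sumₗ f xs ≡ sumₗ (λ x → c * f x) xs
sumₗ-*ˡ c f []       = ℚ.*-zeroʳ c
sumₗ-*ˡ c f (x ∷ xs) = trans (ℚ.*-distribˡ-+ c (f x) _) (cong (_+_ (c * f x)) (sumₗ-*ˡ c f xs))

sum-sumₗ-comm : ∀ {A : Set} {n} (f : A → Fin n → ℚ) xs →
  sum (λ i → sumₗ (λ x → f x i) xs) ≡ sumₗ (λ x → sum (f x)) xs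
sum-sumₗ-comm {n = n} f []       = sum-replicate-zero n
sum-sumₗ-comm f (x ∷ xs) = trans (∑-distrib-+ (f x) (λ i → sumₗ (λ y → f y i) xs))
                                  (cong (_+_ (sum (f x))) (sum-sumₗ-comm f xs))

sumₗ-nonneg : ∀ {A : Set} {f : A → ℚ} → (∀ x → 0ℚ ℚ.≤ f x) → ∀ xs → 0ℚ ℚ.≤ sumₗ f xs
sumₗ-nonneg 0≤f []       = ℚ.≤-refl
sumₗ-nonneg 0≤f (x ∷ xs) = ℚ.+-mono-≤ (0≤f x) (sumₗ-nonneg 0≤f xs)

sumₗ-subsets : ∀ {n} (f : Subset (suc n) → ℚ) → sumₗ f (subsets (suc n)) ≡
  sumₗ (λ S → f (outside Vec.∷ S)) (subsets n) + sumₗ (λ S → f (inside Vec.∷ S)) (subsets n)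
sumₗ-subsets {n} f = trans (sumₗ-++ f (map (outside Vec.∷_) (subsets n)) _)
  (cong₂ _+_ (sumₗ-map f (outside Vec.∷_) (subsets n)) (sumₗ-map f (inside Vec.∷_) (subsets n)))

sumₗ-subsets-δ : ∀ {n} (S : Subset n) (f : Subset n → ℚ) →
  sumₗ (λ T → 𝟙 (Vec.≡-dec Bool._≟_ T S) * f T) (subsets n) ≡ f S
sumₗ-subsets-δ Vec.[] f = trans (ℚ.+-identityʳ _) (ℚ.*-identityˡ (f Vec.[]))
sumₗ-subsets-δ {suc n} (false Vec.∷ S) f = trans
  (sumₗ-subsets (λ T → 𝟙 (Vec.≡-dec Bool._≟_ T (false Vec.∷ S)) * f T)) (trans
  (cong₂ _+_ (sumₗ-subsets-δ S (λ T → f (false Vec.∷ T)))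
             (sumₗ-zero (λ T → ℚ.*-zeroˡ (f (true Vec.∷ T))) (subsets n)))
  (ℚ.+-identityʳ (f (false Vec.∷ S))))
sumₗ-subsets-δ {suc n} (true Vec.∷ S) f = trans
  (sumₗ-subsets (λ T → 𝟙 (Vec.≡-dec Bool._≟_ T (true Vec.∷ S)) * f T)) (trans
  (cong₂ _+_ (sumₗ-zero (λ T → ℚ.*-zeroˡ (f (false Vec.∷ T))) (subsets n))
             (sumₗ-subsets-δ S (λ T → f (true Vec.∷ T))))
  (ℚ.+-identityˡ (f (true Vec.∷ S))))

natℚ : ℕ → ℚ
natℚ zero    = 0ℚ
natℚ (suc n) = 1ℚ + natℚ n

-- The sum over the list of (f x - a)² ≥ 0. It controls the cross term when `Cauchy-Schwarz` adds
-- one entry to the list.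
2a∑f≤∑f²+Na² : ∀ {A : Set} (a : ℚ) (f : A → ℚ) xs →
  a * sumₗ f xs + a * sumₗ f xs ℚ.≤ sumₗ (λ x → f x * f x) xs + natℚ (length xs) * (a * a)
2a∑f≤∑f²+Na² a f [] = ℚ.≤-reflexive
  (solve 1 (λ a → a :* con 0ℚ :+ a :* con 0ℚ := con 0ℚ :+ con 0ℚ :* (a :* a)) refl a)
2a∑f≤∑f²+Na² a f (x ∷ xs) = subst₂ ℚ._≤_
  (solve 3 (λ a p s → con 0ℚ :+ (a :* s :+ a :* s) :+ (a :* p :+ a :* p) := a :* (p :+ s) :+ a :* (p :+ s))
    refl a (f x) (sumₗ f xs))
  (solve 4 (λ a p q N → (p :- a) :* (p :- a) :+ (q :+ N :* (a :* a)) :+ (a :* p :+ a :* p) :=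
                        (p :* p :+ q) :+ (con 1ℚ :+ N) :* (a :* a))
    refl a (f x) (sumₗ (λ x → f x * f x) xs) (natℚ (length xs)))
  (ℚ.+-monoˡ-≤ (a * f x + a * f x) (ℚ.+-mono-≤ (square-nonneg (f x - a)) (2a∑f≤∑f²+Na² a f xs)))

Cauchy-Schwarz : ∀ {A : Set} (f : A → ℚ) xs →
  sumₗ f xs * sumₗ f xs ℚ.≤ natℚ (length xs) * sumₗ (λ x → f x * f x) xs
Cauchy-Schwarz f [] = ℚ.≤-refl
Cauchy-Schwarz f (x ∷ xs) = subst₂ ℚ._≤_
  (solve 2 (λ p s → p :* p :+ ((p :* s :+ p :* s) :+ s :* s) := (p :+ s) :* (p :+ s)) refl (f x) (sumₗ f xs))
  (solve 3 (λ p q N → p :* p :+ ((q :+ N :* (p :* p)) :+ N :* q) := (con 1ℚ :+ N) :* (p :* p :+ q))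
    refl (f x) (sumₗ (λ x → f x * f x) xs) (natℚ (length xs)))
  (ℚ.+-monoʳ-≤ (f x * f x) (ℚ.+-mono-≤ (2a∑f≤∑f²+Na² (f x) f xs) (Cauchy-Schwarz f xs)))

-- Equivalence classes and multipartite graphs

∈-comprehension⁺ : ∀ {n} {P : Pred (Fin n) 0ℓ} (P? : Decidable P) {x} → P x → x ∈ comprehension P?
∈-comprehension⁺ P? {x} Px = lookup⇒[]= x _ (trans (lookup∘tabulate (λ y → does (P? y)) x) (dec-true (P? x) Px))

∈-comprehension⁻ : ∀ {n} {P : Pred (Fin n) 0ℓ} (P? : Decidable P) {x} → x ∈ comprehension P? → P x
∈-comprehension⁻ P? {x} x∈ with P? x | trans (sym (lookup∘tabulate (λ y → does (P? y)) x)) ([]=⇒lookup x∈)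
... | yes Px | _ = Px

-- The encoding copies that of `Par`, so that for `cont?` and `parallel?` the list `classes` is
-- `Par` by computation, and its length is the number of parallel classes.
module Classes {n} {E : Pred (Fin n) 0ℓ} (E? : Decidable E) {R : Fin n → Fin n → Set} (R? : Decidable₂ R) where

  classOf : Fin n → Subset n
  classOf x = comprehension (λ y → E? y ×-dec R? x y)

  IsClass : Pred (Subset n) 0ℓ
  IsClass C = ∃ λ x → E x × C ≡ classOf x

  isClass? : Decidable IsClass
  isClass? C = Fin.any? (λ x → E? x ×-dec Vec.≡-dec Bool._≟_ C (classOf x))

  classes : List (Subset n)
  classes = filter isClass? (subsets n)

  kernel : Matrix n
  kernel x y = 𝟙 (E? x ×-dec (E? y ×-dec R? x y))

  classSum : Vector n → Subset n → ℚ
  classSum w C = sum (λ x → 𝟙 (x ∈? C) * w x)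

  module _ (R-refl : ∀ {x} → E x → R x x) (R-sym : ∀ {x y} → R x y → R y x)
           (R-trans : ∀ {x y z} → E x → E y → E z → R x y → R y z → R x z) where
    open ≡-Reasoning

    classOf-cong : ∀ {x y} → E x → E y → R x y → classOf x ≡ classOf y
    classOf-cong {x} {y} Ex Ey Rxy = ⊆-antisym (half Ex Ey (R-sym Rxy)) (half Ey Ex Rxy)
      where
      half : ∀ {x y} → E x → E y → R y x → classOf x ⊆ classOf y
      half {x} {y} Ex Ey Ryx z∈ with ∈-comprehension⁻ (λ z → E? z ×-dec R? x z) z∈
      ... | Ez , Rxz = ∈-comprehension⁺ (λ z → E? z ×-dec R? y z) (Ez , R-trans Ey Ex Ez Ryx Rxz)

    class∋⇒≡ : ∀ {C x} → IsClass C → x ∈ C → E x × C ≡ classOf x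
    class∋⇒≡ (z , Ez , refl) x∈ with ∈-comprehension⁻ (λ y → E? y ×-dec R? z y) x∈
    ... | Ex , Rzx = Ex , classOf-cong Ez Ex Rzx

    -- The only class that can contain `x` is `classOf x`, so the sum collapses to one term. This
    -- writes the kernel as a sum of rank-one squares, whence `form-kernel` and `kernel-psd`.
    kernel≡sumₗ : ∀ x y → kernel x y ≡ sumₗ (λ C → 𝟙 (x ∈? C) * 𝟙 (y ∈? C)) classes
    kernel≡sumₗ x y = sym (begin
      sumₗ (λ C → 𝟙 (x ∈? C) * 𝟙 (y ∈? C)) classes
        ≡⟨ sumₗ-filter isClass? (λ C → 𝟙 (x ∈? C) * 𝟙 (y ∈? C)) (subsets n) ⟩
      sumₗ (λ C → 𝟙 (isClass? C) * (𝟙 (x ∈? C) * 𝟙 (y ∈? C))) (subsets n)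
        ≡⟨ sumₗ-cong only-classOf (subsets n) ⟩
      sumₗ (λ C → 𝟙 (Vec.≡-dec Bool._≟_ C (classOf x)) * kernel x y) (subsets n)
        ≡⟨ sumₗ-subsets-δ (classOf x) (λ _ → kernel x y) ⟩
      kernel x y ∎)
      where
      only-classOf : ∀ C → 𝟙 (isClass? C) * (𝟙 (x ∈? C) * 𝟙 (y ∈? C)) ≡
                           𝟙 (Vec.≡-dec Bool._≟_ C (classOf x)) * kernel x y
      only-classOf C = begin
        𝟙 (isClass? C) * (𝟙 (x ∈? C) * 𝟙 (y ∈? C))
          ≡⟨ trans (𝟙-× (isClass? C) (x ∈? C ×-dec y ∈? C)) (cong (𝟙 (isClass? C) *_) (𝟙-× (x ∈? C) (y ∈? C))) ⟨
        𝟙 (isClass? C ×-dec (x ∈? C ×-dec y ∈? C))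
          ≡⟨ 𝟙-cong (isClass? C ×-dec (x ∈? C ×-dec y ∈? C))
                     (Vec.≡-dec Bool._≟_ C (classOf x) ×-dec (E? x ×-dec (E? y ×-dec R? x y))) to from ⟩
        𝟙 (Vec.≡-dec Bool._≟_ C (classOf x) ×-dec (E? x ×-dec (E? y ×-dec R? x y)))
          ≡⟨ 𝟙-× (Vec.≡-dec Bool._≟_ C (classOf x)) (E? x ×-dec (E? y ×-dec R? x y)) ⟩
        𝟙 (Vec.≡-dec Bool._≟_ C (classOf x)) * kernel x y ∎
        where
        to : IsClass C × x ∈ C × y ∈ C → C ≡ classOf x × E x × E y × R x y
        to (isC , x∈ , y∈) with class∋⇒≡ isC x∈
        ... | Ex , refl = refl , Ex , ∈-comprehension⁻ (λ y → E? y ×-dec R? x y) y∈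
        from : C ≡ classOf x × E x × E y × R x y → IsClass C × x ∈ C × y ∈ C
        from (refl , Ex , Ey , Rxy) = (x , Ex , refl) ,
          ∈-comprehension⁺ (λ y → E? y ×-dec R? x y) (Ex , R-refl Ex) ,
          ∈-comprehension⁺ (λ y → E? y ×-dec R? x y) (Ey , Rxy)

    form-kernel : ∀ w → form kernel w w ≡ sumₗ (λ C → classSum w C * classSum w C) classes
    form-kernel w = begin
      sum (λ x → w x * sum (λ y → kernel x y * w y))
        ≡⟨ sum-cong-≗ (λ x → trans (cong (w x *_)
              (trans (sum-cong-≗ (row x)) (sum-sumₗ-comm (λ C y → 𝟙 (x ∈? C) * (𝟙 (y ∈? C) * w y)) classes)))
             (sumₗ-*ˡ (w x) (λ C → sum (λ y → 𝟙 (x ∈? C) * (𝟙 (y ∈? C) * w y))) classes)) ⟩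
      sum (λ x → sumₗ (λ C → w x * sum (λ y → 𝟙 (x ∈? C) * (𝟙 (y ∈? C) * w y))) classes)
        ≡⟨ sum-sumₗ-comm (λ C x → w x * sum (λ y → 𝟙 (x ∈? C) * (𝟙 (y ∈? C) * w y))) classes ⟩
      sumₗ (λ C → sum (λ x → w x * sum (λ y → 𝟙 (x ∈? C) * (𝟙 (y ∈? C) * w y)))) classes
        ≡⟨ sumₗ-cong (λ C → trans (sum-cong-≗ (λ x → trans
             (cong (w x *_) (sym (*-distribˡ-sum (𝟙 (x ∈? C)) (λ y → 𝟙 (y ∈? C) * w y))))
             (solve 3 (λ w i s → w :* (i :* s) := s :* (i :* w)) refl (w x) (𝟙 (x ∈? C)) (classSum w C))))
             (sym (*-distribˡ-sum (classSum w C) (λ x → 𝟙 (x ∈? C) * w x)))) classes ⟩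
      sumₗ (λ C → classSum w C * classSum w C) classes ∎
      where
      row : ∀ x y → kernel x y * w y ≡ sumₗ (λ C → 𝟙 (x ∈? C) * (𝟙 (y ∈? C) * w y)) classes
      row x y = begin
        kernel x y * w y
          ≡⟨ trans (cong (_* w y) (kernel≡sumₗ x y)) (ℚ.*-comm _ (w y)) ⟩
        w y * sumₗ (λ C → 𝟙 (x ∈? C) * 𝟙 (y ∈? C)) classes
          ≡⟨ sumₗ-*ˡ (w y) (λ C → 𝟙 (x ∈? C) * 𝟙 (y ∈? C)) classes ⟩
        sumₗ (λ C → w y * (𝟙 (x ∈? C) * 𝟙 (y ∈? C))) classes
          ≡⟨ sumₗ-cong (λ C → solve 3 (λ w i j → w :* (i :* j) := i :* (j :* w)) refl (w y) (𝟙 (x ∈? C)) (𝟙 (y ∈? C))) classes ⟩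
        sumₗ (λ C → 𝟙 (x ∈? C) * (𝟙 (y ∈? C) * w y)) classes ∎

    kernel-psd : ∀ w → 0ℚ ℚ.≤ form kernel w w
    kernel-psd w = subst (0ℚ ℚ.≤_) (sym (form-kernel w))
      (sumₗ-nonneg (λ C → square-nonneg (classSum w C)) classes)

    total≡sumₗ-classSum : ∀ w → sum (λ x → 𝟙 (E? x) * w x) ≡ sumₗ (classSum w) classes
    total≡sumₗ-classSum w = trans (sum-cong-≗ (λ x → begin
      𝟙 (E? x) * w x
        ≡⟨ cong (_* w x) (trans (𝟙-cong (E? x) (E? x ×-dec (E? x ×-dec R? x x)) (λ Ex → Ex , Ex , R-refl Ex) proj₁)
              (kernel≡sumₗ x x)) ⟩
      sumₗ (λ C → 𝟙 (x ∈? C) * 𝟙 (x ∈? C)) classes * w x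
        ≡⟨ trans (ℚ.*-comm _ (w x)) (sumₗ-*ˡ (w x) (λ C → 𝟙 (x ∈? C) * 𝟙 (x ∈? C)) classes) ⟩
      sumₗ (λ C → w x * (𝟙 (x ∈? C) * 𝟙 (x ∈? C))) classes
        ≡⟨ sumₗ-cong (λ C → trans (ℚ.*-comm (w x) _) (cong (_* w x)
             (trans (sym (𝟙-× (x ∈? C) (x ∈? C))) (𝟙-cong (x ∈? C ×-dec x ∈? C) (x ∈? C) proj₁ (λ p → p , p))))) classes ⟩
      sumₗ (λ C → 𝟙 (x ∈? C) * w x) classes ∎))
      (sum-sumₗ-comm (λ C x → 𝟙 (x ∈? C) * w x) classes)

    -- The total is the sum of the class sums, and Cauchy-Schwarz over the list of classes
    -- contributes its length. Here the number of parallel classes enters the theorem.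
    total²≤ : ∀ w → sum (λ x → 𝟙 (E? x) * w x) * sum (λ x → 𝟙 (E? x) * w x) ℚ.≤
      natℚ (length classes) * form kernel w w
    total²≤ w = subst₂ ℚ._≤_ (cong (λ s → s * s) (sym (total≡sumₗ-classSum w)))
      (cong (natℚ (length classes) *_) (sym (form-kernel w))) (Cauchy-Schwarz (classSum w) classes)

    𝟙-complement : ∀ x y → 𝟙 (E? x ×-dec (E? y ×-dec ¬? (R? x y))) ≡ 𝟙 (E? x) * 𝟙 (E? y) - kernel x y
    𝟙-complement x y with E? x | E? y | R? x y
    ... | yes _ | yes _ | yes _ = refl
    ... | yes _ | yes _ | no _  = refl
    ... | yes _ | no _  | _     = refl
    ... | no _  | yes _ | _     = refl
    ... | no _  | no _  | _     = refl

    -- On `E` the complement of an equivalence relation is the all-ones matrix minus `kernel`: one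
    -- square minus a positive semidefinite form.
    form-complement : ∀ (ω v : Vector n) →
      sum (λ x → v x * sum (λ y → 𝟙 (E? x ×-dec (E? y ×-dec ¬? (R? x y))) * (ω x * ω y) * v y)) ≡
      sum (λ x → 𝟙 (E? x) * (ω x * v x)) * sum (λ x → 𝟙 (E? x) * (ω x * v x))
        - form kernel (λ x → ω x * v x) (λ x → ω x * v x)
    form-complement ω v = begin
      sum (λ x → v x * sum (λ y → 𝟙 (E? x ×-dec (E? y ×-dec ¬? (R? x y))) * (ω x * ω y) * v y))
        ≡⟨ sum-cong-≗ (λ x → begin
             v x * sum (λ y → 𝟙 (E? x ×-dec (E? y ×-dec ¬? (R? x y))) * (ω x * ω y) * v y)
               ≡⟨ *-distribˡ-sum (v x) (λ y → 𝟙 (E? x ×-dec (E? y ×-dec ¬? (R? x y))) * (ω x * ω y) * v y) ⟩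
             sum (λ y → v x * (𝟙 (E? x ×-dec (E? y ×-dec ¬? (R? x y))) * (ω x * ω y) * v y))
               ≡⟨ sum-cong-≗ (λ y → trans
                    (cong (λ e → v x * (e * (ω x * ω y) * v y)) (𝟙-complement x y))
                    (solve 7 (λ a b i j k p q → a :* ((i :* j :- k) :* (p :* q) :* b) :=
                        (i :* (p :* a)) :* (j :* (q :* b)) :- (p :* a) :* (k :* (q :* b)))
                      refl (v x) (v y) (𝟙 (E? x)) (𝟙 (E? y)) (kernel x y) (ω x) (ω y))) ⟩
             sum (λ y → t x * t y - w x * (kernel x y * w y))
               ≡⟨ sum-sub (λ y → t x * t y) (λ y → w x * (kernel x y * w y)) ⟩
             sum (λ y → t x * t y) - sum (λ y → w x * (kernel x y * w y))
               ≡⟨ cong₂ _-_ (*-distribˡ-sum (t x) t) (*-distribˡ-sum (w x) (λ y → kernel x y * w y)) ⟨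
             t x * sum t - w x * (kernel · w) x ∎) ⟩
      sum (λ x → t x * sum t - w x * (kernel · w) x)
        ≡⟨ sum-sub (λ x → t x * sum t) (λ x → w x * (kernel · w) x) ⟩
      sum (λ x → t x * sum t) - form kernel w w
        ≡⟨ cong (_- form kernel w w) (trans (sum-cong-≗ (λ x → ℚ.*-comm (t x) (sum t))) (sym (*-distribˡ-sum (sum t) t))) ⟩
      sum t * sum t - form kernel w w ∎
      where
      t w : Vector n
      t x = 𝟙 (E? x) * (ω x * v x)
      w x = ω x * v x

module _ {n} {Adj : Fin n → Fin n → Set} (adj? : Decidable₂ Adj)
  (adj-irrefl : ∀ {x} → ¬ Adj x x) (adj-sym : ∀ {x y} → Adj x y → Adj y x)
  (adj-exchange : ∀ {x y z w} → Adj x z → Adj y w → Adj y x ⊎ Adj y z) where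

  -- The exchange property makes non-adjacency an equivalence relation on the
  -- non-isolated vertices, so Adj is a complete multipartite graph.
  multipartite-negative : ∀ (ω : Vector n) → NegativeOnHyperplane (λ x y → 𝟙 (adj? x y) * (ω x * ω y))
  -- The functional is the weighted total, whose square is the only positive part of the form.
  multipartite-negative ω = (λ x → 𝟙 (E? x) * ω x) , λ v l·v≡0 →
      subst (ℚ._≤ 0ℚ) (sym (form≡ v l·v≡0)) (ℚ.neg-antimono-≤ (kernel-psd R-refl R-sym R-trans (λ x → ω x * v x)))
    where
    open ≡-Reasoning
    E? : Decidable (λ x → ∃ (Adj x))
    E? x = Fin.any? (adj? x)

    open Classes E? (λ x y → ¬? (adj? x y))

    R-refl : ∀ {x} → ∃ (Adj x) → ¬ Adj x x
    R-refl _ = adj-irrefl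
    R-sym : ∀ {x y} → ¬ Adj x y → ¬ Adj y x
    R-sym ¬xy yx = ¬xy (adj-sym yx)
    R-trans : ∀ {x y z} → ∃ (Adj x) → ∃ (Adj y) → ∃ (Adj z) → ¬ Adj x y → ¬ Adj y z → ¬ Adj x z
    -- Exchange between an edge from x to z and an edge at y would join y to x or to z; the edge at
    -- y exists because y is not isolated.
    R-trans _ (_ , yw) _ ¬xy ¬yz xz = [ ¬xy ∘ adj-sym , ¬yz ]′ (adj-exchange xz yw)

    adj⇔ : ∀ x y → 𝟙 (adj? x y) ≡ 𝟙 (E? x ×-dec (E? y ×-dec ¬? (¬? (adj? x y))))
    adj⇔ x y = 𝟙-cong (adj? x y) (E? x ×-dec (E? y ×-dec ¬? (¬? (adj? x y))))
      (λ xy → (y , xy) , (x , adj-sym xy) , λ ¬xy → ¬xy xy)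
      (λ (_ , _ , ¬¬xy) → decidable-stable (adj? x y) ¬¬xy)

    form≡ : ∀ v → dot (λ x → 𝟙 (E? x) * ω x) v ≡ 0ℚ →
      form (λ x y → 𝟙 (adj? x y) * (ω x * ω y)) v v ≡ - form kernel (λ x → ω x * v x) (λ x → ω x * v x)
    form≡ v l·v≡0 = begin
      form (λ x y → 𝟙 (adj? x y) * (ω x * ω y)) v v
        ≡⟨ sum-cong-≗ (λ x → cong (v x *_) (sum-cong-≗ (λ y → cong (λ e → e * (ω x * ω y) * v y) (adj⇔ x y)))) ⟩
      sum (λ x → v x * sum (λ y → 𝟙 (E? x ×-dec (E? y ×-dec ¬? (¬? (adj? x y)))) * (ω x * ω y) * v y))
        ≡⟨ form-complement R-refl R-sym R-trans ω v ⟩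
      sum (λ x → 𝟙 (E? x) * (ω x * v x)) * sum (λ x → 𝟙 (E? x) * (ω x * v x)) - q
        ≡⟨ cong (λ e → e * e - q) (trans (sum-cong-≗ (λ x → sym (ℚ.*-assoc (𝟙 (E? x)) (ω x) (v x)))) l·v≡0) ⟩
      0ℚ * 0ℚ - q
        ≡⟨ solve 1 (λ q → con 0ℚ :* con 0ℚ :- q := :- q) refl q ⟩
      - q ∎
      where q = form kernel (λ x → ω x * v x) (λ x → ω x * v x)

module _ {n} {E : Pred (Fin n) 0ℓ} (E? : Decidable E) {R : Fin n → Fin n → Set} (R? : Decidable₂ R)
  (R-refl : ∀ {x} → E x → R x x) (R-sym : ∀ {x y} → R x y → R y x)
  (R-trans : ∀ {x y z} → E x → E y → E z → R x y → R y z → R x z) where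
  open Classes E? R?

  -- With s the total and q the sum of squares of the class sums, c A(v,v) equals
  -- (c v₀ + s)² + (c - 1) s² - c q, and s² ≤ (number of classes) q.
  cone-negative : ∀ c → 1ℚ ℚ.≤ c → (c - 1ℚ) * natℚ (length classes) ℚ.≤ c →
    ∀ (ω : Vector n) (A : Matrix (suc n)) → A zero zero ≡ c →
    (∀ x → A zero (suc x) ≡ 𝟙 (E? x) * ω x) → (∀ x → A (suc x) zero ≡ 𝟙 (E? x) * ω x) →
    (∀ x y → A (suc x) (suc y) ≡ 𝟙 (E? x ×-dec (E? y ×-dec ¬? (R? x y))) * (ω x * ω y)) →
    NegativeOnHyperplane A
  -- `l` is the row `A zero`, so the hyperplane is the orthogonal complement of e₀ with respect to
  -- `A`.
  cone-negative c 1≤c cN≤c ω A A₀₀ A₀ₓ Aₓ₀ Aₓᵧ = l , negative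
    where
    open ≡-Reasoning
    l : Vector (suc n)
    l zero    = c
    l (suc x) = 𝟙 (E? x) * ω x

    0<c : 0ℚ ℚ.< c
    0<c = ℚ.<-≤-trans (ℚ.positive⁻¹ 1ℚ) 1≤c

    negative : ∀ v → dot l v ≡ 0ℚ → form A v v ℚ.≤ 0ℚ
    negative v l·v≡0 = *-cancelˡ-≤ 0<c (subst₂ ℚ._≤_ (sym c*form≡) (sym (ℚ.*-zeroʳ c)) bound)
      where
      v₀ s q N : ℚ
      w : Vector n
      w x = ω x * v (suc x)
      v₀ = v zero
      s = sum (λ x → 𝟙 (E? x) * w x)
      q = form kernel w w
      N = natℚ (length classes)

      cv₀+s≡0 : c * v₀ + s ≡ 0ℚ
      cv₀+s≡0 = trans (cong (_+_ (c * v₀)) (sum-cong-≗ (λ x → sym (ℚ.*-assoc (𝟙 (E? x)) (ω x) (v (suc x)))))) l·v≡0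

      form≡ : form A v v ≡ v₀ * (c * v₀ + s) + (v₀ * s + (s * s - q))
      form≡ = cong₂ _+_ (cong (v₀ *_) (cong₂ _+_ (cong (_* v₀) A₀₀)
          (sum-cong-≗ (λ x → trans (cong (_* v (suc x)) (A₀ₓ x)) (ℚ.*-assoc (𝟙 (E? x)) (ω x) (v (suc x))))))) (begin
        sum (λ x → v (suc x) * (A (suc x) zero * v₀ + sum (λ y → A (suc x) (suc y) * v (suc y))))
          ≡⟨ sum-cong-≗ (λ x → trans (cong (v (suc x) *_) (cong₂ _+_ (cong (_* v₀) (Aₓ₀ x))
               (sum-cong-≗ (λ y → cong (_* v (suc y)) (Aₓᵧ x y)))))
               (solve 5 (λ a i o z r → a :* (i :* o :* z :+ r) := z :* (i :* (o :* a)) :+ a :* r)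
                 refl (v (suc x)) (𝟙 (E? x)) (ω x) v₀ (row x))) ⟩
        sum (λ x → v₀ * (𝟙 (E? x) * w x) + v (suc x) * row x)
          ≡⟨ ∑-distrib-+ (λ x → v₀ * (𝟙 (E? x) * w x)) (λ x → v (suc x) * row x) ⟩
        sum (λ x → v₀ * (𝟙 (E? x) * w x)) + sum (λ x → v (suc x) * row x)
          ≡⟨ cong₂ _+_ (sym (*-distribˡ-sum v₀ (λ x → 𝟙 (E? x) * w x)))
                       (form-complement R-refl R-sym R-trans ω (λ x → v (suc x))) ⟩
        v₀ * s + (s * s - q) ∎)
        where
        row : Vector n
        row x = sum (λ y → 𝟙 (E? x ×-dec (E? y ×-dec ¬? (R? x y))) * (ω x * ω y) * v (suc y))

      c*form≡ : c * form A v v ≡ (c - 1ℚ) * (s * s) - c * q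
      c*form≡ = begin
        c * form A v v
          ≡⟨ cong (c *_) form≡ ⟩
        c * (v₀ * (c * v₀ + s) + (v₀ * s + (s * s - q)))
          ≡⟨ solve 4 (λ c z s q → c :* (z :* (c :* z :+ s) :+ (z :* s :+ (s :* s :- q))) :=
               (c :* z :+ s) :* (c :* z :+ s) :+ ((c :- con 1ℚ) :* (s :* s) :- c :* q)) refl c v₀ s q ⟩
        (c * v₀ + s) * (c * v₀ + s) + ((c - 1ℚ) * (s * s) - c * q)
          ≡⟨ cong (λ e → e * e + ((c - 1ℚ) * (s * s) - c * q)) cv₀+s≡0 ⟩
        0ℚ * 0ℚ + ((c - 1ℚ) * (s * s) - c * q)
          ≡⟨ ℚ.+-identityˡ _ ⟩
        (c - 1ℚ) * (s * s) - c * q ∎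

      bound : (c - 1ℚ) * (s * s) - c * q ℚ.≤ 0ℚ
      bound = subst ((c - 1ℚ) * (s * s) - c * q ℚ.≤_) (ℚ.+-inverseʳ (c * q)) (ℚ.+-monoˡ-≤ (- (c * q))
        (ℚ.≤-trans (*-monoˡ-≤ (≤⇒0≤- 1≤c) (total²≤ R-refl R-sym R-trans w))
          (subst (ℚ._≤ c * q) (ℚ.*-assoc (c - 1ℚ) N q)
            (ℚ.*-monoʳ-≤-nonNeg q {{ℚ.nonNegative (kernel-psd R-refl R-sym R-trans w)}} cN≤c))))

-- Matroids and their morphisms

private variable
  n m : ℕ

∈-insert⁻ : ∀ (S : Subset n) {x y} → y ∈ S ∪ ⁅ x ⁆ → y ∈ S ⊎ y ≡ x
∈-insert⁻ S {x} y∈ with x∈p∪q⁻ S ⁅ x ⁆ y∈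
... | inj₁ y∈S = inj₁ y∈S
... | inj₂ y∈x = inj₂ (x∈⁅y⁆⇒x≡y x y∈x)

∈-insert : ∀ (S : Subset n) x → x ∈ S ∪ ⁅ x ⁆
∈-insert S x = x∈p∪q⁺ (inj₂ (x∈⁅x⁆ x))

⊆-insert : ∀ (S : Subset n) x → S ⊆ S ∪ ⁅ x ⁆
⊆-insert S x = p⊆p∪q ⁅ x ⁆

insert-⊆ : ∀ {S T : Subset n} {x} → S ⊆ T → x ∈ T → S ∪ ⁅ x ⁆ ⊆ T
insert-⊆ {S = S} S⊆T x∈T y∈ with ∈-insert⁻ S y∈
... | inj₁ y∈S  = S⊆T y∈S
... | inj₂ refl = x∈T

∉-insert : ∀ {S : Subset n} {x y} → y ∉ S → y ≢ x → y ∉ S ∪ ⁅ x ⁆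
∉-insert {S = S} y∉S y≢x y∈ = [ y∉S , y≢x ]′ (∈-insert⁻ S y∈)

insert-comm : ∀ (S : Subset n) x y → (S ∪ ⁅ x ⁆) ∪ ⁅ y ⁆ ≡ (S ∪ ⁅ y ⁆) ∪ ⁅ x ⁆
insert-comm S x y = trans (∪-assoc S ⁅ x ⁆ ⁅ y ⁆)
  (trans (cong (S ∪_) (∪-comm ⁅ x ⁆ ⁅ y ⁆)) (sym (∪-assoc S ⁅ y ⁆ ⁅ x ⁆)))

∣insert∣ : ∀ {S : Subset n} {x} → x ∉ S → ∣ S ∪ ⁅ x ⁆ ∣ ≡ suc ∣ S ∣
∣insert∣ {S = inside  Vec.∷ S} {zero}  x∉S = contradiction here x∉S
∣insert∣ {S = outside Vec.∷ S} {zero}  x∉S = cong (suc ∘ ∣_∣) (∪-identityʳ S)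
∣insert∣ {S = inside  Vec.∷ S} {suc x} x∉S = cong suc (∣insert∣ (x∉S ∘ there))
∣insert∣ {S = outside Vec.∷ S} {suc x} x∉S = ∣insert∣ (x∉S ∘ there)

⊆∧∣∣≥⇒≡ : ∀ {S T : Subset n} → S ⊆ T → ∣ T ∣ ≤ ∣ S ∣ → S ≡ T
⊆∧∣∣≥⇒≡ {S = S} {T} S⊆T ∣T∣≤∣S∣ = ⊆-antisym S⊆T T⊆S
  where
  T⊆S : T ⊆ S
  T⊆S {x} x∈T with x ∈? S
  ... | yes x∈S = x∈S
  ... | no  x∉S = contradiction
          (ℕ.≤-trans (subst (_≤ ∣ T ∣) (∣insert∣ x∉S) (p⊆q⇒∣p∣≤∣q∣ (insert-⊆ S⊆T x∈T))) ∣T∣≤∣S∣)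
          (ℕ.<-irrefl refl)

∈-subsets : ∀ (S : Subset n) → S List.∈ subsets n
∈-subsets Vec.[] = here refl
∈-subsets (outside Vec.∷ S) = ∈-++⁺ˡ (∈-map⁺ (outside Vec.∷_) (∈-subsets S))
∈-subsets {suc n} (inside Vec.∷ S) = ∈-++⁺ʳ (map (outside Vec.∷_) (subsets n)) (∈-map⁺ (inside Vec.∷_) (∈-subsets S))

image⁺ : ∀ (φ : Fin n → Fin m) {S x} → x ∈ S → φ x ∈ image φ S
image⁺ φ {S} {x} x∈S =
  ∈-comprehension⁺ (λ y → Fin.any? (λ x → (x ∈? S) ×-dec (φ x Fin.≟ y))) (x , x∈S , refl)

image⁻ : ∀ (φ : Fin n → Fin m) {S y} → y ∈ image φ S → ∃ λ x → x ∈ S × φ x ≡ y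
image⁻ φ {S} = ∈-comprehension⁻ (λ y → Fin.any? (λ x → (x ∈? S) ×-dec (φ x Fin.≟ y)))

image-mono : ∀ (φ : Fin n → Fin m) {S T} → S ⊆ T → image φ S ⊆ image φ T
image-mono φ S⊆T y∈ with image⁻ φ y∈
... | x , x∈S , refl = image⁺ φ (S⊆T x∈S)

module _ (M : Matroid n) where

  ⊥-indep : Indep M ⊥
  ⊥-indep = hereditary M (⊆-min _) (proj₂ (nonempty M))

  rank-≥ : ∀ {A S} → A ⊆ S → Indep M A → ∣ A ∣ ≤ rank M S
  rank-≥ {A} {S} A⊆S iA = All.lookup (xs≤max 0 _)
    (∈-map⁺ ∣_∣ (∈-filter⁺ (λ A → (A ⊆? S) ×-dec indep? M A) (∈-subsets A) (A⊆S , iA)))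

  rank-witness : ∀ S → ∃ λ A → A ⊆ S × Indep M A × ∣ A ∣ ≡ rank M S
  rank-witness S with argmax-sel id 0 (map ∣_∣ (filter (λ A → (A ⊆? S) ×-dec indep? M A) (subsets n)))
  ... | inj₁ ≡0 = ⊥ , ⊆-min S , ⊥-indep , trans (∣⊥∣≡0 n) (sym ≡0)
  ... | inj₂ ∈max with ∈-map⁻ ∣_∣ ∈max
  ...   | A , A∈ , max≡ with ∈-filter⁻ (λ A → (A ⊆? S) ×-dec indep? M A) {xs = subsets n} A∈
  ...     | _ , A⊆S , iA = A , A⊆S , iA , sym max≡

  rank-mono : ∀ {S T} → S ⊆ T → rank M S ≤ rank M T
  rank-mono {S} S⊆T with rank-witness S
  ... | A , A⊆S , iA , ∣A∣≡ = subst (_≤ _) ∣A∣≡ (rank-≥ (⊆-trans A⊆S S⊆T) iA)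

  rank-indep : ∀ {S} → Indep M S → rank M S ≡ ∣ S ∣
  rank-indep {S} iS with rank-witness S
  ... | A , A⊆S , _ , ∣A∣≡ =
    ℕ.≤-antisym (subst (_≤ ∣ S ∣) ∣A∣≡ (p⊆q⇒∣p∣≤∣q∣ A⊆S)) (rank-≥ ⊆-refl iS)

  -- `y` comes from exchanging a largest independent subset of `U` against one of `T`. The
  -- conclusion covers every `W` so that it applies directly to the image of an enlarged set, which
  -- contains the old image and `y`.
  rank-augment : ∀ {U T} → rank M U < rank M T →
    ∃ λ y → y ∈ T × (∀ {W} → U ⊆ W → y ∈ W → rank M U < rank M W)
  rank-augment {U} {T} U<T with rank-witness U | rank-witness T
  ... | A , A⊆U , iA , ∣A∣≡ | B , B⊆T , iB , ∣B∣≡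
    with exchange M iA iB (subst₂ _<_ (sym ∣A∣≡) (sym ∣B∣≡) U<T)
  ...   | y , y∈B , y∉A , iAy = y , B⊆T y∈B , λ U⊆W y∈W →
            subst₂ _≤_ (trans (∣insert∣ y∉A) (cong suc ∣A∣≡)) refl (rank-≥ (insert-⊆ (⊆-trans A⊆U U⊆W) y∈W) iAy)

  parallel-sym : ∀ S {x y} → Parallel M S x y → Parallel M S y x
  parallel-sym S (inj₁ x≡y) = inj₁ (sym x≡y)
  parallel-sym S {x} {y} (inj₂ dep) = inj₂ (dep ∘ subst (λ A → Indep M (S ∪ A)) (∪-comm ⁅ y ⁆ ⁅ x ⁆))

  -- If S + x + z were independent, exchanging S + y against it would adjoin x or z to S + y,
  -- although y is parallel to both.
  parallel-trans : ∀ S {x y z} → Cont M S x → Cont M S y → Cont M S z →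
    Parallel M S x y → Parallel M S y z → Parallel M S x z
  parallel-trans S _ _ _ (inj₁ refl) yz = yz
  parallel-trans S _ _ _ xy (inj₁ refl) = xy
  parallel-trans S {x} {y} {z} (x∉S , _) (y∉S , iSy) (z∉S , _) (inj₂ ¬xy) (inj₂ ¬yz)
    with x Fin.≟ z | indep? M (S ∪ (⁅ x ⁆ ∪ ⁅ z ⁆))
  ... | yes x≡z | _      = inj₁ x≡z
  ... | no _    | no ¬xz = inj₂ ¬xz
  ... | no x≢z  | yes ixz with exchange M iSy ixz′ bigger
    where
    ixz′ : Indep M ((S ∪ ⁅ x ⁆) ∪ ⁅ z ⁆)
    ixz′ = subst (Indep M) (sym (∪-assoc S ⁅ x ⁆ ⁅ z ⁆)) ixz
    bigger : ∣ S ∪ ⁅ y ⁆ ∣ < ∣ (S ∪ ⁅ x ⁆) ∪ ⁅ z ⁆ ∣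
    bigger = ℕ.≤-reflexive (trans (cong suc (∣insert∣ y∉S))
      (sym (trans (∣insert∣ (∉-insert z∉S (x≢z ∘ sym))) (cong suc (∣insert∣ x∉S)))))
  ... | t , t∈ , t∉ , iSyt with ∈-insert⁻ (S ∪ ⁅ x ⁆) t∈
  ...   | inj₂ refl = contradiction (subst (Indep M) (∪-assoc S ⁅ y ⁆ ⁅ t ⁆) iSyt) ¬yz
  ...   | inj₁ t∈′ with ∈-insert⁻ S t∈′
  ...     | inj₁ t∈S = contradiction (⊆-insert S y t∈S) t∉
  ...     | inj₂ refl = contradiction
              (subst (Indep M) (trans (insert-comm S y t) (∪-assoc S ⁅ t ⁆ ⁅ y ⁆)) iSyt) ¬xy

-- Exchange for bases of a morphism

module MorphismProperties {M : Matroid n} {N : Matroid m} (Φ : Morphism M N) where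
  open Morphism Φ

  g : Subset n → ℕ
  g S = rank N (image fun S)

  g-mono : ∀ {S T} → S ⊆ T → g S ≤ g T
  g-mono S⊆T = rank-mono N (image-mono fun S⊆T)

  g≤rk : ∀ S → g S ≤ rk N
  g≤rk S = rank-mono N (⊆-max (image fun S))

  -- `rankDrop` with the subtractions moved across, so that later arguments stay in ℕ.
  g-drop : ∀ {S T} → S ⊆ T → g T ℕ.+ rank M S ≤ g S ℕ.+ rank M T
  g-drop {S} {T} S⊆T = ℤ.drop‿+≤+ (subst₂ ℤ._≤_
      (telescope (+ g T) (+ g S) (+ rank M S))
      (trans (cong (ℤ._+_ (+ rank M T ℤ.- + rank M S)) (ℤ.+-comm (+ g S) (+ rank M S)))
        (trans (telescope (+ rank M T) (+ rank M S) (+ g S)) (ℤ.+-comm (+ rank M T) (+ g S))))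
      (ℤ.+-monoˡ-≤ (+ g S ℤ.+ + rank M S) (rankDrop S⊆T)))
    where
    open ≡-Reasoning
    telescope : ∀ a b d → (a ℤ.- b) ℤ.+ (b ℤ.+ d) ≡ a ℤ.+ d
    telescope a b d = begin
      (a ℤ.- b) ℤ.+ (b ℤ.+ d)      ≡⟨ ℤ.+-assoc a (ℤ.- b) (b ℤ.+ d) ⟩
      a ℤ.+ (ℤ.- b ℤ.+ (b ℤ.+ d))  ≡⟨ cong (ℤ._+_ a) (ℤ.+-assoc (ℤ.- b) b d) ⟨
      a ℤ.+ ((ℤ.- b ℤ.+ b) ℤ.+ d)  ≡⟨ cong (λ z → a ℤ.+ (z ℤ.+ d)) (ℤ.+-inverseˡ b) ⟩
      a ℤ.+ (ℤ.0ℤ ℤ.+ d)           ≡⟨ cong (ℤ._+_ a) (ℤ.+-identityˡ d) ⟩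
      a ℤ.+ d                      ∎

  -- The rank in `M` must rise along with `g`, so U + t has an independent subset larger than `U`.
  -- Exchange adjoins one of its elements to `U`, and only `t` is new.
  g-increase⇒indep : ∀ {U t} → Indep M U → g U < g (U ∪ ⁅ t ⁆) → t ∉ U × Indep M (U ∪ ⁅ t ⁆)
  g-increase⇒indep {U} {t} iU gU<gUt =
    let A , A⊆ , iA , ∣A∣≡ = rank-witness M (U ∪ ⁅ t ⁆)
        x , x∈A , x∉U , iUx = exchange M iU iA (subst (∣ U ∣ <_) (sym ∣A∣≡) ∣U∣<rank)
    in  the-new-element x∉U iUx (∈-insert⁻ U (A⊆ x∈A))
    where
    ∣U∣<rank : ∣ U ∣ < rank M (U ∪ ⁅ t ⁆)
    ∣U∣<rank = subst (_< rank M (U ∪ ⁅ t ⁆)) (rank-indep M iU) (ℕ.+-cancelˡ-< (g U) (rank M U) (rank M (U ∪ ⁅ t ⁆))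
      (ℕ.<-≤-trans (ℕ.+-monoˡ-< (rank M U) gU<gUt) (g-drop (⊆-insert U t))))
    the-new-element : ∀ {x} → x ∉ U → Indep M (U ∪ ⁅ x ⁆) → x ∈ U ⊎ x ≡ t → t ∉ U × Indep M (U ∪ ⁅ t ⁆)
    the-new-element x∉U iUx (inj₁ x∈U)  = contradiction x∈U x∉U
    the-new-element x∉U iUx (inj₂ refl) = x∉U , iUx

  -- The augmentation happens in `N`: the new element lies in the image of `T`, hence lifts to some
  -- `t`, and independence in `M` follows from the increase of `g`.
  augment : ∀ {U T} → Indep M U → g U < g T →
    ∃ λ t → t ∈ T × t ∉ U × Indep M (U ∪ ⁅ t ⁆) × g U < g (U ∪ ⁅ t ⁆)
  augment {U} {T} iU gU<gT =
    let y , y∈ , increases = rank-augment N gU<gT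
        t , t∈T , φt≡y = image⁻ fun y∈
        gU<gUt = increases (image-mono fun (⊆-insert U t))
                   (subst (_∈ image fun (U ∪ ⁅ t ⁆)) φt≡y (image⁺ fun (∈-insert U t)))
        t∉U , iUt = g-increase⇒indep iU gU<gUt
    in  t , t∈T , t∉U , iUt , gU<gUt

  -- Provided there is a basis of Φ with at least |U| + d elements, this says that
  -- U extends to one with exactly |U| + d elements.
  Extendable : ℕ → Subset n → Set
  Extendable d U = Indep M U × rk N ≤ d ℕ.+ g U

  basis⇒extendable : ∀ {S} → IsBasis Φ S → Extendable 0 S
  basis⇒extendable (iS , gS≡) = iS , ℕ.≤-reflexive (sym gS≡)

  extendable⇒basis : ∀ {S} → Extendable 0 S → IsBasis Φ S
  extendable⇒basis {S} (iS , r≤) = iS , ℕ.≤-antisym (g≤rk S) r≤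

  superset-basis : ∀ {S T} → IsBasis Φ S → S ⊆ T → Indep M T → IsBasis Φ T
  superset-basis {S} {T} (_ , gS≡) S⊆T iT = iT , ℕ.≤-antisym (g≤rk T) (subst (_≤ g T) gS≡ (g-mono S⊆T))

  extendable-≤ : ∀ {d e U} → d ≤ e → Extendable d U → Extendable e U
  extendable-≤ {U = U} d≤e (iU , r≤) = iU , ℕ.≤-trans r≤ (ℕ.+-monoˡ-≤ (g U) d≤e)

  -- By `g-drop`, passing from `U` to `T` raises `g` by at most the `d` elements gained.
  subset-extendable : ∀ {U T d} → IsBasis Φ T → U ⊆ T → ∣ T ∣ ≡ ∣ U ∣ ℕ.+ d → Extendable d U
  subset-extendable {U} {T} {d} (iT , gT≡) U⊆T ∣T∣≡ = iU , ℕ.+-cancelʳ-≤ ∣ U ∣ (rk N) (d ℕ.+ g U)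
      (begin
        rk N ℕ.+ ∣ U ∣         ≡⟨ cong₂ ℕ._+_ gT≡ (rank-indep M iU) ⟨
        g T ℕ.+ rank M U       ≤⟨ g-drop U⊆T ⟩
        g U ℕ.+ rank M T       ≡⟨ cong (g U ℕ.+_) (trans (rank-indep M iT) ∣T∣≡) ⟩
        g U ℕ.+ (∣ U ∣ ℕ.+ d)  ≡⟨ cong (g U ℕ.+_) (ℕ.+-comm ∣ U ∣ d) ⟩
        g U ℕ.+ (d ℕ.+ ∣ U ∣)  ≡⟨ ℕ.+-assoc (g U) d ∣ U ∣ ⟨
        g U ℕ.+ d ℕ.+ ∣ U ∣    ≡⟨ cong (ℕ._+ ∣ U ∣) (ℕ.+-comm (g U) d) ⟩
        d ℕ.+ g U ℕ.+ ∣ U ∣    ∎)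
    where
    open ℕ.≤-Reasoning
    iU = hereditary M U⊆T iT

  -- While `g U` is below `rk N`, the new element is chosen to raise `g`, which lowers the deficit
  -- by one whatever the sizes are. Once there is no deficit, ordinary exchange in `M` suffices; it
  -- requires |U| < |T|.
  extendable-exchange : ∀ {d U T} → Extendable (suc d) U → IsBasis Φ T → (g U < rk N ⊎ ∣ U ∣ < ∣ T ∣) →
    ∃ λ t → t ∈ T × t ∉ U × Extendable d (U ∪ ⁅ t ⁆)
  extendable-exchange {d} {U} {T} (iU , r≤) (iT , gT≡) room = by-cases (g U ℕ.<? rk N)
    where
    by-cases : Dec (g U < rk N) → ∃ λ t → t ∈ T × t ∉ U × Extendable d (U ∪ ⁅ t ⁆)
    by-cases (yes gU<r) =
      let t , t∈T , t∉U , iUt , gU<gUt = augment iU (subst (g U <_) (sym gT≡) gU<r)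
      in  t , t∈T , t∉U , iUt ,
          ℕ.≤-trans r≤ (subst (_≤ d ℕ.+ g (U ∪ ⁅ t ⁆)) (ℕ.+-suc d (g U)) (ℕ.+-monoʳ-≤ d gU<gUt))
    by-cases (no gU≮r) =
      let t , t∈T , t∉U , iUt = exchange M iU iT ([ (λ gU<r → contradiction gU<r gU≮r) , id ]′ room)
      in  t , t∈T , t∉U , iUt ,
          ℕ.≤-trans (ℕ.≮⇒≥ gU≮r) (ℕ.≤-trans (g-mono (⊆-insert U t)) (ℕ.m≤n+m (g (U ∪ ⁅ t ⁆)) d))

-- The atlas

-- A function F on subsets stands for the generating function Σ_T F(T) ∏_{x ∈ T} ω(x) t_x,
-- and δ x for the partial derivative with respect to t_x.
module Derivatives {n} (ω : Vector n) where
  open ≡-Reasoning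

  -- The weight of the step from S to S + x. Its vanishing for x in S makes the generating function
  -- multi-affine: applying `δ x` twice gives 0.
  κ : Fin n → Subset n → ℚ
  κ x S = 𝟙 (¬? (x ∈? S)) * ω x

  δ : Fin n → (Subset n → ℚ) → Subset n → ℚ
  δ x F S = κ x S * F (S ∪ ⁅ x ⁆)

  ∂ : (Subset n → ℚ) → Subset n → ℚ
  ∂ F S = sum (λ x → δ x F S)

  κ-∈ : ∀ {x S} → x ∈ S → κ x S ≡ 0ℚ
  κ-∈ {x} {S} x∈S = trans (cong (_* ω x) (𝟙-no (¬? (x ∈? S)) (λ x∉S → x∉S x∈S))) (ℚ.*-zeroˡ (ω x))

  κ-∉ : ∀ {x S} → x ∉ S → κ x S ≡ ω x
  κ-∉ {x} {S} x∉S = trans (cong (_* ω x) (𝟙-yes (¬? (x ∈? S)) x∉S)) (ℚ.*-identityˡ (ω x))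

  κ-insert : ∀ {x y} S → y ≢ x → κ y (S ∪ ⁅ x ⁆) ≡ κ y S
  κ-insert {x} {y} S y≢x = cong (_* ω y) (𝟙-cong (¬? (y ∈? S ∪ ⁅ x ⁆)) (¬? (y ∈? S))
    (λ y∉ y∈S → y∉ (⊆-insert S x y∈S)) (λ y∉S → ∉-insert y∉S y≢x))

  δ-comm : ∀ x y F S → δ x (δ y F) S ≡ δ y (δ x F) S
  δ-comm x y F S with x Fin.≟ y
  ... | yes refl = refl
  ... | no x≢y = begin
    κ x S * (κ y (S ∪ ⁅ x ⁆) * F ((S ∪ ⁅ x ⁆) ∪ ⁅ y ⁆))
      ≡⟨ cong₂ (λ a b → κ x S * (a * F b)) (κ-insert S (x≢y ∘ sym)) (insert-comm S x y) ⟩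
    κ x S * (κ y S * F ((S ∪ ⁅ y ⁆) ∪ ⁅ x ⁆))
      ≡⟨ solve 3 (λ a b c → a :* (b :* c) := b :* (a :* c)) refl (κ x S) (κ y S) (F ((S ∪ ⁅ y ⁆) ∪ ⁅ x ⁆)) ⟩
    κ y S * (κ x S * F ((S ∪ ⁅ y ⁆) ∪ ⁅ x ⁆))
      ≡⟨ cong (λ a → κ y S * (a * F ((S ∪ ⁅ y ⁆) ∪ ⁅ x ⁆))) (κ-insert S x≢y) ⟨
    κ y S * (κ x (S ∪ ⁅ y ⁆) * F ((S ∪ ⁅ y ⁆) ∪ ⁅ x ⁆)) ∎

  sum-δδ : ∀ x F S → sum (λ y → δ x (δ y F) S) ≡ δ x (∂ F) S
  sum-δδ x F S = sym (*-distribˡ-sum (κ x S) (λ y → δ y F (S ∪ ⁅ x ⁆)))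

  δ-∂ : ∀ x F S → δ x (∂ F) S ≡ ∂ (δ x F) S
  δ-∂ x F S = trans (sym (sum-δδ x F S)) (sum-cong-≗ (λ y → δ-comm x y F S))

  module _ (ω>0 : ∀ x → 0ℚ ℚ.< ω x) where

    κ-nonneg : ∀ x S → 0ℚ ℚ.≤ κ x S
    κ-nonneg x S = *-nonneg (𝟙-nonneg (¬? (x ∈? S))) (ℚ.<⇒≤ (ω>0 x))

    δ-nonneg : ∀ {F} → (∀ S → 0ℚ ℚ.≤ F S) → ∀ x S → 0ℚ ℚ.≤ δ x F S
    δ-nonneg 0≤F x S = *-nonneg (κ-nonneg x S) (0≤F (S ∪ ⁅ x ⁆))

    δ-pos⁺ : ∀ {F x S} → x ∉ S → 0ℚ ℚ.< F (S ∪ ⁅ x ⁆) → 0ℚ ℚ.< δ x F S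
    δ-pos⁺ {F} {x} {S} x∉S 0<F = *-pos (subst (0ℚ ℚ.<_) (sym (κ-∉ x∉S)) (ω>0 x)) 0<F

    δ-pos⁻ : ∀ {F x S} → 0ℚ ℚ.< δ x F S → x ∉ S × 0ℚ ℚ.< F (S ∪ ⁅ x ⁆)
    δ-pos⁻ {F} {x} {S} 0<δ =
      (λ x∈S → ℚ.<-irrefl refl (subst (0ℚ ℚ.<_) (trans (cong (_* F (S ∪ ⁅ x ⁆)) (κ-∈ x∈S)) (ℚ.*-zeroˡ (F (S ∪ ⁅ x ⁆)))) 0<δ)) ,
      ℚ.*-cancelˡ-<-nonNeg (κ x S) {{ℚ.nonNegative (κ-nonneg x S)}}
        (subst (ℚ._< δ x F S) (sym (ℚ.*-zeroʳ (κ x S))) 0<δ)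

-- `T₊` is the basis against which all other sets are completed: any size up to |T₊| can be reached
-- by exchange, which turns extendability into positivity of `F`.
module Atlas {n m} {M : Matroid n} {N : Matroid m} (Φ : Morphism M N)
  (f : Subset n → ℚ) (f-basis : ∀ {S} → IsBasis Φ S → f S ≡ 1ℚ) (f-nonbasis : ∀ {S} → ¬ IsBasis Φ S → f S ≡ 0ℚ)
  (ω : Vector n) (ω>0 : ∀ x → 0ℚ ℚ.< ω x)
  (T₊ : Subset n) (T₊-basis : IsBasis Φ T₊) where

  open MorphismProperties Φ
  open Derivatives ω

  F : ℕ → Subset n → ℚ
  F zero    = f
  F (suc d) = ∂ (F d)

  f-nonneg : ∀ S → 0ℚ ℚ.≤ f S
  f-nonneg S = by-cases (isBasis? Φ S)
    where
    by-cases : Dec (IsBasis Φ S) → 0ℚ ℚ.≤ f S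
    by-cases (yes b) = subst (0ℚ ℚ.≤_) (sym (f-basis b)) (ℚ.nonNegative⁻¹ 1ℚ)
    by-cases (no ¬b) = ℚ.≤-reflexive (sym (f-nonbasis ¬b))

  F-nonneg : ∀ d S → 0ℚ ℚ.≤ F d S
  F-nonneg zero    S = f-nonneg S
  F-nonneg (suc d) S = sum-nonneg (λ x → δ-nonneg ω>0 (F-nonneg d) x S)

  F-pos⇒basis : ∀ d {S} → 0ℚ ℚ.< F d S → ∃ λ T → IsBasis Φ T × S ⊆ T × ∣ T ∣ ≡ ∣ S ∣ ℕ.+ d
  F-pos⇒basis zero {S} 0<f = S , by-cases (isBasis? Φ S) , ⊆-refl , sym (ℕ.+-identityʳ ∣ S ∣)
    where
    by-cases : Dec (IsBasis Φ S) → IsBasis Φ S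
    by-cases (yes b) = b
    by-cases (no ¬b) = contradiction (subst (0ℚ ℚ.<_) (f-nonbasis ¬b) 0<f) (ℚ.<-irrefl refl)
  F-pos⇒basis (suc d) {S} 0<F =
    let x , 0<δ = sum-pos⇒term-pos 0<F
        x∉S , 0<F′ = δ-pos⁻ ω>0 {F d} 0<δ
        T , T-basis , Sx⊆T , ∣T∣≡ = F-pos⇒basis d 0<F′
    in  T , T-basis , ⊆-trans (⊆-insert S x) Sx⊆T ,
        trans ∣T∣≡ (trans (cong (ℕ._+ d) (∣insert∣ x∉S)) (sym (ℕ.+-suc ∣ S ∣ d)))

  -- Each of the `d` exchange steps takes an element of `T₊`, which stays the larger set until the
  -- size |S| + d is reached.
  extendable⇒F-pos : ∀ d {S} → Extendable d S → ∣ S ∣ ℕ.+ d ≤ ∣ T₊ ∣ → 0ℚ ℚ.< F d S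
  extendable⇒F-pos zero ext _ = subst (0ℚ ℚ.<_) (sym (f-basis (extendable⇒basis ext))) (ℚ.positive⁻¹ 1ℚ)
  extendable⇒F-pos (suc d) {S} ext S+d≤ =
    let x , _ , x∉S , ext′ = extendable-exchange ext T₊-basis
          (inj₂ (ℕ.≤-trans (ℕ.s≤s (ℕ.m≤m+n ∣ S ∣ d)) 1+S+d≤))
    in  ℚ.<-≤-trans (δ-pos⁺ ω>0 {F d} x∉S (extendable⇒F-pos d ext′
            (subst (λ s → s ℕ.+ d ≤ ∣ T₊ ∣) (sym (∣insert∣ x∉S)) 1+S+d≤)))
          (term≤sum (λ y → δ-nonneg ω>0 (F-nonneg d) y S) x)
    where
    1+S+d≤ : suc (∣ S ∣ ℕ.+ d) ≤ ∣ T₊ ∣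
    1+S+d≤ = subst (_≤ ∣ T₊ ∣) (ℕ.+-suc ∣ S ∣ d) S+d≤

  -- A basis above `W` certifies that `U` is extendable within `d` steps; completion against `T₊`
  -- then adjusts the size to exactly |U| + d. The contrapositive shows that a vanishing `F` forces
  -- whole rows or matrices to vanish.
  F-pos-mono : ∀ d e {U W} → U ⊆ W → 0ℚ ℚ.< F e W → ∣ W ∣ ℕ.+ e ≤ ∣ U ∣ ℕ.+ d → ∣ U ∣ ℕ.+ d ≤ ∣ T₊ ∣ → 0ℚ ℚ.< F d U
  F-pos-mono d e {U} {W} U⊆W 0<F W+e≤U+d U+d≤ =
    let T , T-basis , W⊆T , ∣T∣≡ = F-pos⇒basis e 0<F
        U⊆T = ⊆-trans U⊆W W⊆T
        a , ∣T∣≡U+a = ℕ.m≤n⇒∃[o]m+o≡n (p⊆q⇒∣p∣≤∣q∣ U⊆T)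
    in  extendable⇒F-pos d (extendable-≤
          (ℕ.+-cancelˡ-≤ ∣ U ∣ a d (subst (_≤ ∣ U ∣ ℕ.+ d) (sym (trans ∣T∣≡U+a ∣T∣≡)) W+e≤U+d))
          (subset-extendable T-basis U⊆T (sym ∣T∣≡U+a))) U+d≤

  F-zero-mono : ∀ d e {U W} → U ⊆ W → F d U ≡ 0ℚ → ∣ W ∣ ℕ.+ e ≤ ∣ U ∣ ℕ.+ d → ∣ U ∣ ℕ.+ d ≤ ∣ T₊ ∣ → F e W ≡ 0ℚ
  F-zero-mono d e {U} {W} U⊆W F≡0 le le₊ = [ (λ F≤0 → ℚ.≤-antisym F≤0 (F-nonneg e W)) ,
    (λ 0<F → contradiction F≡0 (0<⇒≢0 (F-pos-mono d e U⊆W 0<F le le₊))) ]′ (≤0∨0< (F e W))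

  -- The matrices of the atlas and their induction

  module _ (c : ℚ) where
    open ≡-Reasoning

    A : ℕ → Subset n → Matrix (suc n)
    A d S zero    zero    = c * F d S
    A d S zero    (suc y) = δ y (F d) S
    A d S (suc x) zero    = δ x (F d) S
    A d S (suc x) (suc y) = δ x (δ y (F d)) S

    A-sym : ∀ d S → Symmetric (A d S)
    A-sym d S zero    zero    = refl
    A-sym d S zero    (suc y) = refl
    A-sym d S (suc x) zero    = refl
    A-sym d S (suc x) (suc y) = δ-comm x y (F d) S

    block-nonneg : ∀ d S x y → 0ℚ ℚ.≤ block (A d S) x y
    block-nonneg d S x y = δ-nonneg ω>0 (δ-nonneg ω>0 (F-nonneg d) y) x S

    degree≡ : ∀ d S x → degree (block (A d S)) x ≡ δ x (F (suc d)) S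
    degree≡ d S x = sum-δδ x (F d) S

    -- In the local-to-global argument this turns the coordinate x of A u into the local form of u
    -- against `ones` at S + x, which is what reverse Cauchy-Schwarz can bound.
    A·ones : ∀ d S x i → κ x S * (A d (S ∪ ⁅ x ⁆) · ones) i ≡ A (suc d) S (suc x) i
    A·ones d S x zero    = cong (κ x S *_) (·ones (A d (S ∪ ⁅ x ⁆)) zero)
    A·ones d S x (suc y) = cong (κ x S *_)
      (trans (·ones (A d (S ∪ ⁅ x ⁆)) (suc y)) (sum-δδ y (F d) (S ∪ ⁅ x ⁆)))

    form-ones : ∀ d S → form (A d S) ones ones ≡ F (suc (suc d)) S
    form-ones d S = trans (cong₂ _+_ (ℚ.*-zeroˡ ((A d S · ones) zero)) (sum-cong-≗ (λ x →
        trans (ℚ.*-identityˡ ((A d S · ones) (suc x))) (trans (·ones (A d S) (suc x)) (degree≡ d S x)))))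
      (ℚ.+-identityˡ (F (suc (suc d)) S))

    -- The derivatives in the entries commute with `∂`, and the corner follows the same rule because
    -- `c` does not depend on `S`. For this linearity `F` is an iterated derivative, which is the
    -- source of the factorial.
    A-step : ∀ d S i j → A (suc d) S i j ≡ sum (λ x → κ x S * A d (S ∪ ⁅ x ⁆) i j)
    A-step d S zero zero = begin
      c * sum (λ x → κ x S * F d (S ∪ ⁅ x ⁆))
        ≡⟨ *-distribˡ-sum c (λ x → κ x S * F d (S ∪ ⁅ x ⁆)) ⟩
      sum (λ x → c * (κ x S * F d (S ∪ ⁅ x ⁆)))
        ≡⟨ sum-cong-≗ (λ x → solve 3 (λ c k f → c :* (k :* f) := k :* (c :* f)) refl c (κ x S) (F d (S ∪ ⁅ x ⁆))) ⟩
      sum (λ x → κ x S * (c * F d (S ∪ ⁅ x ⁆))) ∎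
    A-step d S zero    (suc y) = δ-∂ y (F d) S
    A-step d S (suc x) zero    = δ-∂ x (F d) S
    A-step d S (suc x) (suc y) = trans (cong (κ x S *_) (δ-∂ y (F d) (S ∪ ⁅ x ⁆))) (δ-∂ x (δ y (F d)) S)

    form-step : ∀ d S v → form (A (suc d) S) v v ≡ sum (λ x → κ x S * form (A d (S ∪ ⁅ x ⁆)) v v)
    form-step d S v = begin
      sum (λ i → v i * sum (λ j → A (suc d) S i j * v j))
        ≡⟨ sum-cong-≗ (λ i → cong (v i *_) (begin
             sum (λ j → A (suc d) S i j * v j)
               ≡⟨ sum-cong-≗ (λ j → trans (cong (_* v j) (A-step d S i j)) (trans (ℚ.*-comm _ (v j))
                    (trans (*-distribˡ-sum (v j) (λ x → κ x S * A d (S ∪ ⁅ x ⁆) i j)) (sum-cong-≗ (λ x →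
                      solve 3 (λ v k a → v :* (k :* a) := k :* (a :* v)) refl (v j) (κ x S) (A d (S ∪ ⁅ x ⁆) i j)))))) ⟩
             sum (λ j → sum (λ x → κ x S * (A d (S ∪ ⁅ x ⁆) i j * v j)))
               ≡⟨ ∑-comm (λ j x → κ x S * (A d (S ∪ ⁅ x ⁆) i j * v j)) ⟩
             sum (λ x → sum (λ j → κ x S * (A d (S ∪ ⁅ x ⁆) i j * v j)))
               ≡⟨ sum-cong-≗ (λ x → sym (*-distribˡ-sum (κ x S) (λ j → A d (S ∪ ⁅ x ⁆) i j * v j))) ⟩
             sum (λ x → κ x S * (A d (S ∪ ⁅ x ⁆) · v) i) ∎)) ⟩
      dot v (λ i → sum (λ x → κ x S * (A d (S ∪ ⁅ x ⁆) · v) i))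
        ≡⟨ dot-sumʳ v (λ x i → κ x S * (A d (S ∪ ⁅ x ⁆) · v) i) ⟩
      sum (λ x → dot v (λ i → κ x S * (A d (S ∪ ⁅ x ⁆) · v) i))
        ≡⟨ sum-cong-≗ (λ x → trans
             (sum-cong-≗ (λ i → solve 3 (λ v k a → v :* (k :* a) := k :* (v :* a)) refl (v i) (κ x S)
                   ((A d (S ∪ ⁅ x ⁆) · v) i)))
             (sym (*-distribˡ-sum (κ x S) (λ i → v i * (A d (S ∪ ⁅ x ⁆) · v) i)))) ⟩
      sum (λ x → κ x S * form (A d (S ∪ ⁅ x ⁆)) v v) ∎

    -- A nonzero entry would yield a basis above `S`, which completion to size |S| + d + 2 turns
    -- into positivity of A(1,1). This covers the case in which reverse Cauchy-Schwarz against
    -- `ones` says nothing about A(v,v).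
    A-vanish : ∀ d S → form (A d S) ones ones ≡ 0ℚ → ∣ S ∣ ℕ.+ suc (suc d) ≤ ∣ T₊ ∣ → ∀ i j → A d S i j ≡ 0ℚ
    A-vanish d S 11≡0 le = vanish
      where
      F≡0 : F (suc (suc d)) S ≡ 0ℚ
      F≡0 = trans (sym (form-ones d S)) 11≡0

      1+ : ∀ {a b} → a ≤ b → a ≤ suc b
      1+ = ℕ.m≤n⇒m≤1+n

      ∣insert∣-+ : ∀ {S : Subset n} {x} → x ∉ S → ∀ d → ∣ S ∪ ⁅ x ⁆ ∣ ℕ.+ d ≡ ∣ S ∣ ℕ.+ suc d
      ∣insert∣-+ {S} x∉S d = trans (cong (ℕ._+ d) (∣insert∣ x∉S)) (sym (ℕ.+-suc ∣ S ∣ d))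

      κ*≡0 : ∀ {x S q} → (x ∉ S → q ≡ 0ℚ) → κ x S * q ≡ 0ℚ
      κ*≡0 {x} {S} {q} q≡0 with x ∈? S
      ... | yes x∈S = trans (cong (_* q) (ℚ.*-zeroˡ (ω x))) (ℚ.*-zeroˡ q)
      ... | no  x∉S = trans (cong (1ℚ * ω x *_) (q≡0 x∉S)) (ℚ.*-zeroʳ (1ℚ * ω x))

      vanish₀ : F d S ≡ 0ℚ
      vanish₀ = F-zero-mono (suc (suc d)) d ⊆-refl F≡0 (ℕ.+-monoʳ-≤ ∣ S ∣ (1+ (1+ ℕ.≤-refl))) le

      vanish₁ : ∀ x → δ x (F d) S ≡ 0ℚ
      vanish₁ x = κ*≡0 {x} {S} (λ x∉S → F-zero-mono (suc (suc d)) d (⊆-insert S x) F≡0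
        (ℕ.≤-trans (ℕ.≤-reflexive (∣insert∣-+ x∉S d)) (ℕ.+-monoʳ-≤ ∣ S ∣ (1+ ℕ.≤-refl))) le)

      vanish : ∀ i j → A d S i j ≡ 0ℚ
      vanish zero    zero    = trans (cong (c *_) vanish₀) (ℚ.*-zeroʳ c)
      vanish zero    (suc y) = vanish₁ y
      vanish (suc x) zero    = vanish₁ x
      vanish (suc x) (suc y) = κ*≡0 {x} {S} (λ x∉S → κ*≡0 {y} {S ∪ ⁅ x ⁆} (λ y∉Sx →
        F-zero-mono (suc (suc d)) d (⊆-trans (⊆-insert S x) (⊆-insert (S ∪ ⁅ x ⁆) y)) F≡0
          (ℕ.≤-reflexive (trans (∣insert∣-+ y∉Sx d) (∣insert∣-+ x∉S (suc d)))) le))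

    -- The bound holds for each x separately. Reverse Cauchy-Schwarz for the matrix at S + x against
    -- `ones`, multiplied by κ², reads D κA'(v,v) ≤ (D T)², because κA'(1,1) = D and κA'(v,1) = D T;
    -- then D is cancelled.
    A-local : ∀ d S → ∣ S ∣ ℕ.+ suc (suc (suc d)) ≤ ∣ T₊ ∣ →
      (∀ {x} → x ∉ S → NegativeOnHyperplane (A d (S ∪ ⁅ x ⁆))) →
      ∀ (v : Vector (suc n)) (T : Vector n) → (∀ x → degree (block (A (suc d) S)) x * T x ≡ (A (suc d) S · v) (suc x)) →
      form (A (suc d) S) v v ℚ.≤ sum (λ x → degree (block (A (suc d) S)) x * (T x * T x))
    A-local d S le negative v T DT≡ = subst (ℚ._≤ sum (λ x → degree (block (A (suc d) S)) x * (T x * T x)))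
        (sym (form-step d S v)) (sum-mono termwise)
      where
      D : Vector n
      D = degree (block (A (suc d) S))

      A′ : Fin n → Matrix (suc n)
      A′ x = A d (S ∪ ⁅ x ⁆)

      D≡ : ∀ x → D x ≡ κ x S * form (A′ x) ones ones
      D≡ x = trans (degree≡ (suc d) S x) (cong (κ x S *_) (sym (form-ones d (S ∪ ⁅ x ⁆))))

      DT≡κ : ∀ x → D x * T x ≡ κ x S * form (A′ x) v ones
      DT≡κ x = trans (DT≡ x) (begin
        sum (λ i → A (suc d) S (suc x) i * v i)
          ≡⟨ sum-cong-≗ (λ i → trans (cong (_* v i) (sym (A·ones d S x i)))
               (solve 3 (λ k a v → k :* a :* v := k :* (v :* a)) refl (κ x S) ((A′ x · ones) i) (v i))) ⟩
        sum (λ i → κ x S * (v i * (A′ x · ones) i))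
          ≡⟨ *-distribˡ-sum (κ x S) (λ i → v i * (A′ x · ones) i) ⟨
        κ x S * form (A′ x) v ones ∎)

      0≤κ²q²≡ : ∀ κ p q r → κ * κ * (q * q - p * r) ≡ (κ * q) * (κ * q) - (κ * r) * (κ * p)
      0≤κ²q²≡ = solve 4 (λ k p q r → k :* k :* (q :* q :- p :* r) := (k :* q) :* (k :* q) :- (k :* r) :* (k :* p)) refl

      0≤D : ∀ x → 0ℚ ℚ.≤ D x
      0≤D x = sum-nonneg (block-nonneg (suc d) S x)

      inside-case : ∀ x → x ∉ S → κ x S * form (A′ x) v v ℚ.≤ D x * (T x * T x)
      inside-case x x∉S with ≤0∨0< (D x)
      ... | inj₂ 0<D = *-cancelˡ-≤ 0<D (0≤-⇒≤ (subst (0ℚ ℚ.≤_) (begin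
              κ x S * κ x S * (form (A′ x) v ones * form (A′ x) v ones - form (A′ x) v v * form (A′ x) ones ones)
                ≡⟨ 0≤κ²q²≡ (κ x S) (form (A′ x) v v) (form (A′ x) v ones) (form (A′ x) ones ones) ⟩
              (κ x S * form (A′ x) v ones) * (κ x S * form (A′ x) v ones) - (κ x S * form (A′ x) ones ones) *
                    (κ x S * form (A′ x) v v)
                ≡⟨ cong₂ (λ a b → a * a - b * (κ x S * form (A′ x) v v)) (DT≡κ x) (D≡ x) ⟨
              (D x * T x) * (D x * T x) - D x * (κ x S * form (A′ x) v v)
                ≡⟨ solve 3 (λ D T q → (D :* T) :* (D :* T) :- D :* q := D :* (D :* (T :* T)) :- D :* q)
                     refl (D x) (T x) (κ x S * form (A′ x) v v) ⟩
              D x * (D x * (T x * T x)) - D x * (κ x S * form (A′ x) v v) ∎)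
              (*-nonneg (square-nonneg (κ x S)) (≤⇒0≤- (reverse-Cauchy-Schwarz (A-sym d (S ∪ ⁅ x ⁆)) (negative x∉S) ones
                (subst (0ℚ ℚ.≤_) (sym (form-ones d (S ∪ ⁅ x ⁆))) (F-nonneg (suc (suc d)) (S ∪ ⁅ x ⁆))) v)))))
      -- Here D = 0 cannot be cancelled, but then the whole local matrix is zero.
      ... | inj₁ D≤0 = subst (ℚ._≤ D x * (T x * T x))
              (sym (trans (cong (κ x S *_) vv≡0) (ℚ.*-zeroʳ (κ x S)))) (*-nonneg (0≤D x) (square-nonneg (T x)))
        where
        D≡0 : D x ≡ 0ℚ
        D≡0 = ℚ.≤-antisym D≤0 (0≤D x)
        11≡0 : form (A′ x) ones ones ≡ 0ℚ
        11≡0 = *-cancelˡ-≡0 (subst (0ℚ ℚ.<_) (sym (κ-∉ x∉S)) (ω>0 x)) (trans (sym (D≡ x)) D≡0)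
        vv≡0 : form (A′ x) v v ≡ 0ℚ
        vv≡0 = sum-zero (λ i → trans (cong (v i *_) (sum-zero (λ j → trans (cong (_* v j)
          (A-vanish d (S ∪ ⁅ x ⁆) 11≡0 (subst (_≤ ∣ T₊ ∣)
                (trans (ℕ.+-suc ∣ S ∣ (suc (suc d))) (cong (ℕ._+ suc (suc d)) (sym (∣insert∣ x∉S)))) le) i j))
          (ℚ.*-zeroˡ (v j))))) (ℚ.*-zeroʳ (v i)))

      termwise : ∀ x → κ x S * form (A′ x) v v ℚ.≤ D x * (T x * T x)
      termwise x = by-cases (x ∈? S)
        where
        by-cases : Dec (x ∈ S) → κ x S * form (A′ x) v v ℚ.≤ D x * (T x * T x)
        by-cases (no x∉S) = inside-case x x∉S
        by-cases (yes x∈S) = subst (ℚ._≤ D x * (T x * T x))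
          (sym (trans (cong (_* form (A′ x) v v) (κ-∈ x∈S)) (ℚ.*-zeroˡ (form (A′ x) v v))))
          (*-nonneg (0≤D x) (square-nonneg (T x)))

    -- A basis with `d` elements beyond S + x leaves room below |T₊|, so S + x also has a completion
    -- with d + 1 elements, and the degree of x would be positive.
    A-support : ∀ d S → ∣ S ∣ ℕ.+ suc (suc d) ≤ ∣ T₊ ∣ → ∀ x → degree (block (A d S)) x ≡ 0ℚ → δ x (F d) S ≡ 0ℚ
    A-support d S le x D≡0 = by-cases (x ∈? S)
      where
      by-cases : Dec (x ∈ S) → δ x (F d) S ≡ 0ℚ
      by-cases (yes x∈S) = trans (cong (_* F d (S ∪ ⁅ x ⁆)) (κ-∈ x∈S)) (ℚ.*-zeroˡ (F d (S ∪ ⁅ x ⁆)))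
      by-cases (no x∉S) = trans (cong (κ x S *_) (F-zero-mono (suc d) d ⊆-refl
          (*-cancelˡ-≡0 (subst (0ℚ ℚ.<_) (sym (κ-∉ x∉S)) (ω>0 x)) (trans (sym (degree≡ d S x)) D≡0))
          (ℕ.+-monoʳ-≤ ∣ S ∪ ⁅ x ⁆ ∣ (ℕ.n≤1+n d))
          (subst (_≤ ∣ T₊ ∣) (trans (ℕ.+-suc ∣ S ∣ (suc d)) (cong (ℕ._+ suc d) (sym (∣insert∣ x∉S)))) le)))
        (ℚ.*-zeroʳ (κ x S))

    -- Any two non-isolated x and y are within distance two: take a basis T above S + x and exchange
    -- S + y against it. The element t obtained is adjacent to y, and it equals x or is adjacent to
    -- x because both lie in T.
    A-connected : ∀ d S → ∣ S ∣ ℕ.+ suc (suc (suc d)) ≤ ∣ T₊ ∣ → Connected (block (A (suc d) S))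
    A-connected d S le r r-edge x y Dx≢0 Dy≢0 =
      let x∉S , 0<Fx = positive-degree x Dx≢0
          y∉S , 0<Fy = positive-degree y Dy≢0
          T , T-basis , Sx⊆T , ∣T∣≡ = F-pos⇒basis (suc (suc d)) 0<Fx
          T′ , T′-basis , Sy⊆T′ , ∣T′∣≡ = F-pos⇒basis (suc (suc d)) 0<Fy
          ∣Sy∣<∣T∣ = subst₂ _<_ (trans (∣insert∣ x∉S) (sym (∣insert∣ y∉S))) (sym ∣T∣≡) (ℕ.m<m+n ∣ S ∪ ⁅ x ⁆ ∣ ℕ.z<s)
          t , t∈T , t∉Sy , ext = extendable-exchange (subset-extendable T′-basis Sy⊆T′ ∣T′∣≡) T-basis (inj₂ ∣Sy∣<∣T∣)
          ry≡rt = edge y∉S t∉Sy ext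
          t∉S = λ t∈S → t∉Sy (⊆-insert S y t∈S)
      in  trans (rx≡rt x∉S T-basis Sx⊆T ∣T∣≡ t∈T t∉S (t Fin.≟ x)) (sym ry≡rt)
      where
      positive-degree : ∀ x → degree (block (A (suc d) S)) x ≢ 0ℚ → x ∉ S × 0ℚ ℚ.< F (suc (suc d)) (S ∪ ⁅ x ⁆)
      positive-degree x D≢0 = δ-pos⁻ ω>0 {F (suc (suc d))} (subst (0ℚ ℚ.<_) (degree≡ (suc d) S x)
        (≢0⇒0< (sum-nonneg (block-nonneg (suc d) S x)) D≢0))

      edge : ∀ {x t} → x ∉ S → t ∉ S ∪ ⁅ x ⁆ → Extendable (suc d) ((S ∪ ⁅ x ⁆) ∪ ⁅ t ⁆) → r x ≡ r t
      edge {x} {t} x∉S t∉Sx ext = r-edge x t (δ-pos⁺ ω>0 {δ t (F (suc d))} x∉S (δ-pos⁺ ω>0 {F (suc d)} t∉Sx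
        (extendable⇒F-pos (suc d) ext (subst (_≤ ∣ T₊ ∣) (sym (trans
          (cong (ℕ._+ suc d) (trans (∣insert∣ t∉Sx) (cong suc (∣insert∣ x∉S))))
          (trans (cong suc (sym (ℕ.+-suc ∣ S ∣ (suc d)))) (sym (ℕ.+-suc ∣ S ∣ (suc (suc d))))))) le))))

      rx≡rt : ∀ {x t T} → x ∉ S → IsBasis Φ T → S ∪ ⁅ x ⁆ ⊆ T → ∣ T ∣ ≡ ∣ S ∪ ⁅ x ⁆ ∣ ℕ.+ suc (suc d) →
        t ∈ T → t ∉ S → Dec (t ≡ x) → r x ≡ r t
      rx≡rt x∉S T-basis Sx⊆T ∣T∣≡ t∈T t∉S (yes refl) = refl
      rx≡rt {x} {t} x∉S T-basis Sx⊆T ∣T∣≡ t∈T t∉S (no t≢x) = edge x∉S (∉-insert t∉S t≢x)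
        (subset-extendable T-basis (insert-⊆ Sx⊆T t∈T) (trans ∣T∣≡
          (trans (ℕ.+-suc ∣ S ∪ ⁅ x ⁆ ∣ (suc d)) (cong (ℕ._+ suc d) (sym (∣insert∣ (∉-insert t∉S t≢x)))))))

    -- The vertices of the graph are X together with zero, which is adjacent to the
    -- elements that complete S to a basis.
    module NonBasis (S : Subset n) (S-nonbasis : ¬ IsBasis Φ S) where

      Adj : Fin (suc n) → Fin (suc n) → Set
      Adj zero    zero    = Empty
      Adj zero    (suc y) = y ∉ S × IsBasis Φ (S ∪ ⁅ y ⁆)
      Adj (suc x) zero    = x ∉ S × IsBasis Φ (S ∪ ⁅ x ⁆)
      Adj (suc x) (suc y) = x ∉ S × y ∉ S ∪ ⁅ x ⁆ × IsBasis Φ ((S ∪ ⁅ x ⁆) ∪ ⁅ y ⁆)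

      adj? : Decidable₂ Adj
      adj? zero    zero    = no id
      adj? zero    (suc y) = ¬? (y ∈? S) ×-dec isBasis? Φ (S ∪ ⁅ y ⁆)
      adj? (suc x) zero    = ¬? (x ∈? S) ×-dec isBasis? Φ (S ∪ ⁅ x ⁆)
      adj? (suc x) (suc y) = ¬? (x ∈? S) ×-dec (¬? (y ∈? S ∪ ⁅ x ⁆) ×-dec isBasis? Φ ((S ∪ ⁅ x ⁆) ∪ ⁅ y ⁆))

      adj-irrefl : ∀ {i} → ¬ Adj i i
      adj-irrefl {suc x} (_ , x∉Sx , _) = x∉Sx (∈-insert S x)

      adj-sym : ∀ {i j} → Adj i j → Adj j i
      adj-sym {zero}  {suc y} a = a
      adj-sym {suc x} {zero}  a = a
      adj-sym {suc x} {suc y} (x∉S , y∉Sx , b) =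
        (λ y∈S → y∉Sx (⊆-insert S x y∈S)) ,
        ∉-insert x∉S (λ x≡y → y∉Sx (subst (_∈ S ∪ ⁅ x ⁆) x≡y (∈-insert S x))) ,
        subst (IsBasis Φ) (insert-comm S x y) b

      two-elements : ∀ {x z t} {U : Subset n} → S ⊆ U → t ∈ (S ∪ ⁅ x ⁆) ∪ ⁅ z ⁆ → t ∉ U → t ≡ x ⊎ t ≡ z
      two-elements {x} S⊆U t∈ t∉U = [ (λ t∈Sx → [ (λ t∈S → contradiction (S⊆U t∈S) t∉U) , inj₁ ]′ (∈-insert⁻ S t∈Sx)) , inj₂ ]′
        (∈-insert⁻ (S ∪ ⁅ x ⁆) t∈)

      insert-extendable : ∀ {y j} → Adj (suc y) j → y ∉ S × Extendable 1 (S ∪ ⁅ y ⁆)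
      insert-extendable {j = zero}  (y∉S , b) = y∉S , extendable-≤ ℕ.z≤n (basis⇒extendable b)
      insert-extendable {y} {suc w} (y∉S , w∉Sy , b) =
        y∉S , subset-extendable b (⊆-insert (S ∪ ⁅ y ⁆) w) (trans (∣insert∣ w∉Sy) (ℕ.+-comm 1 ∣ S ∪ ⁅ y ⁆ ∣))

      S-deficient : ∀ {y} → IsBasis Φ (S ∪ ⁅ y ⁆) → g S < rk N
      S-deficient {y} (iSy , _) = ℕ.≤∧≢⇒< (g≤rk S) (λ gS≡r → S-nonbasis (hereditary M (⊆-insert S y) iSy , gS≡r))

      -- As S + w is a basis and S is not, the deficit of S is exactly one. The element of S + x + z
      -- that removes it is x or z.
      exchange-zero : ∀ {w x z} → Adj zero (suc w) → Adj (suc x) (suc z) → Adj zero (suc x) ⊎ Adj zero (suc z)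
      exchange-zero {w} (w∉S , bw) (x∉S , z∉Sx , b) =
        let ext = subset-extendable bw (⊆-insert S w) (trans (∣insert∣ w∉S) (ℕ.+-comm 1 ∣ S ∣))
            t , t∈ , t∉S , ext′ = extendable-exchange ext b (inj₁ (S-deficient bw))
            b′ = extendable⇒basis ext′
        in  [ (λ t≡x → inj₁ (subst (Adj zero ∘ suc) t≡x (t∉S , b′))) ,
              (λ t≡z → inj₂ (subst (Adj zero ∘ suc) t≡z (t∉S , b′))) ]′ (two-elements id t∈ t∉S)

      exchange-suc : ∀ {y j x z} → Adj (suc y) j → Adj (suc x) (suc z) → Adj (suc y) (suc x) ⊎ Adj (suc y) (suc z)
      exchange-suc {y} a (x∉S , z∉Sx , b) =
        let y∉S , ext = insert-extendable a
            t , t∈ , t∉Sy , ext′ = extendable-exchange ext b (inj₂ (ℕ.≤-reflexive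
              (trans (cong suc (∣insert∣ y∉S)) (sym (trans (∣insert∣ z∉Sx) (cong suc (∣insert∣ x∉S)))))))
            b′ = extendable⇒basis ext′
        in  [ (λ t≡x → inj₁ (subst (Adj (suc y) ∘ suc) t≡x (y∉S , t∉Sy , b′))) ,
              (λ t≡z → inj₂ (subst (Adj (suc y) ∘ suc) t≡z (y∉S , t∉Sy , b′))) ]′
              (two-elements (⊆-insert S y) t∈ t∉Sy)

      -- S + y and S + z have the same size, so exchange between them is driven by a deficit of S +
      -- y. If there is none, S + y is a basis and y is adjacent to `zero`.
      exchange-mixed : ∀ {y j z} → Adj (suc y) j → Adj zero (suc z) → Adj (suc y) zero ⊎ Adj (suc y) (suc z)
      exchange-mixed {y} {j} {z} a (z∉S , b) = by-cases (isBasis? Φ (S ∪ ⁅ y ⁆))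
        where
        y∉S = proj₁ (insert-extendable a)
        ext = proj₂ (insert-extendable a)
        by-cases : Dec (IsBasis Φ (S ∪ ⁅ y ⁆)) → Adj (suc y) zero ⊎ Adj (suc y) (suc z)
        by-cases (yes b-y) = inj₁ (y∉S , b-y)
        by-cases (no ¬b-y) =
          let t , t∈ , t∉Sy , ext′ = extendable-exchange ext b
                (inj₁ (ℕ.≤∧≢⇒< (g≤rk (S ∪ ⁅ y ⁆)) (λ g≡r → ¬b-y (proj₁ ext , g≡r))))
          in  [ (λ t∈S → contradiction (⊆-insert S y t∈S) t∉Sy)
              , (λ t≡z → inj₂ (subst (Adj (suc y) ∘ suc) t≡z (y∉S , t∉Sy , extendable⇒basis ext′))) ]′ (∈-insert⁻ S t∈)

      adj-exchange : ∀ {x y z w} → Adj x z → Adj y w → Adj y x ⊎ Adj y z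
      adj-exchange {zero}  {zero}  {suc z} {suc w} xz yw = inj₂ xz
      adj-exchange {suc x} {zero}  {zero}  {suc w} xz yw = inj₁ xz
      adj-exchange {suc x} {zero}  {suc z} {suc w} xz yw = exchange-zero yw xz
      adj-exchange {zero}  {suc y} {suc z} {w}     xz yw = exchange-mixed {j = w} yw xz
      adj-exchange {suc x} {suc y} {zero}  {w}     xz yw =
        [ inj₂ , inj₁ ]′ (exchange-mixed {j = w} yw xz)
      adj-exchange {suc x} {suc y} {suc z} {w}     xz yw = exchange-suc {j = w} yw xz

      weights : Vector (suc n)
      weights zero    = 1ℚ
      weights (suc x) = ω x

      f≡𝟙 : ∀ T → f T ≡ 𝟙 (isBasis? Φ T)
      f≡𝟙 T = by-cases (isBasis? Φ T)
        where
        by-cases : Dec (IsBasis Φ T) → f T ≡ 𝟙 (isBasis? Φ T)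
        by-cases (yes b) = trans (f-basis b) (sym (𝟙-yes (isBasis? Φ T) b))
        by-cases (no ¬b) = trans (f-nonbasis ¬b) (sym (𝟙-no (isBasis? Φ T) ¬b))

      δ≡ : ∀ x → δ x f S ≡ 𝟙 (adj? zero (suc x)) * ω x
      δ≡ x = begin
        𝟙 (¬? (x ∈? S)) * ω x * f (S ∪ ⁅ x ⁆)
          ≡⟨ cong (𝟙 (¬? (x ∈? S)) * ω x *_) (f≡𝟙 (S ∪ ⁅ x ⁆)) ⟩
        𝟙 (¬? (x ∈? S)) * ω x * 𝟙 (isBasis? Φ (S ∪ ⁅ x ⁆))
          ≡⟨ solve 3 (λ i o b → i :* o :* b := (i :* b) :* o) refl (𝟙 (¬? (x ∈? S))) (ω x) (𝟙 (isBasis? Φ (S ∪ ⁅ x ⁆))) ⟩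
        (𝟙 (¬? (x ∈? S)) * 𝟙 (isBasis? Φ (S ∪ ⁅ x ⁆))) * ω x
          ≡⟨ cong (_* ω x) (𝟙-× (¬? (x ∈? S)) (isBasis? Φ (S ∪ ⁅ x ⁆))) ⟨
        𝟙 (adj? zero (suc x)) * ω x ∎

      δδ≡ : ∀ x y → δ x (δ y f) S ≡ 𝟙 (adj? (suc x) (suc y)) * (ω x * ω y)
      δδ≡ x y = begin
        𝟙 (¬? (x ∈? S)) * ω x * (𝟙 (¬? (y ∈? S ∪ ⁅ x ⁆)) * ω y * f Sxy)
          ≡⟨ cong (λ e → 𝟙 (¬? (x ∈? S)) * ω x * (𝟙 (¬? (y ∈? S ∪ ⁅ x ⁆)) * ω y * e)) (f≡𝟙 Sxy) ⟩
        𝟙 (¬? (x ∈? S)) * ω x * (𝟙 (¬? (y ∈? S ∪ ⁅ x ⁆)) * ω y * 𝟙 (isBasis? Φ Sxy))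
          ≡⟨ solve 5 (λ i o j p b → i :* o :* (j :* p :* b) := (i :* (j :* b)) :* (o :* p)) refl
               (𝟙 (¬? (x ∈? S))) (ω x) (𝟙 (¬? (y ∈? S ∪ ⁅ x ⁆))) (ω y) (𝟙 (isBasis? Φ Sxy)) ⟩
        (𝟙 (¬? (x ∈? S)) * (𝟙 (¬? (y ∈? S ∪ ⁅ x ⁆)) * 𝟙 (isBasis? Φ Sxy))) * (ω x * ω y)
          ≡⟨ cong (_* (ω x * ω y)) (trans (𝟙-× (¬? (x ∈? S)) (¬? (y ∈? S ∪ ⁅ x ⁆) ×-dec isBasis? Φ Sxy))
               (cong (𝟙 (¬? (x ∈? S)) *_) (𝟙-× (¬? (y ∈? S ∪ ⁅ x ⁆)) (isBasis? Φ Sxy)))) ⟨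
        𝟙 (adj? (suc x) (suc y)) * (ω x * ω y) ∎
        where Sxy = (S ∪ ⁅ x ⁆) ∪ ⁅ y ⁆

      A≡ : ∀ i j → A 0 S i j ≡ 𝟙 (adj? i j) * (weights i * weights j)
      -- The corner vanishes whatever `c` is, because `S` is not a basis: the vertex `zero` carries
      -- no loop.
      A≡ zero    zero    = trans (cong (c *_) (f-nonbasis S-nonbasis)) (trans (ℚ.*-zeroʳ c) (sym (ℚ.*-zeroˡ (1ℚ * 1ℚ))))
      A≡ zero    (suc y) = trans (δ≡ y) (cong (𝟙 (adj? zero (suc y)) *_) (sym (ℚ.*-identityˡ (ω y))))
      A≡ (suc x) zero    = trans (δ≡ x) (cong (𝟙 (adj? (suc x) zero) *_) (sym (ℚ.*-identityʳ (ω x))))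
      A≡ (suc x) (suc y) = δδ≡ x y

      negative : NegativeOnHyperplane (A 0 S)
      negative =
        let l , neg = multipartite-negative adj? (λ {i} → adj-irrefl {i}) (λ {i} {j} → adj-sym {i} {j})
                        (λ {x} {y} {z} {w} → adj-exchange {x} {y} {z} {w}) weights
        in  l , λ v l·v≡0 → subst (ℚ._≤ 0ℚ) (sym (form-cong {u = v} {v = v} A≡ (λ _ → refl) (λ _ → refl))) (neg v l·v≡0)

    module BasisCase (S : Subset n) (S-basis : IsBasis Φ S) (1≤c : 1ℚ ℚ.≤ c)
      (c-bound : (c - 1ℚ) * natℚ (length (Par M S)) ℚ.≤ c) where

      E? = cont? M S
      R? = parallel? M S

      -- Independent supersets of a basis of Φ are bases, so above `S` only the matroid `M` is seen:
      -- the block joins non-parallel elements of `Cont M S`, and `zero` is joined to all of them.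
      f≡𝟙indep : ∀ {T} → S ⊆ T → f T ≡ 𝟙 (indep? M T)
      f≡𝟙indep {T} S⊆T = by-cases (indep? M T)
        where
        by-cases : Dec (Indep M T) → f T ≡ 𝟙 (indep? M T)
        by-cases (yes i) = trans (f-basis (superset-basis S-basis S⊆T i)) (sym (𝟙-yes (indep? M T) i))
        by-cases (no ¬i) = trans (f-nonbasis (¬i ∘ proj₁)) (sym (𝟙-no (indep? M T) ¬i))

      δ≡ : ∀ x → δ x f S ≡ 𝟙 (E? x) * ω x
      δ≡ x = begin
        𝟙 (¬? (x ∈? S)) * ω x * f (S ∪ ⁅ x ⁆)
          ≡⟨ cong (𝟙 (¬? (x ∈? S)) * ω x *_) (f≡𝟙indep (⊆-insert S x)) ⟩
        𝟙 (¬? (x ∈? S)) * ω x * 𝟙 (indep? M (S ∪ ⁅ x ⁆))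
          ≡⟨ solve 3 (λ i o b → i :* o :* b := (i :* b) :* o) refl (𝟙 (¬? (x ∈? S))) (ω x) (𝟙 (indep? M (S ∪ ⁅ x ⁆))) ⟩
        (𝟙 (¬? (x ∈? S)) * 𝟙 (indep? M (S ∪ ⁅ x ⁆))) * ω x
          ≡⟨ cong (_* ω x) (𝟙-× (¬? (x ∈? S)) (indep? M (S ∪ ⁅ x ⁆))) ⟨
        𝟙 (E? x) * ω x ∎

      δδ≡ : ∀ x y → δ x (δ y f) S ≡ 𝟙 (E? x ×-dec (E? y ×-dec ¬? (R? x y))) * (ω x * ω y)
      δδ≡ x y = begin
        𝟙 (¬? (x ∈? S)) * ω x * (𝟙 (¬? (y ∈? S ∪ ⁅ x ⁆)) * ω y * f Sxy)
          ≡⟨ cong (λ e → 𝟙 (¬? (x ∈? S)) * ω x * (𝟙 (¬? (y ∈? S ∪ ⁅ x ⁆)) * ω y * e))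
                (f≡𝟙indep (⊆-trans (⊆-insert S x) (⊆-insert (S ∪ ⁅ x ⁆) y))) ⟩
        𝟙 (¬? (x ∈? S)) * ω x * (𝟙 (¬? (y ∈? S ∪ ⁅ x ⁆)) * ω y * 𝟙 (indep? M Sxy))
          ≡⟨ solve 5 (λ i o j p b → i :* o :* (j :* p :* b) := (i :* (j :* b)) :* (o :* p)) refl
               (𝟙 (¬? (x ∈? S))) (ω x) (𝟙 (¬? (y ∈? S ∪ ⁅ x ⁆))) (ω y) (𝟙 (indep? M Sxy)) ⟩
        (𝟙 (¬? (x ∈? S)) * (𝟙 (¬? (y ∈? S ∪ ⁅ x ⁆)) * 𝟙 (indep? M Sxy))) * (ω x * ω y)
          ≡⟨ cong (_* (ω x * ω y)) (trans (𝟙-× (¬? (x ∈? S)) (¬? (y ∈? S ∪ ⁅ x ⁆) ×-dec indep? M Sxy))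
               (cong (𝟙 (¬? (x ∈? S)) *_) (𝟙-× (¬? (y ∈? S ∪ ⁅ x ⁆)) (indep? M Sxy)))) ⟨
        𝟙 (¬? (x ∈? S) ×-dec (¬? (y ∈? S ∪ ⁅ x ⁆) ×-dec indep? M Sxy)) * (ω x * ω y)
          ≡⟨ cong (_* (ω x * ω y)) (𝟙-cong (¬? (x ∈? S) ×-dec (¬? (y ∈? S ∪ ⁅ x ⁆) ×-dec indep? M Sxy))
               (E? x ×-dec (E? y ×-dec ¬? (R? x y))) to from) ⟩
        𝟙 (E? x ×-dec (E? y ×-dec ¬? (R? x y))) * (ω x * ω y) ∎
        where
        Sxy = (S ∪ ⁅ x ⁆) ∪ ⁅ y ⁆
        to : x ∉ S × y ∉ S ∪ ⁅ x ⁆ × Indep M Sxy → Cont M S x × Cont M S y × ¬ Parallel M S x y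
        to (x∉S , y∉Sx , i) =
          (x∉S , hereditary M (⊆-insert (S ∪ ⁅ x ⁆) y) i) ,
          (y∉Sx ∘ ⊆-insert S x , hereditary M (⊆-insert (S ∪ ⁅ y ⁆) x) (subst (Indep M) (insert-comm S x y) i)) ,
          [ (λ x≡y → y∉Sx (subst (_∈ S ∪ ⁅ x ⁆) x≡y (∈-insert S x))) ,
                (λ dep → dep (subst (Indep M) (∪-assoc S ⁅ x ⁆ ⁅ y ⁆) i)) ]′
        from : Cont M S x × Cont M S y × ¬ Parallel M S x y → x ∉ S × y ∉ S ∪ ⁅ x ⁆ × Indep M Sxy
        from ((x∉S , _) , (y∉S , _) , ¬par) =
          x∉S , ∉-insert y∉S (λ y≡x → ¬par (inj₁ (sym y≡x))) ,
          decidable-stable (indep? M Sxy) (λ dep → ¬par (inj₂ (dep ∘ subst (Indep M) (sym (∪-assoc S ⁅ x ⁆ ⁅ y ⁆)))))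

      negative : NegativeOnHyperplane (A 0 S)
      negative = cone-negative E? R? (λ _ → inj₁ refl) (parallel-sym M S) (parallel-trans M S)
        c 1≤c c-bound ω (A 0 S) (trans (cong (c *_) (f-basis S-basis)) (ℚ.*-identityʳ c)) δ≡ δ≡ δδ≡

    module _ (1≤c : 1ℚ ℚ.≤ c) (K : ℕ) (K+2≤ : K ℕ.+ 2 ≤ ∣ T₊ ∣)
      (c-bound : ∀ {S} → IsBasis Φ S → ∣ S ∣ ≡ K → (c - 1ℚ) * natℚ (length (Par M S)) ℚ.≤ c) where

      A-negative : ∀ d S → ∣ S ∣ ℕ.+ d ≡ K → NegativeOnHyperplane (A d S)
      A-negative zero S ∣S∣≡ = by-cases (isBasis? Φ S)
        where
        by-cases : Dec (IsBasis Φ S) → NegativeOnHyperplane (A 0 S)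
        by-cases (no ¬b) = NonBasis.negative S ¬b
        by-cases (yes b) = BasisCase.negative S b 1≤c (c-bound b (trans (sym (ℕ.+-identityʳ ∣ S ∣)) ∣S∣≡))
      A-negative (suc d) S ∣S∣≡ = local-to-global (A (suc d) S) (A-sym (suc d) S) (block-nonneg (suc d) S)
          (A-support (suc d) S le) (A-connected d S le)
          (A-local d S le (λ {x} x∉S → A-negative d (S ∪ ⁅ x ⁆)
            (trans (cong (ℕ._+ d) (∣insert∣ x∉S)) (trans (sym (ℕ.+-suc ∣ S ∣ d)) ∣S∣≡))))
        where
        le : ∣ S ∣ ℕ.+ suc (suc (suc d)) ≤ ∣ T₊ ∣
        le = subst (_≤ ∣ T₊ ∣) (trans (cong (ℕ._+ 2) (sym ∣S∣≡))
          (trans (ℕ.+-assoc ∣ S ∣ (suc d) 2) (cong (λ e → ∣ S ∣ ℕ.+ suc e) (ℕ.+-comm d 2)))) K+2≤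

-- Sums over the subsets of a given size

-- `weight` for rational weights, by recursion on the characteristic vector, so that insertion of an
-- element can be treated by induction.
monomial : ∀ {n} → Vector n → Subset n → ℚ
monomial ω Vec.[]      = 1ℚ
monomial ω (s Vec.∷ S) = (if s then ω zero else 1ℚ) * monomial (ω ∘ suc) S

monomial-⊥ : ∀ {n} (ω : Vector n) → monomial ω ⊥ ≡ 1ℚ
monomial-⊥ {zero}  ω = refl
monomial-⊥ {suc n} ω = trans (ℚ.*-identityˡ _) (monomial-⊥ (ω ∘ suc))

monomial-insert : ∀ {n} (ω : Vector n) {S x} → x ∉ S → monomial ω (S ∪ ⁅ x ⁆) ≡ ω x * monomial ω S
monomial-insert ω {inside Vec.∷ S}  {zero} x∉S = contradiction Vec.here x∉S
monomial-insert ω {outside Vec.∷ S} {zero} x∉S = cong (ω zero *_)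
  (trans (cong (monomial (ω ∘ suc)) (∪-identityʳ S)) (sym (ℚ.*-identityˡ (monomial (ω ∘ suc) S))))
monomial-insert ω {inside Vec.∷ S} {suc x} x∉S = trans
  (cong (ω zero *_) (monomial-insert (ω ∘ suc) (x∉S ∘ Vec.there)))
  (solve 3 (λ a b c → a :* (b :* c) := b :* (a :* c)) refl (ω zero) (ω (suc x)) (monomial (ω ∘ suc) S))
monomial-insert ω {outside Vec.∷ S} {suc x} x∉S = trans
  (cong (1ℚ *_) (monomial-insert (ω ∘ suc) (x∉S ∘ Vec.there)))
  (solve 3 (λ a b c → a :* (b :* c) := b :* (a :* c)) refl 1ℚ (ω (suc x)) (monomial (ω ∘ suc) S))

filter-map-suc : ∀ {n} s (S : Subset n) xs →
  filter (_∈? (s Vec.∷ S)) (map suc xs) ≡ map suc (filter (_∈? S) xs)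
filter-map-suc s S []       = refl
filter-map-suc s S (x ∷ xs) with does (x ∈? S)
... | true  = cong (suc x ∷_) (filter-map-suc s S xs)
... | false = filter-map-suc s S xs

product≡monomial : ∀ {n} (ω : Vector n) S →
  foldr _*_ 1ℚ (map ω (filter (_∈? S) (allFin n))) ≡ monomial ω S
product≡monomial ω Vec.[] = refl
product≡monomial {suc n} ω (s Vec.∷ S) = begin
  foldr _*_ 1ℚ (map ω (filter (_∈? (s Vec.∷ S)) (zero ∷ List.tabulate suc)))
    ≡⟨ cong (λ xs → foldr _*_ 1ℚ (map ω (filter (_∈? (s Vec.∷ S)) (zero ∷ xs)))) (sym (List.map-tabulate id suc)) ⟩
  foldr _*_ 1ℚ (map ω (filter (_∈? (s Vec.∷ S)) (zero ∷ map suc (allFin n))))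
    ≡⟨ first s ⟩
  (if s then ω zero else 1ℚ) * foldr _*_ 1ℚ (map ω (filter (_∈? (s Vec.∷ S)) (map suc (allFin n))))
    ≡⟨ cong (λ xs → (if s then ω zero else 1ℚ) * foldr _*_ 1ℚ (map ω xs)) (filter-map-suc s S (allFin n)) ⟩
  (if s then ω zero else 1ℚ) * foldr _*_ 1ℚ (map ω (map suc (filter (_∈? S) (allFin n))))
    ≡⟨ cong (λ xs → (if s then ω zero else 1ℚ) * foldr _*_ 1ℚ xs) (sym (List.map-∘ (filter (_∈? S) (allFin n)))) ⟩
  (if s then ω zero else 1ℚ) * foldr _*_ 1ℚ (map (ω ∘ suc) (filter (_∈? S) (allFin n)))
    ≡⟨ cong ((if s then ω zero else 1ℚ) *_) (product≡monomial (ω ∘ suc) S) ⟩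
  monomial ω (s Vec.∷ S) ∎
  where
  open ≡-Reasoning
  first : ∀ s → foldr _*_ 1ℚ (map ω (filter (_∈? (s Vec.∷ S)) (zero ∷ map suc (allFin n)))) ≡
    (if s then ω zero else 1ℚ) * foldr _*_ 1ℚ (map ω (filter (_∈? (s Vec.∷ S)) (map suc (allFin n))))
  first true  = refl
  first false = sym (ℚ.*-identityˡ _)

-- Insertion of `x` is a bijection from the subsets avoiding `x` to those containing it.
sumₗ-insert : ∀ {n} (x : Fin n) (H : Subset n → ℚ) →
  sumₗ (λ S → 𝟙 (¬? (x ∈? S)) * H (S ∪ ⁅ x ⁆)) (subsets n) ≡ sumₗ (λ T → 𝟙 (x ∈? T) * H T) (subsets n)
sumₗ-insert {suc n} zero H = begin
  sumₗ (λ S → 𝟙 (¬? (zero ∈? S)) * H (S ∪ ⁅ zero ⁆)) (subsets (suc n))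
    ≡⟨ sumₗ-subsets {n} (λ S → 𝟙 (¬? (zero ∈? S)) * H (S ∪ ⁅ zero ⁆)) ⟩
  sumₗ (λ S → 1ℚ * H (inside Vec.∷ (S ∪ ⊥))) (subsets n) + sumₗ (λ S → 0ℚ * H (inside Vec.∷ (S ∪ ⊥))) (subsets n)
    ≡⟨ ℚ.+-comm (sumₗ (λ S → 1ℚ * H (inside Vec.∷ (S ∪ ⊥))) (subsets n))
          (sumₗ (λ S → 0ℚ * H (inside Vec.∷ (S ∪ ⊥))) (subsets n)) ⟩
  sumₗ (λ S → 0ℚ * H (inside Vec.∷ (S ∪ ⊥))) (subsets n) + sumₗ (λ S → 1ℚ * H (inside Vec.∷ (S ∪ ⊥))) (subsets n)
    ≡⟨ cong₂ _+_ (sumₗ-cong (λ S → trans (ℚ.*-zeroˡ (H (inside Vec.∷ (S ∪ ⊥))))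
          (sym (ℚ.*-zeroˡ (H (outside Vec.∷ S))))) (subsets n))
                 (sumₗ-cong (λ S → cong (λ T → 1ℚ * H (inside Vec.∷ T)) (∪-identityʳ S)) (subsets n)) ⟩
  sumₗ (λ S → 0ℚ * H (outside Vec.∷ S)) (subsets n) + sumₗ (λ S → 1ℚ * H (inside Vec.∷ S)) (subsets n)
    ≡⟨ sumₗ-subsets {n} (λ T → 𝟙 (zero ∈? T) * H T) ⟨
  sumₗ (λ T → 𝟙 (zero ∈? T) * H T) (subsets (suc n)) ∎
  where open ≡-Reasoning
sumₗ-insert {suc n} (suc x) H = begin
  sumₗ (λ S → 𝟙 (¬? (suc x ∈? S)) * H (S ∪ ⁅ suc x ⁆)) (subsets (suc n))
    ≡⟨ sumₗ-subsets {n} (λ S → 𝟙 (¬? (suc x ∈? S)) * H (S ∪ ⁅ suc x ⁆)) ⟩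
  sumₗ (λ S → 𝟙 (¬? (x ∈? S)) * H (outside Vec.∷ (S ∪ ⁅ x ⁆))) (subsets n)
    + sumₗ (λ S → 𝟙 (¬? (x ∈? S)) * H (inside Vec.∷ (S ∪ ⁅ x ⁆))) (subsets n)
    ≡⟨ cong₂ _+_ (sumₗ-insert x (H ∘ (outside Vec.∷_))) (sumₗ-insert x (H ∘ (inside Vec.∷_))) ⟩
  sumₗ (λ T → 𝟙 (x ∈? T) * H (outside Vec.∷ T)) (subsets n) + sumₗ (λ T → 𝟙 (x ∈? T) * H (inside Vec.∷ T)) (subsets n)
    ≡⟨ sumₗ-subsets {n} (λ T → 𝟙 (suc x ∈? T) * H T) ⟨
  sumₗ (λ T → 𝟙 (suc x ∈? T) * H T) (subsets (suc n)) ∎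
  where open ≡-Reasoning

sum-∈≡card : ∀ {n} (T : Subset n) → sum (λ x → 𝟙 (x ∈? T)) ≡ natℚ ∣ T ∣
sum-∈≡card Vec.[] = refl
sum-∈≡card (outside Vec.∷ T) = trans (ℚ.+-identityˡ _) (sum-∈≡card T)
sum-∈≡card (inside  Vec.∷ T) = cong (_+_ 1ℚ) (sum-∈≡card T)

∣∣≡0⇒≡⊥ : ∀ {n} {S : Subset n} → ∣ S ∣ ≡ 0 → S ≡ ⊥
∣∣≡0⇒≡⊥ {n} {S} ∣S∣≡0 = sym (⊆∧∣∣≥⇒≡ (⊆-min S) (subst (_≤ ∣ ⊥ {n} ∣) (sym ∣S∣≡0) ℕ.z≤n))

factorial : ℕ → ℚ
factorial zero    = 1ℚ
factorial (suc j) = natℚ (suc j) * factorial j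

module Levels {n} (ω : Vector n) where
  open Derivatives ω
  open ≡-Reasoning

  level : ℕ → (Subset n → ℚ) → ℚ
  level j F = sumₗ (λ S → 𝟙 (∣ S ∣ ℕ.≟ j) * (F S * monomial ω S)) (subsets n)

  level-zero : ∀ F → level 0 F ≡ F ⊥
  level-zero F = begin
    level 0 F
      ≡⟨ sumₗ-cong (λ S → cong (_* (F S * monomial ω S)) (𝟙-cong (∣ S ∣ ℕ.≟ 0) (Vec.≡-dec Bool._≟_ S ⊥)
           ∣∣≡0⇒≡⊥ (λ S≡⊥ → trans (cong ∣_∣ S≡⊥) (∣⊥∣≡0 n)))) (subsets n) ⟩
    sumₗ (λ S → 𝟙 (Vec.≡-dec Bool._≟_ S ⊥) * (F S * monomial ω S)) (subsets n)
      ≡⟨ sumₗ-subsets-δ ⊥ (λ S → F S * monomial ω S) ⟩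
    F ⊥ * monomial ω ⊥
      ≡⟨ trans (cong (F ⊥ *_) (monomial-⊥ ω)) (ℚ.*-identityʳ (F ⊥)) ⟩
    F ⊥ ∎

  -- Double counting of the pairs x ∈ T with |T| = j + 1.
  level-∂ : ∀ j F → level j (∂ F) ≡ natℚ (suc j) * level (suc j) F
  level-∂ j F = begin
    sumₗ (λ S → 𝟙 (∣ S ∣ ℕ.≟ j) * (sum (λ x → δ x F S) * monomial ω S)) (subsets n)
      ≡⟨ sumₗ-cong (λ S → begin
           𝟙 (∣ S ∣ ℕ.≟ j) * (sum (λ x → δ x F S) * monomial ω S)
             ≡⟨ solve 3 (λ i s w → i :* (s :* w) := (i :* w) :* s) refl (𝟙 (∣ S ∣ ℕ.≟ j)) (sum (λ x → δ x F S)) (monomial ω S) ⟩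
           (𝟙 (∣ S ∣ ℕ.≟ j) * monomial ω S) * sum (λ x → δ x F S)
             ≡⟨ *-distribˡ-sum (𝟙 (∣ S ∣ ℕ.≟ j) * monomial ω S) (λ x → δ x F S) ⟩
           sum (λ x → (𝟙 (∣ S ∣ ℕ.≟ j) * monomial ω S) * δ x F S)
             ≡⟨ sum-cong-≗ (λ x → shift S x) ⟩
           sum (λ x → 𝟙 (¬? (x ∈? S)) * H (S ∪ ⁅ x ⁆)) ∎) (subsets n) ⟩
    sumₗ (λ S → sum (λ x → 𝟙 (¬? (x ∈? S)) * H (S ∪ ⁅ x ⁆))) (subsets n)
      ≡⟨ sum-sumₗ-comm (λ S x → 𝟙 (¬? (x ∈? S)) * H (S ∪ ⁅ x ⁆)) (subsets n) ⟨
    sum (λ x → sumₗ (λ S → 𝟙 (¬? (x ∈? S)) * H (S ∪ ⁅ x ⁆)) (subsets n))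
      ≡⟨ sum-cong-≗ (λ x → sumₗ-insert x H) ⟩
    sum (λ x → sumₗ (λ T → 𝟙 (x ∈? T) * H T) (subsets n))
      ≡⟨ sum-sumₗ-comm (λ T x → 𝟙 (x ∈? T) * H T) (subsets n) ⟩
    sumₗ (λ T → sum (λ x → 𝟙 (x ∈? T) * H T)) (subsets n)
      ≡⟨ sumₗ-cong (λ T → begin
           sum (λ x → 𝟙 (x ∈? T) * H T)  ≡⟨ sum-cong-≗ (λ x → ℚ.*-comm (𝟙 (x ∈? T)) (H T)) ⟩
           sum (λ x → H T * 𝟙 (x ∈? T))  ≡⟨ *-distribˡ-sum (H T) (λ x → 𝟙 (x ∈? T)) ⟨
           H T * sum (λ x → 𝟙 (x ∈? T))  ≡⟨ cong (H T *_) (sum-∈≡card T) ⟩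
           H T * natℚ ∣ T ∣              ≡⟨ at-level T ⟩
           natℚ (suc j) * H T            ∎) (subsets n) ⟩
    sumₗ (λ T → natℚ (suc j) * H T) (subsets n)
      ≡⟨ sumₗ-*ˡ (natℚ (suc j)) H (subsets n) ⟨
    natℚ (suc j) * level (suc j) F ∎
    where
    H : Subset n → ℚ
    H T = 𝟙 (∣ T ∣ ℕ.≟ suc j) * (F T * monomial ω T)

    at-level : ∀ T → H T * natℚ ∣ T ∣ ≡ natℚ (suc j) * H T
    at-level T = by-cases (∣ T ∣ ℕ.≟ suc j)
      where
      by-cases : Dec (∣ T ∣ ≡ suc j) → H T * natℚ ∣ T ∣ ≡ natℚ (suc j) * H T
      by-cases (yes e) = trans (ℚ.*-comm (H T) (natℚ ∣ T ∣)) (cong (λ t → natℚ t * H T) e)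
      by-cases (no ¬e) = trans (cong (_* natℚ ∣ T ∣) H≡0) (trans (ℚ.*-zeroˡ (natℚ ∣ T ∣))
        (sym (trans (cong (natℚ (suc j) *_) H≡0) (ℚ.*-zeroʳ (natℚ (suc j))))))
        where
        H≡0 : H T ≡ 0ℚ
        H≡0 = trans (cong (_* (F T * monomial ω T)) (𝟙-no (∣ T ∣ ℕ.≟ suc j) ¬e)) (ℚ.*-zeroˡ (F T * monomial ω T))

    shift : ∀ S x → (𝟙 (∣ S ∣ ℕ.≟ j) * monomial ω S) * δ x F S ≡ 𝟙 (¬? (x ∈? S)) * H (S ∪ ⁅ x ⁆)
    shift S x = by-cases (x ∈? S)
      where
      by-cases : Dec (x ∈ S) → (𝟙 (∣ S ∣ ℕ.≟ j) * monomial ω S) * δ x F S ≡ 𝟙 (¬? (x ∈? S)) * H (S ∪ ⁅ x ⁆)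
      by-cases (yes x∈S) = trans
        (cong (λ k → (𝟙 (∣ S ∣ ℕ.≟ j) * monomial ω S) * (k * F (S ∪ ⁅ x ⁆))) (κ-∈ x∈S)) (trans
        (solve 2 (λ a b → a :* (con 0ℚ :* b) := con 0ℚ) refl (𝟙 (∣ S ∣ ℕ.≟ j) * monomial ω S) (F (S ∪ ⁅ x ⁆)))
        (sym (trans (cong (_* H (S ∪ ⁅ x ⁆)) (𝟙-no (¬? (x ∈? S)) (λ x∉S → x∉S x∈S))) (ℚ.*-zeroˡ (H (S ∪ ⁅ x ⁆))))))
      by-cases (no x∉S) = begin
        (𝟙 (∣ S ∣ ℕ.≟ j) * monomial ω S) * (κ x S * F (S ∪ ⁅ x ⁆))
          ≡⟨ cong₂ (λ i k → (i * monomial ω S) * (k * F (S ∪ ⁅ x ⁆)))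
               (𝟙-cong (∣ S ∣ ℕ.≟ j) (∣ S ∪ ⁅ x ⁆ ∣ ℕ.≟ suc j) (λ e → trans (∣insert∣ x∉S) (cong suc e))
                  (λ e → ℕ.suc-injective (trans (sym (∣insert∣ x∉S)) e))) (κ-∉ x∉S) ⟩
        (𝟙 (∣ S ∪ ⁅ x ⁆ ∣ ℕ.≟ suc j) * monomial ω S) * (ω x * F (S ∪ ⁅ x ⁆))
          ≡⟨ solve 4 (λ i w o f → (i :* w) :* (o :* f) := con 1ℚ :* (i :* (f :* (o :* w)))) refl
               (𝟙 (∣ S ∪ ⁅ x ⁆ ∣ ℕ.≟ suc j)) (monomial ω S) (ω x) (F (S ∪ ⁅ x ⁆)) ⟩
        1ℚ * (𝟙 (∣ S ∪ ⁅ x ⁆ ∣ ℕ.≟ suc j) * (F (S ∪ ⁅ x ⁆) * (ω x * monomial ω S)))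
          ≡⟨ cong₂ (λ i w → i * (𝟙 (∣ S ∪ ⁅ x ⁆ ∣ ℕ.≟ suc j) * (F (S ∪ ⁅ x ⁆) * w)))
               (𝟙-yes (¬? (x ∈? S)) x∉S) (monomial-insert ω x∉S) ⟨
        𝟙 (¬? (x ∈? S)) * H (S ∪ ⁅ x ⁆) ∎

-- Natural numbers and factorials in ℚ

natℚ-nonneg : ∀ j → 0ℚ ℚ.≤ natℚ j
natℚ-nonneg zero    = ℚ.≤-refl
natℚ-nonneg (suc j) = ℚ.+-mono-≤ (ℚ.nonNegative⁻¹ 1ℚ) (natℚ-nonneg j)

natℚ-mono : ∀ {i j} → i ≤ j → natℚ i ℚ.≤ natℚ j
natℚ-mono {j = j} ℕ.z≤n = natℚ-nonneg j
natℚ-mono (ℕ.s≤s i≤j)   = ℚ.+-monoʳ-≤ 1ℚ (natℚ-mono i≤j)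

natℚ-pos : ∀ j → 0ℚ ℚ.< natℚ (suc j)
natℚ-pos j = ℚ.+-mono-<-≤ (ℚ.positive⁻¹ 1ℚ) (natℚ-nonneg j)

factorial-pos : ∀ j → 0ℚ ℚ.< factorial j
factorial-pos zero    = ℚ.positive⁻¹ 1ℚ
factorial-pos (suc j) = *-pos (natℚ-pos j) (factorial-pos j)

natℚ≡/1 : ∀ j → natℚ j ≡ + j ℚ./ 1
natℚ≡/1 zero    = refl
natℚ≡/1 (suc j) = ℚ.toℚᵘ-injective (begin
  ℚ.toℚᵘ (1ℚ + natℚ j)                     ≈⟨ ℚ.toℚᵘ-homo-+ 1ℚ (natℚ j) ⟩
  ℚᵘ.1ℚᵘ ℚᵘ.+ ℚ.toℚᵘ (natℚ j)              ≡⟨ cong (λ q → ℚᵘ.1ℚᵘ ℚᵘ.+ ℚ.toℚᵘ q) (natℚ≡/1 j) ⟩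
  ℚᵘ.1ℚᵘ ℚᵘ.+ ℚ.toℚᵘ (+ j ℚ./ 1)           ≈⟨ ℚᵘ.+-congʳ ℚᵘ.1ℚᵘ (ℚ.toℚᵘ-fromℚᵘ (ℚᵘ.mkℚᵘ (+ j) 0)) ⟩
  ℚᵘ.1ℚᵘ ℚᵘ.+ ℚᵘ.mkℚᵘ (+ j) 0              ≈⟨ ℚᵘ.*≡* (cong (λ z → (+ 1 ℤ.+ z) ℤ.* + 1) (ℤ.*-identityʳ (+ j))) ⟩
  ℚᵘ.mkℚᵘ (+ suc j) 0                      ≈⟨ ℚ.toℚᵘ-fromℚᵘ (ℚᵘ.mkℚᵘ (+ suc j) 0) ⟨
  ℚ.toℚᵘ (+ suc j ℚ./ 1)                   ∎)
  where open ℚᵘ.≃-Reasoning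

-- Positive weights

natℚ*recip≡1 : ∀ q → natℚ (suc q) * recip (+ suc q) ≡ 1ℚ
natℚ*recip≡1 q = ℚ.toℚᵘ-injective (begin
  ℚ.toℚᵘ (natℚ (suc q) * recip (+ suc q))           ≈⟨ ℚ.toℚᵘ-homo-* (natℚ (suc q)) (recip (+ suc q)) ⟩
  ℚ.toℚᵘ (natℚ (suc q)) ℚᵘ.* ℚ.toℚᵘ (+ 1 ℚ./ suc q)  ≡⟨ cong (λ p → ℚ.toℚᵘ p ℚᵘ.* ℚ.toℚᵘ (+ 1 ℚ./ suc q)) (natℚ≡/1 (suc q)) ⟩
  ℚ.toℚᵘ (+ suc q ℚ./ 1) ℚᵘ.* ℚ.toℚᵘ (+ 1 ℚ./ suc q)
    ≈⟨ ℚᵘ.*-cong (ℚ.toℚᵘ-fromℚᵘ (ℚᵘ.mkℚᵘ (+ suc q) 0)) (ℚ.toℚᵘ-fromℚᵘ (ℚᵘ.mkℚᵘ (+ 1) q)) ⟩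
  ℚᵘ.mkℚᵘ (+ suc q) 0 ℚᵘ.* ℚᵘ.mkℚᵘ (+ 1) q
    ≈⟨ ℚᵘ.*≡* (trans (ℤ.*-identityʳ (+ suc q ℤ.* + 1))
          (trans (ℤ.*-comm (+ suc q) (+ 1)) (cong (λ z → + 1 ℤ.* + suc z) (sym (ℕ.+-identityʳ q))))) ⟩
  ℚ.toℚᵘ 1ℚ ∎)
  where open ℚᵘ.≃-Reasoning

-- Under the conventions of `recip` the value is 0 at p = 0, 1 at p = 1, and p/(p-1) from p = 2 on.
parallelFactor : ℕ → ℚ
parallelFactor p = 1ℚ + recip (+ p ℤ.- + 1)

1≤parallelFactor : ∀ q → 1ℚ ℚ.≤ parallelFactor (suc q)
1≤parallelFactor zero    = ℚ.≤-refl
1≤parallelFactor (suc q) = subst (ℚ._≤ parallelFactor (suc (suc q))) (ℚ.+-identityʳ 1ℚ)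
  (ℚ.+-monoʳ-≤ 1ℚ (ℚ.nonNegative⁻¹ (+ 1 ℚ./ suc q) {{ℚ.normalize-nonNeg 1 (suc q)}}))

-- From p = 2 on, with c = p/(p-1), both sides agree at N = p, so c is the largest constant that
-- `cone-negative` admits for p classes.
parallelFactor-bound : ∀ q {N} → N ≤ suc q → (parallelFactor (suc q) - 1ℚ) * natℚ N ℚ.≤ parallelFactor (suc q)
parallelFactor-bound zero {N} _ = subst (ℚ._≤ 1ℚ) (sym (ℚ.*-zeroˡ (natℚ N))) (ℚ.nonNegative⁻¹ 1ℚ)
parallelFactor-bound (suc q) {N} N≤ = subst₂ ℚ._≤_
  (solve 2 (λ r n → r :* n := (con 1ℚ :+ r :- con 1ℚ) :* n) refl r (natℚ N)) (begin
    r * natℚ (suc (suc q))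
      ≡⟨ solve 2 (λ r n → r :* (con 1ℚ :+ n) := n :* r :+ r) refl r (natℚ (suc q)) ⟩
    natℚ (suc q) * r + r
      ≡⟨ cong (_+ r) (natℚ*recip≡1 q) ⟩
    1ℚ + r ∎)
  (*-monoˡ-≤ 0≤r (natℚ-mono N≤))
  where
  open ≡-Reasoning
  r : ℚ
  r = recip (+ suc q)
  0≤r : 0ℚ ℚ.≤ r
  0≤r = ℚ.nonNegative⁻¹ (+ 1 ℚ./ suc q) {{ℚ.normalize-nonNeg 1 (suc q)}}

module RationalWeights {n m} {M : Matroid n} {N : Matroid m} (Φ : Morphism M N)
  (ω : Vector n) (ω>0 : ∀ x → 0ℚ ℚ.< ω x) where
  open ≡-Reasoning
  open Levels ω

  Bℚ : ℕ → ℚ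
  Bℚ j = sumₗ (λ S → foldr _*_ 1ℚ (map ω (filter (_∈? S) (allFin n)))) (bases Φ j)

  f : Subset n → ℚ
  f S = 𝟙 (isBasis? Φ S)

  open Derivatives ω

  -- The same functions as `F`, but available without a choice of `T₊`, so that the factorial
  -- identities stand apart from the atlas.
  derivative : ℕ → Subset n → ℚ
  derivative zero    = f
  derivative (suc j) = ∂ (derivative j)

  Bℚ≡level : ∀ j → Bℚ j ≡ level j f
  Bℚ≡level j = trans (sumₗ-filter (λ S → isBasis? Φ S ×-dec (∣ S ∣ ℕ.≟ j))
        (λ S → foldr _*_ 1ℚ (map ω (filter (_∈? S) (allFin n)))) (subsets n))
    (sumₗ-cong (λ S → begin
      𝟙 (isBasis? Φ S ×-dec (∣ S ∣ ℕ.≟ j)) * foldr _*_ 1ℚ (map ω (filter (_∈? S) (allFin n)))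
        ≡⟨ cong₂ _*_ (𝟙-× (isBasis? Φ S) (∣ S ∣ ℕ.≟ j)) (product≡monomial ω S) ⟩
      (𝟙 (isBasis? Φ S) * 𝟙 (∣ S ∣ ℕ.≟ j)) * monomial ω S
        ≡⟨ solve 3 (λ b i w → (b :* i) :* w := i :* (b :* w)) refl (𝟙 (isBasis? Φ S)) (𝟙 (∣ S ∣ ℕ.≟ j)) (monomial ω S) ⟩
      𝟙 (∣ S ∣ ℕ.≟ j) * (f S * monomial ω S) ∎) (subsets n))

  -- Each `∂` is traded for one level more and a factor equal to the new size, so the factors
  -- accumulate to (i+j)!/i!. The denominator is kept on the left to avoid division.
  level-derivative : ∀ j i → level i (derivative j) * factorial i ≡ factorial (i ℕ.+ j) * level (i ℕ.+ j) f
  level-derivative zero i = trans (ℚ.*-comm (level i f) (factorial i))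
    (cong (λ k → factorial k * level k f) (sym (ℕ.+-identityʳ i)))
  level-derivative (suc j) i = begin
    level i (∂ (derivative j)) * factorial i
      ≡⟨ cong (_* factorial i) (level-∂ i (derivative j)) ⟩
    (natℚ (suc i) * level (suc i) (derivative j)) * factorial i
      ≡⟨ solve 3 (λ a l p → (a :* l) :* p := l :* (a :* p)) refl (natℚ (suc i)) (level (suc i) (derivative j)) (factorial i) ⟩
    level (suc i) (derivative j) * factorial (suc i)
      ≡⟨ level-derivative j (suc i) ⟩
    factorial (suc i ℕ.+ j) * level (suc i ℕ.+ j) f
      ≡⟨ cong (λ k → factorial k * level k f) (ℕ.+-suc i j) ⟨
    factorial (i ℕ.+ suc j) * level (i ℕ.+ suc j) f ∎

  derivative-⊥ : ∀ j → derivative j ⊥ ≡ factorial j * Bℚ j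
  derivative-⊥ j = begin
    derivative j ⊥                 ≡⟨ level-zero (derivative j) ⟨
    level 0 (derivative j)         ≡⟨ ℚ.*-identityʳ (level 0 (derivative j)) ⟨
    level 0 (derivative j) * 1ℚ    ≡⟨ level-derivative j 0 ⟩
    factorial j * level j f        ≡⟨ cong (factorial j *_) (Bℚ≡level j) ⟨
    factorial j * Bℚ j             ∎

  module _ (K : ℕ) (T₊ : Subset n) (T₊-basis : IsBasis Φ T₊) (∣T₊∣≡ : ∣ T₊ ∣ ≡ suc (suc K)) where
    open Atlas Φ f (λ {S} → 𝟙-yes (isBasis? Φ S)) (λ {S} → 𝟙-no (isBasis? Φ S)) ω ω>0 T₊ T₊-basis

    F≡derivative : ∀ j S → F j S ≡ derivative j S
    F≡derivative zero    S = refl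
    F≡derivative (suc j) S = sum-cong-≗ (λ x → cong (κ x S *_) (F≡derivative j (S ∪ ⁅ x ⁆)))

    F-⊥ : ∀ j → F j ⊥ ≡ factorial j * Bℚ j
    F-⊥ j = trans (F≡derivative j ⊥) (derivative-⊥ j)

    module _ (q : ℕ) (Par-bound : ∀ {S} → IsBasis Φ S → ∣ S ∣ ≡ K → length (Par M S) ≤ suc q) where

      c : ℚ
      c = parallelFactor (suc q)

      e₀ : Vector (suc n)
      e₀ zero    = 1ℚ
      e₀ (suc _) = 0ℚ

      dot-e₀ : ∀ v → dot e₀ v ≡ v zero
      dot-e₀ v = trans (cong₂ _+_ (ℚ.*-identityˡ (v zero)) (sum-zero (λ x → ℚ.*-zeroˡ (v (suc x))))) (ℚ.+-identityʳ (v zero))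

      discriminant : (c * F K ⊥) * F (suc (suc K)) ⊥ ℚ.≤ F (suc K) ⊥ * F (suc K) ⊥
      discriminant = subst₂ ℚ._≤_
        (cong₂ _*_ (trans (dot-e₀ (A c K ⊥ · e₀)) (trans (dot-comm (A c K ⊥ zero) e₀) (dot-e₀ (A c K ⊥ zero))))
              (form-ones c K ⊥))
        (cong (λ e → e * e) (trans (dot-e₀ (A c K ⊥ · ones)) (·ones (A c K ⊥) zero)))
        (reverse-Cauchy-Schwarz (A-sym c K ⊥)
          (A-negative c (1≤parallelFactor q) K (ℕ.≤-reflexive (trans (ℕ.+-comm K 2) (sym ∣T₊∣≡)))
            (λ S-basis ∣S∣≡ → parallelFactor-bound q (Par-bound S-basis ∣S∣≡)) K ⊥ (cong (ℕ._+ K) (∣⊥∣≡0 n)))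
          ones (subst (0ℚ ℚ.≤_) (sym (form-ones c K ⊥)) (F-nonneg (suc (suc K)) ⊥)) e₀)

      -- With k = K + 1, the ratio of (k-1)! (k+1)! to (k!)² is 1 + 1/k; this is the origin of the
      -- first factor. To expose the common factor (k!)², the 1 in k + 1 is rewritten as k times
      -- 1/k.
      nontrivial-case : (1ℚ + recip (+ suc K)) * c * Bℚ K * Bℚ (suc (suc K)) ℚ.≤ Bℚ (suc K) * Bℚ (suc K)
      nontrivial-case = *-cancelˡ-≤ (*-pos (*-pos (factorial-pos K) (factorial-pos K)) (natℚ-pos K))
        (*-cancelˡ-≤ (natℚ-pos K) (subst₂ ℚ._≤_ lhs rhs discriminant))
        where
        φ a r B₀ B₁ B₂ : ℚ
        φ = factorial K
        a = natℚ (suc K)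
        r = recip (+ suc K)
        B₀ = Bℚ K
        B₁ = Bℚ (suc K)
        B₂ = Bℚ (suc (suc K))

        lhs : (c * F K ⊥) * F (suc (suc K)) ⊥ ≡ a * (φ * φ * a * ((1ℚ + r) * c * B₀ * B₂))
        lhs = begin
          (c * F K ⊥) * F (suc (suc K)) ⊥
            ≡⟨ cong₂ (λ x y → (c * x) * y) (F-⊥ K) (F-⊥ (suc (suc K))) ⟩
          (c * (φ * B₀)) * (((1ℚ + a) * (a * φ)) * B₂)
            ≡⟨ cong (λ e → (c * (φ * B₀)) * (((e + a) * (a * φ)) * B₂)) (natℚ*recip≡1 K) ⟨
          (c * (φ * B₀)) * (((a * r + a) * (a * φ)) * B₂)
            ≡⟨ solve 6 (λ c φ x y a r → (c :* (φ :* x)) :* (((a :* r :+ a) :* (a :* φ)) :* y) :=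
                 a :* (φ :* φ :* a :* ((con 1ℚ :+ r) :* c :* x :* y))) refl c φ B₀ B₂ a r ⟩
          a * (φ * φ * a * ((1ℚ + r) * c * B₀ * B₂)) ∎

        rhs : F (suc K) ⊥ * F (suc K) ⊥ ≡ a * (φ * φ * a * (B₁ * B₁))
        rhs = begin
          F (suc K) ⊥ * F (suc K) ⊥          ≡⟨ cong (λ e → e * e) (F-⊥ (suc K)) ⟩
          ((a * φ) * B₁) * ((a * φ) * B₁)    ≡⟨ solve 3 (λ a φ b → ((a :* φ) :* b) :* ((a :* φ) :* b) :=
                                                  a :* (φ :* φ :* a :* (b :* b))) refl a φ B₁ ⟩
          a * (φ * φ * a * (B₁ * B₁))        ∎

  rational-case : ∀ K → (1ℚ + recip (+ suc K)) * (1ℚ + recip (+ maxPar Φ K ℤ.- + 1)) * Bℚ K * Bℚ (suc (suc K))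
    ℚ.≤ Bℚ (suc K) * Bℚ (suc K)
  rational-case K = by-largest (bases Φ (suc (suc K))) refl
    where
    C = 1ℚ + recip (+ suc K)

    Par-bound : ∀ {S} → IsBasis Φ S → ∣ S ∣ ≡ K → length (Par M S) ≤ maxPar Φ K
    Par-bound {S} S-basis ∣S∣≡ = All.lookup (xs≤max 0 (map (λ S → length (Par M S)) (bases Φ K)))
      (∈-map⁺ (λ S → length (Par M S)) (∈-filter⁺ (λ S → isBasis? Φ S ×-dec (∣ S ∣ ℕ.≟ K)) (∈-subsets S) (S-basis , ∣S∣≡)))

    by-maxPar : ∀ T₊ → IsBasis Φ T₊ → ∣ T₊ ∣ ≡ suc (suc K) → ∀ p →
      (∀ {S} → IsBasis Φ S → ∣ S ∣ ≡ K → length (Par M S) ≤ p) →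
      C * parallelFactor p * Bℚ K * Bℚ (suc (suc K)) ℚ.≤ Bℚ (suc K) * Bℚ (suc K)
    by-maxPar T₊ T₊-basis ∣T₊∣≡ (suc q) bound = nontrivial-case K T₊ T₊-basis ∣T₊∣≡ q bound
    -- recip (0 - 1) = -1, so the factor of a vanishing p is 0.
    by-maxPar T₊ T₊-basis ∣T₊∣≡ zero    bound = subst (ℚ._≤ Bℚ (suc K) * Bℚ (suc K))
      (solve 3 (λ c x y → con 0ℚ := c :* con 0ℚ :* x :* y) refl C (Bℚ K) (Bℚ (suc (suc K))))
      (square-nonneg (Bℚ (suc K)))

    -- If the list is empty, B(k+1) and with it the left side vanish. Otherwise its head serves as
    -- `T₊`.
    by-largest : ∀ Ts → bases Φ (suc (suc K)) ≡ Ts →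
      C * parallelFactor (maxPar Φ K) * Bℚ K * Bℚ (suc (suc K)) ℚ.≤ Bℚ (suc K) * Bℚ (suc K)
    by-largest [] none = subst (ℚ._≤ Bℚ (suc K) * Bℚ (suc K))
      (sym (trans (cong (C * parallelFactor (maxPar Φ K) * Bℚ K *_)
        (cong (sumₗ (λ S → foldr _*_ 1ℚ (map ω (filter (_∈? S) (allFin n))))) none))
        (ℚ.*-zeroʳ (C * parallelFactor (maxPar Φ K) * Bℚ K))))
      (square-nonneg (Bℚ (suc K)))
    by-largest (T₊ ∷ _) some =
      let _ , T₊-basis , ∣T₊∣≡ = ∈-filter⁻ (λ S → isBasis? Φ S ×-dec (∣ S ∣ ℕ.≟ suc (suc K))) {xs = subsets n}
                                   (subst (T₊ List.∈_) (sym some) (here refl))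
      in  by-maxPar T₊ T₊-basis ∣T₊∣≡ (maxPar Φ K) Par-bound

-- Passage to real weights

eventually-all : ∀ {n} {P : Fin n → ℕ → Set} → (∀ x → ∃ λ N → ∀ i → N ≤ i → P x i) →
  ∃ λ N → ∀ i → N ≤ i → ∀ x → P x i
eventually-all {zero}  _ = 0 , λ _ _ ()
eventually-all {suc n} {P} ev with ev zero | eventually-all (ev ∘ suc)
... | N₀ , h₀ | N₁ , h₁ = N₀ ℕ.⊔ N₁ , λ i N≤i → λ where
  zero    → h₀ i (ℕ.m⊔n≤o⇒m≤o N₀ N₁ N≤i)
  (suc x) → h₁ i (ℕ.m⊔n≤o⇒n≤o N₀ N₁ N≤i) x

seq-sumᴿ : ∀ {A : Set} (g : A → ℝ) xs i → seq (sumᴿ (map g xs)) i ≡ sumₗ (λ x → seq (g x) i) xs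
seq-sumᴿ g []       i = refl
seq-sumᴿ g (x ∷ xs) i = cong (_+_ (seq (g x) i)) (seq-sumᴿ g xs i)

seq-prodᴿ : ∀ {A : Set} (g : A → ℝ) xs i → seq (prodᴿ (map g xs)) i ≡ foldr _*_ 1ℚ (map (λ x → seq (g x) i) xs)
seq-prodᴿ g []       i = refl
seq-prodᴿ g (x ∷ xs) i = cong (seq (g x) i *_) (seq-prodᴿ g xs i)

theorem1p16 : ∀ {n m : ℕ} (M : Matroid n) (N : Matroid m) (Φ : Morphism M N)
    (ω : Fin n → ℝ) → (∀ x → 0ᴿ <ᴿ ω x) →
    ∀ (k : ℕ) → 1 ≤ k → k < rk M →
    fromℚ (1ℚ ℚ.+ recip (+ k))
    *ᴿ fromℚ (1ℚ ℚ.+ recip (+ maxPar Φ (k ∸ 1) ℤ.- + 1))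
    *ᴿ B Φ ω (k ∸ 1) *ᴿ B Φ ω (suc k)
    ≤ᴿ B Φ ω k *ᴿ B Φ ω k
theorem1p16 {n} M N Φ ω ω>0 (suc K) _ _ ε 0<ε =
  -- Positivity of a real weight gives a positive rational lower bound from some index on; as there
  -- are finitely many weights, one index serves them all.
  let N₀ , positive = eventually-all (λ x → let ε , 0<ε , N , h = ω>0 x in
        N , λ i N≤i → ℚ.<-≤-trans (subst (0ℚ ℚ.<_) (sym (ℚ.+-identityˡ ε)) 0<ε) (h i N≤i))
  in  N₀ , λ i N₀≤i → termwise i (positive i N₀≤i)
  where
  termwise : ∀ i → (∀ x → 0ℚ ℚ.< seq (ω x) i) →
    (1ℚ + recip (+ suc K)) * (1ℚ + recip (+ maxPar Φ K ℤ.- + 1)) * seq (B Φ ω K) i * seq (B Φ ω (suc (suc K))) i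
      ℚ.≤ seq (B Φ ω (suc K)) i * seq (B Φ ω (suc K)) i + ε
  termwise i ωᵢ>0 = subst₂ ℚ._≤_
      (cong₂ (λ x y → (1ℚ + recip (+ suc K)) * (1ℚ + recip (+ maxPar Φ K ℤ.- + 1)) * x * y) (seq-B K) (seq-B (suc (suc K))))
      (cong (λ x → x * x + ε) (seq-B (suc K)))
      (ℚ.≤-trans (rational-case K) (subst (ℚ._≤ Bℚ (suc K) * Bℚ (suc K) + ε) (ℚ.+-identityʳ (Bℚ (suc K) * Bℚ (suc K)))
        (ℚ.+-monoʳ-≤ (Bℚ (suc K) * Bℚ (suc K)) (ℚ.<⇒≤ 0<ε))))
    where
    open RationalWeights Φ (λ x → seq (ω x) i) ωᵢ>0
    -- Sums and products of reals are formed termwise, so the i-th term of `B` is the same sum for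
    -- the i-th terms of the weights.
    seq-B : ∀ j → Bℚ j ≡ seq (B Φ ω j) i
    seq-B j = sym (trans (seq-sumᴿ (weight Φ ω) (bases Φ j) i)
      (sumₗ-cong (λ S → seq-prodᴿ ω (filter (_∈? S) (allFin n)) i) (bases Φ j)))
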